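{- Fix an integer $r\ge 2$ and a real $K>1$. Let $p=p(n)$ be integer-valued with $$p\to\infty,\qquad p=o((\log n)^r)\qquad (n\to\infty).$$ (1) (Lower bound.) There is a constant $c=c(r,K)>0$ such that for all sufficiently large $n$, every multiplicatively independent set $A_n\subseteq\{2,\dots,n-1\}$ of $r$ generators with $\gcd(A_n)=1$, $\max A_n\le(\min A_n)^K$ and $|H_{A_n}(n)|\le p$ satisfies $$W_n(H_{A_n}(n))\ \ge\ n\exp\!\left(c\,\frac{\log n}{p^{1/r}}\right)\quad\text{and}\quad C_n(H_{A_n}(n))\ \ge\ n\exp\!\left(c\,\frac{\log n}{p^{1/r}}\right).$$ (2) (Upper bound.) Conversely, for all sufficiently large $n$ there are pairwise coprime, multiplicatively independent sets $A_n\subseteq\{2,\dots,n-1\}$ of $r$ generators with $\max A_n\le(\min A_n)^K$ such that $$|H_{A_n}(n)|=\Theta_r(p),\qquad |H_{A_n}(n)|\le p,$$ and $$C_n(H_{A_n}(n))\ \le\ np\,\exp\!\left(O_r\!\left(\frac{\log n}{p^{1/r}}\right)\right).$$ (3) If, in addition, $\log p=o\!\left(\log n/p^{1/r}\right)$, then the minimum of $W_n(H_{A}(n))$ and the minimum of $C_n(H_{A}(n))$, each taken over all multiplicatively independent sets $A\subseteq\{2,\dots,n-1\}$ of $r$ generators with $\gcd(A)=1$, $\max A\le(\min A)^K$ and $|H_A(n)|\le p$, are both $$n\exp\!\left(\Theta_{r,K}\!\left(\frac{\log n}{p^{1/r}}\right)\right).$$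
   Context: Shellsort: a gap sequence is a decreasing sequence of positive integers $H=(h_1>h_2>\cdots>h_p=1)$. On an array of $n$ distinct keys (a permutation), pass $j$ runs ordinary insertion sort separately on each $h_j$-chain, i.e. on each set of positions with the same remainder modulo $h_j$: the key is repeatedly compared with the key $h_j$ positions before it, exchanging the two if they are out of order, until no exchange is needed or the start of the chain is reached. Passes are run for $j=1,2,\dots,p$. $W_n(H)$ and $C_n(H)$ are the worst-case (over all inputs of $n$ keys) total numbers of exchanges and of comparisons. Product grids: for a set $A=\{a_1,\dots,a_r\}\subseteq\{2,\dots,n-1\}$ of generators, $H_A(n)=\{\prod_{i=1}^r a_i^{u_i}<n:\ u_i\in\mathbb N_0\}$ (as a set, duplicates removed), used as a gap sequence in decreasing order. The set $A$ is multiplicatively independent if distinct exponent vectors $(u_1,\dots,u_r)\in\mathbb N_0^r$ give distinct products $\prod a_i^{u_i}$. Logarithms are natural. Subscripts on $O,\Theta$ indicate what the implied positive constants depend on. -}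

module Defs where

open import Data.Bool using (if_then_else_)
open import Data.Nat as ℕ using (ℕ; zero; suc)
import Data.Nat.Properties as ℕ
import Data.Nat.Coprimality as Coprime
open import Data.Nat.GCD using (gcd)
open import Data.Integer as ℤ using (ℤ; +_; -[1+_])
import Data.Integer.Properties as ℤ
open import Data.Rational
open import Data.Rational.Properties
import Data.Rational.Unnormalised as ℚᵘ
import Data.Rational.Unnormalised.Properties as ℚᵘ
open import Data.Rational.Solver
open import Data.List as List using (List; []; _∷_; _++_; length; concatMap; filter; foldl; upTo; downFrom; cartesianProductWith)
open import Data.List.Extrema.Nat using (max; min)
open import Data.Nat.ListAction using (product)
open import Data.List.Membership.Propositional using (_∈_; find; lose)
open import Data.List.Membership.Propositional.Properties
open import Data.List.Relation.Unary.Any using (here; there; any?)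
open import Data.List.Relation.Binary.Permutation.Propositional as Perm using (_↭_; ↭-sym)
open import Data.List.Relation.Binary.Permutation.Propositional.Properties using (∈-resp-↭; drop-mid; ↭-empty-inv)
open import Data.Vec as Vec using (Vec; []; _∷_; toList; zipWith)
open import Data.Vec.Relation.Unary.All using (All; []; _∷_)
open import Data.Vec.Relation.Unary.AllPairs using (AllPairs)
open import Data.Vec.Relation.Unary.Unique.Propositional using (Unique)
open import Data.Product using (∃; _,_; _×_; proj₁; proj₂)
open import Data.Sum using (inj₁; inj₂)
open import Function using (_∘_; _⇔_; mk⇔)
open import Relation.Binary.PropositionalEquality hiding (J)
open +-*-Solver using (solve; _:+_; _:*_; _:-_; :-_; _:=_; con)

private
  variable
    a b c x : ℚ
    f g : ℕ → ℚ

Eventually : (ℕ → Set) → Set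
Eventually P = ∃ λ N → ∀ n → N ℕ.≤ n → P n

Cauchy : (ℕ → ℚ) → Set
Cauchy f = ∀ ε → 0ℚ < ε →
           ∃ λ N → ∀ m n → N ℕ.≤ m → N ℕ.≤ n → ∣ f m - f n ∣ ≤ ε

module CauchyLemmas where

  ι : ℕ → ℚ
  ι n = + n / 1

  -- u k = 1/(k+1)
  u : ℕ → ℚ
  u k = + 1 / suc k

  ι≡mk : ∀ n → ι n ≡ mkℚ (+ n) 0 (Coprime.sym (Coprime.1-coprimeTo n))
  ι≡mk n = normalize-coprime (Coprime.sym (Coprime.1-coprimeTo n))

  u≡mk : ∀ k → u k ≡ mkℚ (+ 1) k (Coprime.1-coprimeTo (suc k))
  u≡mk k = normalize-coprime (Coprime.1-coprimeTo (suc k))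

  ι-* : ∀ m n → ι (m ℕ.* n) ≡ ι m * ι n
  ι-* m n rewrite ι≡mk m | ι≡mk n = cong (_/ 1) (ℤ.pos-* m n)

  ι-suc : ∀ n → ι (suc n) ≡ 1ℚ + ι n
  ι-suc n rewrite ι≡mk n = cong (_/ 1) (cong (λ z → + 1 ℤ.+ z) (sym (ℤ.*-identityʳ (+ n))))

  uι : ∀ k → u k * ι (suc k) ≡ 1ℚ
  uι k rewrite ι≡mk (suc k) | u≡mk k = toℚᵘ-injective (ℚᵘ.≃-trans
    (toℚᵘ-homo-* (mkℚ (+ 1) k (Coprime.1-coprimeTo (suc k))) (mkℚ (+ suc k) 0 (Coprime.sym (Coprime.1-coprimeTo (suc k)))))
    (ℚᵘ.*≡* (cong +_ (ℕ.*-assoc 1 (suc k) 1))))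

  ι-mono : ∀ {m n} → m ℕ.≤ n → ι m ≤ ι n
  ι-mono {m} {n} m≤n rewrite ι≡mk m | ι≡mk n =
    *≤* (ℤ.*-monoʳ-≤-nonNeg (+ 1) (ℤ.+≤+ m≤n))

  0≤ι : ∀ n → 0ℚ ≤ ι n
  0≤ι n = ι-mono {0} {n} ℕ.z≤n

  u-anti : ∀ {j k} → j ℕ.≤ k → u k ≤ u j
  u-anti {j} {k} j≤k rewrite u≡mk k | u≡mk j =
    *≤* (ℤ.*-monoˡ-≤-nonNeg (+ 1) (ℤ.+≤+ (ℕ.s≤s j≤k)))

  0≤u : ∀ k → 0ℚ ≤ u k
  0≤u k rewrite u≡mk k = *≤* (ℤ.+≤+ ℕ.z≤n)

  arch : ∀ q → ∃ λ n → q ≤ ι n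
  arch q@(mkℚ p d-1 _) = ℤ.∣ p ∣ , subst (q ≤_) (sym (ι≡mk ℤ.∣ p ∣)) (*≤* (begin
    p ℤ.* + 1                   ≡⟨ ℤ.*-identityʳ p ⟩
    p                           ≤⟨ i≤∣i∣ p ⟩
    + ℤ.∣ p ∣                   ≤⟨ ℤ.+≤+ (ℕ.m≤m*n ℤ.∣ p ∣ (suc d-1)) ⟩
    + (ℤ.∣ p ∣ ℕ.* suc d-1)     ≡⟨ ℤ.pos-* ℤ.∣ p ∣ (suc d-1) ⟩
    + ℤ.∣ p ∣ ℤ.* + suc d-1     ∎))
    where
    open ℤ.≤-Reasoning
    i≤∣i∣ : ∀ i → i ℤ.≤ + ℤ.∣ i ∣
    i≤∣i∣ (+ n)    = ℤ.≤-refl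
    i≤∣i∣ -[1+ n ] = ℤ.-≤+

  *-monoˡ : 0ℚ ≤ a → b ≤ c → a * b ≤ a * c
  *-monoˡ {a} 0≤a = *-monoˡ-≤-nonNeg a {{nonNegative 0≤a}}

  *-monoʳ : 0ℚ ≤ a → b ≤ c → b * a ≤ c * a
  *-monoʳ {a} 0≤a = *-monoʳ-≤-nonNeg a {{nonNegative 0≤a}}

  0≤* : 0ℚ ≤ a → 0ℚ ≤ b → 0ℚ ≤ a * b
  0≤* {a} {b} 0≤a 0≤b = subst (_≤ a * b) (*-zeroʳ a) (*-monoˡ 0≤a 0≤b)

  0≤+ : 0ℚ ≤ a → 0ℚ ≤ b → 0ℚ ≤ a + b
  0≤+ 0≤a 0≤b = +-mono-≤ 0≤a 0≤b

  0<* : 0ℚ < a → 0ℚ < b → 0ℚ < a * b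
  0<* {a} {b} 0<a 0<b = subst (_< a * b) (*-zeroʳ a)
    (*-monoʳ-<-pos a {{positive 0<a}} 0<b)

  ≤-sub : a ≤ b → 0ℚ ≤ b - a
  ≤-sub {a} {b} a≤b = subst (_≤ b - a) (+-inverseʳ a) (+-monoˡ-≤ (- a) a≤b)

  ≤-add : 0ℚ ≤ b → a ≤ a + b
  ≤-add {b} {a} 0≤b = subst (_≤ a + b) (+-identityʳ a) (+-monoʳ-≤ a 0≤b)

  ∣-∣-sym : ∀ a b → ∣ a - b ∣ ≡ ∣ b - a ∣
  ∣-∣-sym a b = trans (sym (∣-p∣≡∣p∣ (a - b)))
    (cong ∣_∣ (solve 2 (λ a b → :- (a :- b) := b :- a) refl a b))

  ∣-∣-tri : ∀ a b c → ∣ a - c ∣ ≤ ∣ a - b ∣ + ∣ b - c ∣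
  ∣-∣-tri a b c = subst (λ z → ∣ z ∣ ≤ ∣ a - b ∣ + ∣ b - c ∣)
    (solve 3 (λ a b c → (a :- b) :+ (b :- c) := a :- c) refl a b c)
    (∣p+q∣≤∣p∣+∣q∣ (a - b) (b - c))

  half : ∀ ε → 0ℚ < ε → 0ℚ < ½ * ε
  half ε = 0<* {½} (*<* (ℤ.+<+ (ℕ.s≤s ℕ.z≤n)))

  ½+½ : ∀ ε → ½ * ε + ½ * ε ≡ ε
  ½+½ ε = trans (sym (*-distribʳ-+ ε ½ ½)) (*-identityˡ ε)

  -- every positive ε absorbs a fixed factor B
  scale : ∀ B → 0ℚ ≤ B → ∀ ε → 0ℚ < ε → ∃ λ δ → 0ℚ < δ × B * δ ≤ ε
  scale B 0≤B ε 0<ε = δ , 0<* 0<ε 0<v , Bδ≤ε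
    where
    N = proj₁ (arch B)
    v = u N
    δ = ε * v
    0<v : 0ℚ < v
    0<v rewrite u≡mk N = *<* (ℤ.+<+ (ℕ.s≤s ℕ.z≤n))
    Bδ≤ε : B * (ε * v) ≤ ε
    Bδ≤ε = begin
      B * (ε * v)           ≤⟨ *-monoʳ (<⇒≤ (0<* 0<ε 0<v)) (≤-trans (proj₂ (arch B)) (ι-mono (ℕ.n≤1+n N))) ⟩
      ι (suc N) * (ε * v)   ≡⟨ solve 3 (λ n e v → n :* (e :* v) := e :* (v :* n)) refl (ι (suc N)) ε v ⟩
      ε * (v * ι (suc N))   ≡⟨ cong (ε *_) (uι N) ⟩
      ε * 1ℚ                ≡⟨ *-identityʳ ε ⟩
      ε                     ∎
      where open ≤-Reasoning

  -- it is enough to compare later terms with earlier ones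
  ordered : (∀ ε → 0ℚ < ε → ∃ λ N → ∀ m n → N ℕ.≤ m → m ℕ.≤ n → ∣ f n - f m ∣ ≤ ε) → Cauchy f
  ordered {f} h ε 0<ε = proj₁ (h ε 0<ε) , λ m n N≤m N≤n → go m n N≤m N≤n (ℕ.≤-total m n)
    where
    go : ∀ m n → proj₁ (h ε 0<ε) ℕ.≤ m → proj₁ (h ε 0<ε) ℕ.≤ n → _ → ∣ f m - f n ∣ ≤ ε
    go m n N≤m N≤n (inj₁ m≤n) = subst (_≤ ε) (∣-∣-sym (f n) (f m)) (proj₂ (h ε 0<ε) m n N≤m m≤n)
    go m n N≤m N≤n (inj₂ n≤m) = proj₂ (h ε 0<ε) n m N≤n n≤m

  bounded : Cauchy f → ∃ λ B → 0ℚ ≤ B × (∀ n → ∣ f n ∣ ≤ B)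
  bounded {f} cf = B , 0≤+ (0≤sum N) 0≤1 , bound
    where
    0≤1 : 0ℚ ≤ 1ℚ
    0≤1 = 0≤ι 1
    N = proj₁ (cf 1ℚ (*<* (ℤ.+<+ (ℕ.s≤s ℕ.z≤n))))
    sum : ℕ → ℚ
    sum zero    = ∣ f 0 ∣
    sum (suc n) = sum n + ∣ f (suc n) ∣
    0≤sum : ∀ n → 0ℚ ≤ sum n
    0≤sum zero    = 0≤∣p∣ _
    0≤sum (suc n) = 0≤+ (0≤sum n) (0≤∣p∣ _)
    B = sum N + 1ℚ
    top : ∀ n → ∣ f n ∣ ≤ sum n
    top zero    = ≤-refl
    top (suc n) = subst (_≤ sum n + ∣ f (suc n) ∣) (+-identityˡ _) (+-monoˡ-≤ _ (0≤sum n))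
    below : ∀ {n} k → n ℕ.≤′ k → ∣ f n ∣ ≤ sum k
    below k ℕ.≤′-refl             = top k
    below (suc k) (ℕ.≤′-step n≤k) = ≤-trans (below k n≤k) (≤-add (0≤∣p∣ _))
    bound : ∀ n → ∣ f n ∣ ≤ B
    bound n with ℕ.≤-total n N
    ... | inj₁ n≤N = ≤-trans (below N (ℕ.≤⇒≤′ n≤N)) (≤-add 0≤1)
    ... | inj₂ N≤n = begin
      ∣ f n ∣                      ≡⟨ cong ∣_∣ (solve 2 (λ a b → a := b :+ (a :- b)) refl (f n) (f N)) ⟩
      ∣ f N + (f n - f N) ∣        ≤⟨ ∣p+q∣≤∣p∣+∣q∣ (f N) (f n - f N) ⟩
      ∣ f N ∣ + ∣ f n - f N ∣      ≤⟨ +-mono-≤ (top N) (proj₂ (cf 1ℚ _) n N N≤n ℕ.≤-refl) ⟩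
      sum N + 1ℚ                   ∎
      where open ≤-Reasoning

-- Real numbers are Cauchy sequences of rationals; two sequences denote the same
-- real when each is ≤ℝ the other.
record ℝ : Set where
  constructor mkℝ
  field
    seq    : ℕ → ℚ
    cauchy : Cauchy seq

open ℝ public

module ProductLemmas where

  open CauchyLemmas

  cauchy-const : ∀ q → Cauchy (λ _ → q)
  cauchy-const q ε 0<ε = 0 , λ _ _ _ _ → subst (_≤ ε) (cong ∣_∣ (sym (+-inverseʳ q))) (<⇒≤ 0<ε)

  cauchy-* : Cauchy f → Cauchy g → Cauchy (λ n → f n * g n)
  cauchy-* {f} {g} cf cg ε 0<ε = N , close
    where
    Bf = proj₁ (bounded {f} cf)
    Bg = proj₁ (bounded {g} cg)
    0≤Bf = proj₁ (proj₂ (bounded {f} cf))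
    0≤Bg = proj₁ (proj₂ (bounded {g} cg))
    sf = scale Bg 0≤Bg (½ * ε) (half ε 0<ε)
    sg = scale Bf 0≤Bf (½ * ε) (half ε 0<ε)
    hf = cf (proj₁ sf) (proj₁ (proj₂ sf))
    hg = cg (proj₁ sg) (proj₁ (proj₂ sg))
    N = proj₁ hf ℕ.⊔ proj₁ hg
    close : ∀ m n → N ℕ.≤ m → N ℕ.≤ n → ∣ f m * g m - f n * g n ∣ ≤ ε
    close m n N≤m N≤n = begin
      ∣ f m * g m - f n * g n ∣
        ≤⟨ ∣-∣-tri (f m * g m) (f m * g n) (f n * g n) ⟩
      ∣ f m * g m - f m * g n ∣ + ∣ f m * g n - f n * g n ∣
        ≡⟨ cong₂ (λ a b → ∣ a ∣ + ∣ b ∣)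
             (solve 3 (λ a b c → a :* b :- a :* c := a :* (b :- c)) refl (f m) (g m) (g n))
             (solve 3 (λ a b c → b :* a :- c :* a := a :* (b :- c)) refl (g n) (f m) (f n)) ⟩
      ∣ f m * (g m - g n) ∣ + ∣ g n * (f m - f n) ∣
        ≡⟨ cong₂ _+_ (∣p*q∣≡∣p∣*∣q∣ (f m) _) (∣p*q∣≡∣p∣*∣q∣ (g n) _) ⟩
      ∣ f m ∣ * ∣ g m - g n ∣ + ∣ g n ∣ * ∣ f m - f n ∣
        ≤⟨ +-mono-≤
             (≤-trans (*-monoʳ (0≤∣p∣ _) (proj₂ (proj₂ (bounded {f} cf)) m))
                      (*-monoˡ 0≤Bf (proj₂ hg m n (ℕ.≤-trans (ℕ.m≤n⊔m (proj₁ hf) _) N≤m) (ℕ.≤-trans (ℕ.m≤n⊔m (proj₁ hf) _) N≤n))))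
             (≤-trans (*-monoʳ (0≤∣p∣ _) (proj₂ (proj₂ (bounded {g} cg)) n))
                      (*-monoˡ 0≤Bg (proj₂ hf m n (ℕ.≤-trans (ℕ.m≤m⊔n _ (proj₁ hg)) N≤m) (ℕ.≤-trans (ℕ.m≤m⊔n _ (proj₁ hg)) N≤n)))) ⟩
      Bf * proj₁ sg + Bg * proj₁ sf
        ≤⟨ +-mono-≤ (proj₂ (proj₂ sg)) (proj₂ (proj₂ sf)) ⟩
      ½ * ε + ½ * ε
        ≡⟨ ½+½ ε ⟩
      ε ∎
      where open ≤-Reasoning

-- term x k = x^k/k!,  expSum x n = Σ_{k ≤ n} x^k/k!
term : ℚ → ℕ → ℚ
term x zero    = 1ℚ
term x (suc k) = term x k * x * (+ 1 / suc k)

expSum : ℚ → ℕ → ℚ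
expSum x zero    = 1ℚ
expSum x (suc n) = expSum x n + term x (suc n)

module ExpLemmas where

  open CauchyLemmas

  0≤1 : 0ℚ ≤ 1ℚ
  0≤1 = 0≤ι 1

  0≤term : 0ℚ ≤ b → ∀ k → 0ℚ ≤ term b k
  0≤term 0≤b zero    = 0≤1
  0≤term 0≤b (suc k) = 0≤* (0≤* (0≤term 0≤b k) 0≤b) (0≤u k)

  ∣uk∣ : ∀ k → ∣ u k ∣ ≡ u k
  ∣uk∣ k = 0≤p⇒∣p∣≡p (0≤u k)

  ∣term∣ : 0ℚ ≤ b → ∣ x ∣ ≤ b → ∀ k → ∣ term x k ∣ ≤ term b k
  ∣term∣ 0≤b x≤b zero = ≤-refl
  ∣term∣ {b} {x} 0≤b x≤b (suc k) = begin
    ∣ term x k * x * u k ∣          ≡⟨ ∣p*q∣≡∣p∣*∣q∣ (term x k * x) (u k) ⟩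
    ∣ term x k * x ∣ * ∣ u k ∣      ≡⟨ cong₂ _*_ (∣p*q∣≡∣p∣*∣q∣ (term x k) x) (∣uk∣ k) ⟩
    ∣ term x k ∣ * ∣ x ∣ * u k      ≤⟨ *-monoʳ (0≤u k) (≤-trans (*-monoʳ (0≤∣p∣ x) (∣term∣ 0≤b x≤b k)) (*-monoˡ (0≤term 0≤b k) x≤b)) ⟩
    term b k * b * u k              ∎
    where open ≤-Reasoning

  0≤expSum : 0ℚ ≤ b → ∀ n → 0ℚ ≤ expSum b n
  0≤expSum 0≤b zero    = 0≤1
  0≤expSum 0≤b (suc n) = 0≤+ (0≤expSum 0≤b n) (0≤term 0≤b (suc n))

  -- tails of the series at x are dominated by tails at b ≥ |x|
  tail-dom : 0ℚ ≤ b → ∣ x ∣ ≤ b → ∀ {m} n → m ℕ.≤′ n →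
             ∣ expSum x n - expSum x m ∣ ≤ expSum b n - expSum b m
  tail-dom {b} {x} 0≤b x≤b n ℕ.≤′-refl = ≤-reflexive
    (trans (cong ∣_∣ (+-inverseʳ (expSum x n))) (sym (+-inverseʳ (expSum b n))))
  tail-dom {b} {x} 0≤b x≤b {m} (suc n) (ℕ.≤′-step m≤n) = begin
    ∣ (X + t) - Xm ∣          ≡⟨ cong ∣_∣ (solve 3 (λ a b c → (a :+ b) :- c := (a :- c) :+ b) refl X t Xm) ⟩
    ∣ (X - Xm) + t ∣          ≤⟨ ∣p+q∣≤∣p∣+∣q∣ (X - Xm) t ⟩
    ∣ X - Xm ∣ + ∣ t ∣        ≤⟨ +-mono-≤ (tail-dom 0≤b x≤b n m≤n) (∣term∣ 0≤b x≤b (suc n)) ⟩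
    (B - Bm) + s              ≡⟨ solve 3 (λ a b c → (a :- c) :+ b := (a :+ b) :- c) refl B s Bm ⟩
    (B + s) - Bm              ∎
    where
    open ≤-Reasoning
    X = expSum x n
    Xm = expSum x m
    t = term x (suc n)
    B = expSum b n
    Bm = expSum b m
    s = term b (suc n)

  -- once k+1 ≥ 2b the terms at least halve
  term-half : 0ℚ ≤ b → ∀ k → b + b ≤ ι (suc k) → term b (suc k) ≤ ½ * term b k
  term-half {b} 0≤b k 2b≤k = begin
    t * b * u k                     ≡⟨ solve 3 (λ t b u → t :* b :* u := t :* u :* (con ½ :* (b :+ b))) refl t b (u k) ⟩
    t * u k * (½ * (b + b))         ≤⟨ *-monoˡ (0≤* (0≤term 0≤b k) (0≤u k)) (*-monoˡ {½} (nonNegative⁻¹ ½) 2b≤k) ⟩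
    t * u k * (½ * ι (suc k))       ≡⟨ solve 3 (λ t u n → t :* u :* (con ½ :* n) := con ½ :* t :* (u :* n)) refl t (u k) (ι (suc k)) ⟩
    ½ * t * (u k * ι (suc k))       ≡⟨ cong (½ * t *_) (uι k) ⟩
    ½ * t * 1ℚ                      ≡⟨ *-identityʳ _ ⟩
    ½ * t                           ∎
    where
    open ≤-Reasoning
    t = term b k

  module Tail (b : ℚ) (0≤b : 0ℚ ≤ b) where

    K : ℕ
    K = proj₁ (arch (b + b))

    big : ∀ k → K ℕ.≤ k → b + b ≤ ι (suc k)
    big k K≤k = ≤-trans (proj₂ (arch (b + b))) (ι-mono (ℕ.m≤n⇒m≤1+n K≤k))

    -- expSum b k + term b k is nonincreasing from K on
    cap : ∀ {m} n → K ℕ.≤ m → m ℕ.≤′ n → expSum b n + term b n ≤ expSum b m + term b m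
    cap n K≤m ℕ.≤′-refl = ≤-refl
    cap {m} (suc n) K≤m (ℕ.≤′-step m≤n) = ≤-trans step (cap n K≤m m≤n)
      where
      h = term-half 0≤b n (big n (ℕ.≤-trans K≤m (ℕ.≤′⇒≤ m≤n)))
      step : expSum b n + term b (suc n) + term b (suc n) ≤ expSum b n + term b n
      step = subst₂ _≤_ (sym (+-assoc (expSum b n) _ _)) (cong (λ z → expSum b n + z) (½+½ (term b n)))
               (+-monoʳ-≤ (expSum b n) (+-mono-≤ h h))

    tail≤ : ∀ m n → K ℕ.≤ m → m ℕ.≤ n → expSum b n - expSum b m ≤ term b m
    tail≤ m n K≤m m≤n = subst (expSum b n - expSum b m ≤_)
      (solve 2 (λ s t → (s :+ t) :- s := t) refl (expSum b m) (term b m))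
      (+-monoˡ-≤ (- expSum b m) (≤-trans (≤-add {a = expSum b n} (0≤term 0≤b n)) (cap n K≤m (ℕ.≤⇒≤′ m≤n))))

    M : ℚ
    M = expSum b K + term b K

    expSum≤M : ∀ n → expSum b n ≤ M
    expSum≤M n with ℕ.≤-total K n
    ... | inj₁ K≤n = ≤-trans (≤-add (0≤term 0≤b n)) (cap n ℕ.≤-refl (ℕ.≤⇒≤′ K≤n))
    ... | inj₂ n≤K = ≤-trans (mono K (ℕ.≤⇒≤′ n≤K)) (≤-add (0≤term 0≤b K))
      where
      mono : ∀ {m} n → m ℕ.≤′ n → expSum b m ≤ expSum b n
      mono n ℕ.≤′-refl             = ≤-refl
      mono (suc n) (ℕ.≤′-step m≤n) = ≤-trans (mono n m≤n) (≤-add (0≤term 0≤b (suc n)))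

    0≤M : 0ℚ ≤ M
    0≤M = ≤-trans (0≤expSum 0≤b K) (expSum≤M K)

    decay : ∀ j → term b (j ℕ.+ K) * ι (suc j) ≤ term b K
    decay zero    = ≤-reflexive (*-identityʳ _)
    decay (suc j) = begin
      term b (suc (j ℕ.+ K)) * ι (suc (suc j))
        ≤⟨ *-monoʳ (0≤ι (suc (suc j))) (term-half 0≤b (j ℕ.+ K) (big (j ℕ.+ K) (ℕ.m≤n+m K j))) ⟩
      ½ * t * ι (suc (suc j))
        ≤⟨ *-monoˡ (0≤* {½} (nonNegative⁻¹ ½) 0≤t) ι≤ ⟩
      ½ * t * (ι (suc j) + ι (suc j))
        ≡⟨ solve 2 (λ t n → con ½ :* t :* (n :+ n) := t :* n) refl t (ι (suc j)) ⟩
      t * ι (suc j)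
        ≤⟨ decay j ⟩
      term b K ∎
      where
      open ≤-Reasoning
      t = term b (j ℕ.+ K)
      0≤t = 0≤term 0≤b (j ℕ.+ K)
      ι≤ : ι (suc (suc j)) ≤ ι (suc j) + ι (suc j)
      ι≤ = subst (_≤ ι (suc j) + ι (suc j)) (sym (ι-suc (suc j)))
             (+-monoˡ-≤ (ι (suc j)) (ι-mono {1} {suc j} (ℕ.s≤s ℕ.z≤n)))

    vanish : ∀ ε → 0ℚ < ε → ∃ λ m → K ℕ.≤ m × term b m ≤ ε
    vanish ε 0<ε = J ℕ.+ K , ℕ.m≤n+m K J , small
      where
      open ≤-Reasoning
      sc = scale (term b K) (0≤term 0≤b K) ε 0<ε
      δ = proj₁ sc
      instance
        δ≢0 : NonZero δ
        δ≢0 = >-nonZero (proj₁ (proj₂ sc))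
      -- 1/δ ≤ J
      J = proj₁ (arch (1/ δ))
      1≤ : 1ℚ ≤ ι (suc J) * δ
      1≤ = subst (_≤ ι (suc J) * δ) (*-inverseˡ δ)
             (*-monoʳ (<⇒≤ (proj₁ (proj₂ sc))) (≤-trans (proj₂ (arch (1/ δ))) (ι-mono (ℕ.n≤1+n J))))
      small : term b (J ℕ.+ K) ≤ ε
      small = begin
        t                       ≡⟨ sym (*-identityʳ t) ⟩
        t * 1ℚ                  ≤⟨ *-monoˡ (0≤term 0≤b (J ℕ.+ K)) 1≤ ⟩
        t * (ι (suc J) * δ)     ≡⟨ sym (*-assoc t _ δ) ⟩
        t * ι (suc J) * δ       ≤⟨ *-monoʳ (<⇒≤ (proj₁ (proj₂ sc))) (decay J) ⟩
        term b K * δ            ≤⟨ proj₂ (proj₂ sc) ⟩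
        ε                       ∎
        where t = term b (J ℕ.+ K)

    series : ∀ ε → 0ℚ < ε → ∃ λ N → ∀ x → ∣ x ∣ ≤ b → ∀ m n → N ℕ.≤ m → m ℕ.≤ n →
             ∣ expSum x n - expSum x m ∣ ≤ ε
    series ε 0<ε = N , λ x x≤b m n N≤m m≤n → begin
      ∣ expSum x n - expSum x m ∣   ≤⟨ tail-dom 0≤b x≤b n (ℕ.≤⇒≤′ m≤n) ⟩
      expSum b n - expSum b m       ≤⟨ +-monoʳ-≤ (expSum b n) (neg-antimono-≤ (mono m (ℕ.≤⇒≤′ N≤m))) ⟩
      expSum b n - expSum b N       ≤⟨ tail≤ N n (proj₁ (proj₂ (vanish ε 0<ε))) (ℕ.≤-trans N≤m m≤n) ⟩
      term b N                      ≤⟨ proj₂ (proj₂ (vanish ε 0<ε)) ⟩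
      ε                             ∎
      where
      open ≤-Reasoning
      N = proj₁ (vanish ε 0<ε)
      mono : ∀ {m} n → m ℕ.≤′ n → expSum b m ≤ expSum b n
      mono n ℕ.≤′-refl             = ≤-refl
      mono (suc n) (ℕ.≤′-step m≤n) = ≤-trans (mono n m≤n) (≤-add (0≤term 0≤b (suc n)))

    module _ (x y : ℚ) (x≤b : ∣ x ∣ ≤ b) (y≤b : ∣ y ∣ ≤ b) where

      private
        δ : ℚ
        δ = ∣ x - y ∣

      term-lip : ∀ k → ∣ term x (suc k) - term y (suc k) ∣ ≤ term b k * δ
      term-lip zero = ≤-reflexive (begin
        ∣ 1ℚ * x * 1ℚ - 1ℚ * y * 1ℚ ∣   ≡⟨ cong ∣_∣ (solve 2 (λ x y → con 1ℚ :* x :* con 1ℚ :- con 1ℚ :* y :* con 1ℚ := x :- y) refl x y) ⟩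
        δ                               ≡⟨ sym (*-identityˡ δ) ⟩
        1ℚ * δ                          ∎)
        where open ≡-Reasoning
      term-lip (suc k) = begin
        ∣ tx * x * v - ty * y * v ∣
          ≡⟨ cong ∣_∣ (solve 5 (λ a b x y v → a :* x :* v :- b :* y :* v := (a :* (x :- y) :+ (a :- b) :* y) :* v) refl tx ty x y v) ⟩
        ∣ (tx * (x - y) + (tx - ty) * y) * v ∣
          ≡⟨ trans (∣p*q∣≡∣p∣*∣q∣ (tx * (x - y) + (tx - ty) * y) v) (cong (∣ tx * (x - y) + (tx - ty) * y ∣ *_) (∣uk∣ (suc k))) ⟩
        ∣ tx * (x - y) + (tx - ty) * y ∣ * v
          ≤⟨ *-monoʳ (0≤u (suc k)) (∣p+q∣≤∣p∣+∣q∣ (tx * (x - y)) ((tx - ty) * y)) ⟩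
        (∣ tx * (x - y) ∣ + ∣ (tx - ty) * y ∣) * v
          ≡⟨ cong (_* v) (cong₂ _+_ (∣p*q∣≡∣p∣*∣q∣ tx (x - y)) (∣p*q∣≡∣p∣*∣q∣ (tx - ty) y)) ⟩
        (∣ tx ∣ * δ + ∣ tx - ty ∣ * ∣ y ∣) * v
          ≤⟨ *-monoʳ (0≤u (suc k)) (+-mono-≤ (*-monoʳ (0≤∣p∣ _) (∣term∣ 0≤b x≤b (suc k)))
               (≤-trans (*-monoʳ (0≤∣p∣ y) (term-lip k)) (*-monoˡ (0≤* (0≤term 0≤b k) (0≤∣p∣ _)) y≤b))) ⟩
        (T * w * δ + tb * δ * b) * v
          ≡⟨⟩
        (tb * b * w * δ + tb * δ * b) * v
          ≡⟨ cong (λ z → (tb * b * w * δ + z) * v) (trans (solve 3 (λ t d b → t :* d :* b := t :* b :* d :* con 1ℚ) refl tb δ b) (cong (tb * b * δ *_) (sym (uι k)))) ⟩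
        (tb * b * w * δ + tb * b * δ * (w * ι (suc k))) * v
          ≡⟨ solve 6 (λ t b w d v n → (t :* b :* w :* d :+ t :* b :* d :* (w :* n)) :* v := t :* b :* w :* d :* (v :* (con 1ℚ :+ n))) refl tb b w δ v (ι (suc k)) ⟩
        tb * b * w * δ * (v * (1ℚ + ι (suc k)))
          ≡⟨ cong (λ z → tb * b * w * δ * (v * z)) (sym (ι-suc (suc k))) ⟩
        tb * b * w * δ * (v * ι (suc (suc k)))
          ≡⟨ cong (tb * b * w * δ *_) (uι (suc k)) ⟩
        tb * b * w * δ * 1ℚ
          ≡⟨ *-identityʳ _ ⟩
        T' * δ ∎
        where
        open ≤-Reasoning
        tx = term x (suc k)
        ty = term y (suc k)
        tb = term b k
        w = u k
        v = u (suc k)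
        T = tb * b
        T' = term b (suc k)

      expSum-lip : ∀ n → ∣ expSum x (suc n) - expSum y (suc n) ∣ ≤ expSum b n * δ
      expSum-lip zero = subst (_≤ 1ℚ * δ)
        (cong ∣_∣ (solve 2 (λ a b → a :- b := (con 1ℚ :+ a) :- (con 1ℚ :+ b)) refl (term x 1) (term y 1)))
        (term-lip 0)
      expSum-lip (suc n) = begin
        ∣ (X + s) - (Y + t) ∣       ≡⟨ cong ∣_∣ (solve 4 (λ X s Y t → (X :+ s) :- (Y :+ t) := (X :- Y) :+ (s :- t)) refl X s Y t) ⟩
        ∣ (X - Y) + (s - t) ∣       ≤⟨ ∣p+q∣≤∣p∣+∣q∣ (X - Y) (s - t) ⟩
        ∣ X - Y ∣ + ∣ s - t ∣       ≤⟨ +-mono-≤ (expSum-lip n) (term-lip (suc n)) ⟩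
        expSum b n * δ + term b (suc n) * δ  ≡⟨ sym (*-distribʳ-+ δ (expSum b n) (term b (suc n))) ⟩
        expSum b (suc n) * δ        ∎
        where
        open ≤-Reasoning
        X = expSum x (suc n)
        Y = expSum y (suc n)
        s = term x (suc (suc n))
        t = term y (suc (suc n))

      lipschitz : ∀ n → ∣ expSum x n - expSum y n ∣ ≤ M * δ
      lipschitz zero    = 0≤* 0≤M (0≤∣p∣ _)
      lipschitz (suc n) = ≤-trans (expSum-lip n) (*-monoʳ (0≤∣p∣ _) (expSum≤M n))

  cauchy-exp : Cauchy f → Cauchy (λ n → expSum (f n) n)
  cauchy-exp {f} cf = ordered {λ n → expSum (f n) n} λ ε 0<ε →
    let sc = scale M 0≤M (½ * ε) (half ε 0<ε)
        hf = cf (proj₁ sc) (proj₁ (proj₂ sc))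
        hs = series (½ * ε) (half ε 0<ε)
    in proj₁ hf ℕ.⊔ proj₁ hs , λ m n N≤m m≤n →
      let N≤m₁ = ℕ.≤-trans (ℕ.m≤m⊔n (proj₁ hf) (proj₁ hs)) N≤m
          N≤m₂ = ℕ.≤-trans (ℕ.m≤n⊔m (proj₁ hf) (proj₁ hs)) N≤m
      in begin
      ∣ expSum (f n) n - expSum (f m) m ∣
        ≤⟨ ∣-∣-tri (expSum (f n) n) (expSum (f n) m) (expSum (f m) m) ⟩
      ∣ expSum (f n) n - expSum (f n) m ∣ + ∣ expSum (f n) m - expSum (f m) m ∣
        ≤⟨ +-mono-≤ (proj₂ hs (f n) (f≤B n) m n N≤m₂ m≤n) (lipschitz (f n) (f m) (f≤B n) (f≤B m) m) ⟩
      ½ * ε + M * ∣ f n - f m ∣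
        ≤⟨ +-monoʳ-≤ (½ * ε) (≤-trans (*-monoˡ 0≤M (proj₂ hf n m (ℕ.≤-trans N≤m₁ m≤n) N≤m₁)) (proj₂ (proj₂ sc))) ⟩
      ½ * ε + ½ * ε
        ≡⟨ ½+½ ε ⟩
      ε ∎
    where
    open ≤-Reasoning
    B = proj₁ (bounded {f} cf)
    f≤B = proj₂ (proj₂ (bounded {f} cf))
    open Tail B (proj₁ (proj₂ (bounded {f} cf)))

-- H_a = Σ_{1 ≤ i ≤ a} 1/i
harmonic : ℕ → ℚ
harmonic zero    = 0ℚ
harmonic (suc a) = harmonic a + + 1 / suc a

-- Right Riemann sum of mesh 1/m for ∫₁ⁿ dt/t.
logSum : ℕ → ℕ → ℚ
logSum n m = harmonic (n ℕ.* m) - harmonic m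

module LogLemmas where

  open CauchyLemmas
  open ExpLemmas using (0≤1)

  -- k terms of the harmonic sum after position a
  H-upper : ∀ a k → harmonic (k ℕ.+ a) ≤ harmonic a + ι k * u a
  H-upper a zero    = ≤-reflexive (solve 2 (λ h v → h := h :+ con 0ℚ :* v) refl (harmonic a) (u a))
  H-upper a (suc k) = begin
    harmonic (k ℕ.+ a) + u (k ℕ.+ a)    ≤⟨ +-mono-≤ (H-upper a k) (u-anti (ℕ.m≤n+m a k)) ⟩
    harmonic a + ι k * u a + u a        ≡⟨ solve 3 (λ h n v → h :+ n :* v :+ v := h :+ (con 1ℚ :+ n) :* v) refl (harmonic a) (ι k) (u a) ⟩
    harmonic a + (1ℚ + ι k) * u a       ≡⟨ cong (λ z → harmonic a + z * u a) (sym (ι-suc k)) ⟩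
    harmonic a + ι (suc k) * u a        ∎
    where open ≤-Reasoning

  H-lower : ∀ a k c → k ℕ.+ a ℕ.≤ suc c → harmonic a + ι k * u c ≤ harmonic (k ℕ.+ a)
  H-lower a zero c _ = ≤-reflexive (solve 2 (λ h v → h :+ con 0ℚ :* v := h) refl (harmonic a) (u c))
  H-lower a (suc k) c (ℕ.s≤s le) = begin
    harmonic a + ι (suc k) * u c        ≡⟨ cong (λ z → harmonic a + z * u c) (ι-suc k) ⟩
    harmonic a + (1ℚ + ι k) * u c       ≡⟨ solve 3 (λ h n v → h :+ (con 1ℚ :+ n) :* v := h :+ n :* v :+ v) refl (harmonic a) (ι k) (u c) ⟩
    harmonic a + ι k * u c + u c        ≤⟨ +-mono-≤ (H-lower a k c (ℕ.m≤n⇒m≤1+n le)) (u-anti le) ⟩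
    harmonic (k ℕ.+ a) + u (k ℕ.+ a)    ∎
    where open ≤-Reasoning

  -- n · 1/(n(i+1)) = 1/(i+1)  for n = k+1
  cancel : ∀ k i → ι (suc k) * u (i ℕ.+ k ℕ.* suc i) ≡ u i
  cancel k i = begin
    A * U                       ≡⟨ sym (*-identityʳ _) ⟩
    A * U * 1ℚ                  ≡⟨ cong (A * U *_) (sym (uι i)) ⟩
    A * U * (u i * C)           ≡⟨ solve 4 (λ A U v C → A :* U :* (v :* C) := v :* (U :* (A :* C))) refl A U (u i) C ⟩
    u i * (U * (A * C))         ≡⟨ cong (λ z → u i * (U * z)) (sym (ι-* (suc k) (suc i))) ⟩
    u i * (U * ι (suc k ℕ.* suc i)) ≡⟨ cong (u i *_) (uι (i ℕ.+ k ℕ.* suc i)) ⟩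
    u i * 1ℚ                    ≡⟨ *-identityʳ _ ⟩
    u i                         ∎
    where
    open ≡-Reasoning
    A = ι (suc k)
    C = ι (suc i)
    U = u (i ℕ.+ k ℕ.* suc i)

  module Log (k : ℕ) where

    -- m = i+1
    L : ℕ → ℚ
    L i = logSum (suc k) (suc i)

    nm : ∀ i → suc k ℕ.* suc (suc i) ≡ suc k ℕ.+ suc k ℕ.* suc i
    nm i = ℕ.*-suc (suc k) (suc i)

    L-up : ∀ i → L i ≤ L (suc i)
    L-up i = begin
      h - harmonic (suc i)
        ≡⟨ solve 3 (λ h g v → h :- g := (h :+ v) :- (g :+ v)) refl h (harmonic (suc i)) (u (suc i)) ⟩
      (h + u (suc i)) - harmonic (suc (suc i))
        ≡⟨ cong (λ z → (h + z) - harmonic (suc (suc i))) (sym (cancel k (suc i))) ⟩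
      (h + ι (suc k) * u (suc i ℕ.+ k ℕ.* suc (suc i))) - harmonic (suc (suc i))
        ≤⟨ +-monoˡ-≤ (- harmonic (suc (suc i))) (H-lower (suc k ℕ.* suc i) (suc k) _ (ℕ.≤-reflexive (sym (nm i)))) ⟩
      harmonic (suc k ℕ.+ suc k ℕ.* suc i) - harmonic (suc (suc i))
        ≡⟨ cong (λ z → harmonic z - harmonic (suc (suc i))) (sym (nm i)) ⟩
      harmonic (suc k ℕ.* suc (suc i)) - harmonic (suc (suc i)) ∎
      where
      open ≤-Reasoning
      h = harmonic (suc k ℕ.* suc i)

    L-down : ∀ i → L (suc i) + u (suc i) ≤ L i + u i
    L-down i = begin
      harmonic (suc k ℕ.* suc (suc i)) - (harmonic (suc i) + u (suc i)) + u (suc i)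
        ≡⟨ solve 3 (λ h g v → h :- (g :+ v) :+ v := h :- g) refl (harmonic (suc k ℕ.* suc (suc i))) (harmonic (suc i)) (u (suc i)) ⟩
      harmonic (suc k ℕ.* suc (suc i)) - harmonic (suc i)
        ≡⟨ cong (λ z → harmonic z - harmonic (suc i)) (nm i) ⟩
      harmonic (suc k ℕ.+ suc k ℕ.* suc i) - harmonic (suc i)
        ≤⟨ +-monoˡ-≤ (- harmonic (suc i)) (H-upper (suc k ℕ.* suc i) (suc k)) ⟩
      h + ι (suc k) * u (suc k ℕ.* suc i) - harmonic (suc i)
        ≤⟨ +-monoˡ-≤ (- harmonic (suc i)) (+-monoʳ-≤ h (*-monoˡ (0≤ι (suc k)) (u-anti {i ℕ.+ k ℕ.* suc i} (ℕ.n≤1+n _)))) ⟩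
      h + ι (suc k) * u (i ℕ.+ k ℕ.* suc i) - harmonic (suc i)
        ≡⟨ cong (λ z → h + z - harmonic (suc i)) (cancel k i) ⟩
      h + u i - harmonic (suc i)
        ≡⟨ solve 3 (λ h v g → h :+ v :- g := h :- g :+ v) refl h (u i) (harmonic (suc i)) ⟩
      L i + u i ∎
      where
      open ≤-Reasoning
      h = harmonic (suc k ℕ.* suc i)

    ups : ∀ {i} j → i ℕ.≤′ j → L i ≤ L j
    ups j ℕ.≤′-refl           = ≤-refl
    ups (suc j) (ℕ.≤′-step p) = ≤-trans (ups j p) (L-up j)

    downs : ∀ {i} j → i ℕ.≤′ j → L j + u j ≤ L i + u i
    downs j ℕ.≤′-refl           = ≤-refl
    downs (suc j) (ℕ.≤′-step p) = ≤-trans (L-down j) (downs j p)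

    cauchy-log : Cauchy L
    cauchy-log = ordered {L} λ ε 0<ε →
      let N = proj₁ (small ε 0<ε)
      in N , λ i j N≤i i≤j → begin
        ∣ L j - L i ∣        ≡⟨ 0≤p⇒∣p∣≡p (≤-sub (ups j (ℕ.≤⇒≤′ i≤j))) ⟩
        L j - L i            ≤⟨ +-monoˡ-≤ (- L i) (≤-trans (≤-add {a = L j} (0≤u j)) (downs j (ℕ.≤⇒≤′ i≤j))) ⟩
        L i + u i - L i      ≡⟨ solve 2 (λ a b → a :+ b :- a := b) refl (L i) (u i) ⟩
        u i                  ≤⟨ u-anti N≤i ⟩
        u N                  ≤⟨ proj₂ (small ε 0<ε) ⟩
        ε                    ∎
      where
      open ≤-Reasoning
      small : ∀ ε → 0ℚ < ε → ∃ λ N → u N ≤ ε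
      small ε 0<ε = N , (begin
        u N                       ≡⟨ sym (*-identityʳ (u N)) ⟩
        u N * 1ℚ                  ≡⟨ cong (u N *_) (sym (*-inverseˡ ε)) ⟩
        u N * (1/ ε * ε)          ≤⟨ *-monoˡ (0≤u N) (*-monoʳ (<⇒≤ 0<ε) (≤-trans (proj₂ (arch (1/ ε))) (ι-mono (ℕ.n≤1+n N)))) ⟩
        u N * (ι (suc N) * ε)     ≡⟨ sym (*-assoc (u N) _ ε) ⟩
        u N * ι (suc N) * ε       ≡⟨ cong (_* ε) (uι N) ⟩
        1ℚ * ε                    ≡⟨ *-identityˡ ε ⟩
        ε                         ∎)
        where
        instance
          ε≢0 : NonZero ε
          ε≢0 = >-nonZero 0<ε
        N = proj₁ (arch (1/ ε))

open ProductLemmas using (cauchy-const; cauchy-*)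
open ExpLemmas using (cauchy-exp)
open LogLemmas using (module Log)

infixl 7 _*ℝ_
infix  4 _≤ℝ_ _<ℝ_
infixr 8 _^ℕ_ _^ℝ_

fromℚ : ℚ → ℝ
fromℚ q = mkℝ (λ _ → q) (cauchy-const q)

fromℕ : ℕ → ℝ
fromℕ n = fromℚ (+ n / 1)

0ℝ 1ℝ : ℝ
0ℝ = fromℕ 0
1ℝ = fromℕ 1

_≤ℝ_ : ℝ → ℝ → Set
x ≤ℝ y = ∀ ε → 0ℚ < ε → Eventually λ n → seq x n ≤ seq y n + ε

_<ℝ_ : ℝ → ℝ → Set
x <ℝ y = ∃ λ ε → 0ℚ < ε × Eventually λ n → seq x n + ε ≤ seq y n

_*ℝ_ : ℝ → ℝ → ℝ
x *ℝ y = mkℝ (λ n → seq x n * seq y n) (cauchy-* {seq x} {seq y} (cauchy x) (cauchy y))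

_^ℕ_ : ℝ → ℕ → ℝ
x ^ℕ zero  = 1ℝ
x ^ℕ suc k = x *ℝ x ^ℕ k

-- The diagonal sequence Σ_{k ≤ n} (xₙ)^k/k!  converges to e^x.
expℝ : ℝ → ℝ
expℝ x = mkℝ (λ n → expSum (seq x n) n) (cauchy-exp {seq x} (cauchy x))

-- Natural logarithm ∫₁ⁿ dt/t of a positive integer; the value at 0 is junk.
log : ℕ → ℝ
log zero    = 0ℝ
log (suc k) = mkℝ (λ i → logSum (suc k) (suc i)) (Log.cauchy-log k)

-- Real powers of a positive integer.
_^ℝ_ : ℕ → ℝ → ℝ
b ^ℝ y = expℝ (y *ℝ log b)

-- f = o(g), for nonnegative f and g.
LittleO : (f g : ℕ → ℝ) → Set
LittleO f g = ∀ (ε : ℝ) → 0ℝ <ℝ ε → Eventually λ n → f n ≤ℝ ε *ℝ g n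

TendsToInfinity : (ℕ → ℤ) → Set
TendsToInfinity p = ∀ M → Eventually λ n → M ℤ.≤ p n

-- log n / q^{1/r}.  Only q > 0 is meaningful: in the theorem q = p(n) → ∞.
rate : (r : ℕ) .{{_ : ℕ.NonZero r}} → ℤ → ℕ → ℝ
rate r q n = log n *ℝ ℤ.∣ q ∣ ^ℝ fromℚ (- (+ 1 / r))

IsMinimum : {B : Set} → (B → Set) → (B → ℕ) → ℕ → Set
IsMinimum P f m = (∃ λ x → P x × f x ≡ m) × (∀ x → P x → m ℕ.≤ f x)

record State : Set where
  constructor state
  field
    key         : ℕ → ℕ
    exchanges   : ℕ
    comparisons : ℕ

open State public

swap : ℕ → ℕ → (ℕ → ℕ) → ℕ → ℕ
swap i j key k = if k ℕ.≡ᵇ i then key j else if k ℕ.≡ᵇ j then key i else key k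

-- The chain of residue c modulo h occupies positions c, c + h, c + 2h, …
-- (0-based).  sift h c k inserts the element at position c + k h.
sift : (h c k : ℕ) → State → State
sift h c zero    s = s
sift h c (suc k) (state key e m) =
  let i = c ℕ.+ k ℕ.* h
      j = c ℕ.+ suc k ℕ.* h
  in if key j ℕ.<ᵇ key i
     then sift h c k (state (swap i j key) (suc e) (suc m))
     else state key e (suc m)

insertionSort : (n h c : ℕ) → State → State
insertionSort n h c s =
  foldl (λ s k → sift h c k s) s (filter (λ k → c ℕ.+ k ℕ.* h ℕ.<? n) (upTo n))

pass : (n h : ℕ) → State → State
pass n h s = foldl (λ s c → insertionSort n h c s) s (upTo h)

-- Positions past the end are never read by shellsort.
keyAt : List ℕ → ℕ → ℕ
keyAt []       _       = 0
keyAt (x ∷ _)  zero    = x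
keyAt (_ ∷ xs) (suc i) = keyAt xs i

shellsort : (n : ℕ) (H : List ℕ) → List ℕ → State
shellsort n H xs = foldl (λ s h → pass n h s) (state (keyAt xs) 0 0) H

insertions : ℕ → List ℕ → List (List ℕ)
insertions x []       = (x ∷ []) ∷ []
insertions x (y ∷ ys) = (x ∷ y ∷ ys) ∷ List.map (y ∷_) (insertions x ys)

permutations : List ℕ → List (List ℕ)
permutations []       = [] ∷ []
permutations (x ∷ xs) = concatMap (insertions x) (permutations xs)

worst : (State → ℕ) → ℕ → List ℕ → ℕ
worst cost n H = max 0 (List.map (cost ∘ shellsort n H) (permutations (upTo n)))

W C : ℕ → List ℕ → ℕ
W = worst exchanges
C = worst comparisons

monomial : ∀ {r} → Vec ℕ r → Vec ℕ r → ℕ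
monomial A u = product (toList (zipWith ℕ._^_ A u))

exponents : ℕ → (r : ℕ) → List (Vec ℕ r)
exponents n zero    = [] ∷ []
exponents n (suc r) = cartesianProductWith _∷_ (upTo n) (exponents n r)

-- H_A(n) in decreasing order.  For generators ≥ 2 a product below n has all
-- exponents below n, so the finite search loses nothing (∈-grid).
grid : ∀ {r} → Vec ℕ r → ℕ → List ℕ
grid A n = filter (λ h → any? (λ u → monomial A u ℕ.≟ h) (exponents n _)) (downFrom n)

maximum minimum gcdOf : ∀ {r} → Vec ℕ r → ℕ
maximum A = max 0 (toList A)
-- min d takes the minimum of the list and d, so d must not undercut the entries.
minimum A = min (maximum A) (toList A)
gcdOf   A = List.foldr gcd 0 (toList A)

-- A vector of r distinct entries stands for an r-element set; everything below
-- is insensitive to the order of the entries.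
record Generators {r} (n : ℕ) (A : Vec ℕ r) : Set where
  field
    inRange  : All (λ a → 2 ℕ.≤ a × a ℕ.< n) A
    distinct : Unique A

Independent : ∀ {r} → Vec ℕ r → Set
Independent {r} A = (u v : Vec ℕ r) → monomial A u ≡ monomial A v → u ≡ v

PairwiseCoprime : ∀ {r} → Vec ℕ r → Set
PairwiseCoprime = AllPairs Coprime.Coprime

BoundedRatio : ∀ {r} → ℝ → Vec ℕ r → Set
BoundedRatio K A = fromℕ (maximum A) ≤ℝ minimum A ^ℝ K

record Feasible {r} (K : ℝ) (n : ℕ) (q : ℤ) (A : Vec ℕ r) : Set where
  field
    generators  : Generators n A
    independent : Independent A
    gcd≡1       : gcdOf A ≡ 1
    ratio       : BoundedRatio K A
    size        : + length (grid A n) ℤ.≤ q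

∈-insertions : ∀ x as bs → as ++ x ∷ bs ∈ insertions x (as ++ bs)
∈-insertions x []       []       = here refl
∈-insertions x []       (b ∷ bs) = here refl
∈-insertions x (a ∷ as) bs       = there (∈-map⁺ (a ∷_) (∈-insertions x as bs))

insertions-↭ : ∀ x xs {ys} → ys ∈ insertions x xs → ys ↭ x ∷ xs
insertions-↭ x []       (here refl) = Perm.refl
insertions-↭ x (y ∷ xs) (here refl) = Perm.refl
insertions-↭ x (y ∷ xs) (there p) with ∈-map⁻ (y ∷_) p
... | zs , zs∈ , refl = Perm.trans (Perm.prep y (insertions-↭ x xs zs∈)) (Perm.swap y x Perm.refl)

∈-permutations : ∀ xs {ys} → ys ∈ permutations xs ⇔ (ys ↭ xs)
∈-permutations xs = mk⇔ (sound xs) (complete xs)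
  where
  sound : ∀ xs {ys} → ys ∈ permutations xs → ys ↭ xs
  sound []       (here refl) = Perm.refl
  sound (x ∷ xs) p with find (∈-concatMap⁻ (insertions x) {xs = permutations xs} p)
  ... | zs , zs∈ , ys∈ = Perm.trans (insertions-↭ x zs ys∈) (Perm.prep x (sound xs zs∈))
  complete : ∀ xs {ys} → ys ↭ xs → ys ∈ permutations xs
  complete []       p with ↭-empty-inv p
  ... | refl = here refl
  complete (x ∷ xs) p with ∈-∃++ (∈-resp-↭ (↭-sym p) (here refl))
  ... | as , bs , refl =
    ∈-concatMap⁺ (insertions x) (lose (complete xs (drop-mid as [] p)) (∈-insertions x as bs))

∈-grid : ∀ {r n h} {A : Vec ℕ r} → All (2 ℕ.≤_) A →
         h ∈ grid A n ⇔ (h ℕ.< n × ∃ λ u → monomial A u ≡ h)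
∈-grid {r} {n} {h} {A} 2≤A = mk⇔ to from
  where
  dec′ = λ h → any? (λ u → monomial A u ℕ.≟ h) (exponents n r)
  to : h ∈ grid A n → h ℕ.< n × ∃ λ u → monomial A u ≡ h
  to p with ∈-filter⁻ dec′ {xs = downFrom n} p
  ... | h∈ , q with find q
  ... | u , _ , eq = ∈-downFrom⁻ h∈ , u , eq
  1≤mono : ∀ {r} {A : Vec ℕ r} → All (2 ℕ.≤_) A → ∀ u → 1 ℕ.≤ monomial A u
  1≤mono []         []      = ℕ.≤-refl
  1≤mono {A = a ∷ _} (2≤a ∷ 2≤A) (k ∷ u) =
    ℕ.*-mono-≤ (ℕ.m^n>0 a {{ℕ.>-nonZero (ℕ.<⇒≤ 2≤a)}} k) (1≤mono 2≤A u)
  k<a^k : ∀ {a} → 2 ℕ.≤ a → ∀ k → k ℕ.< a ℕ.^ k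
  k<a^k 2≤a zero    = ℕ.s≤s ℕ.z≤n
  k<a^k {a} 2≤a (suc k) = begin
    suc (suc k)               ≤⟨ ℕ.s≤s (ℕ.m≤n+m (suc k) k) ⟩
    suc k ℕ.+ suc k           ≡⟨ cong (suc k ℕ.+_) (sym (ℕ.+-identityʳ (suc k))) ⟩
    2 ℕ.* suc k               ≤⟨ ℕ.*-mono-≤ 2≤a (k<a^k 2≤a k) ⟩
    a ℕ.* a ℕ.^ k             ∎
    where open ℕ.≤-Reasoning
  bound : ∀ {r} {A : Vec ℕ r} → All (2 ℕ.≤_) A → ∀ u → monomial A u ℕ.< n → u ∈ exponents n r
  bound []          []      _ = here refl
  bound {A = a ∷ A} (2≤a ∷ 2≤A) (k ∷ u) lt =
    ∈-cartesianProductWith⁺ _∷_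
      (∈-upTo⁺ (ℕ.<-trans (k<a^k 2≤a k) (ℕ.≤-<-trans
        (ℕ.m≤m*n (a ℕ.^ k) (monomial A u) {{ℕ.>-nonZero (1≤mono 2≤A u)}}) lt)))
      (bound 2≤A u (ℕ.≤-<-trans
        (ℕ.m≤n*m (monomial A u) (a ℕ.^ k) {{ℕ.m^n≢0 a k {{ℕ.>-nonZero (ℕ.<⇒≤ 2≤a)}}}}) lt))
  from : h ℕ.< n × (∃ λ u → monomial A u ≡ h) → h ∈ grid A n
  from (h<n , u , refl) = ∈-filter⁺ dec′ (∈-downFrom⁺ h<n) (lose (bound 2≤A u h<n) refl)

{-# OPTIONS --safe #-}
-- Lower bound.  If a is the least generator, every gap other than 1 is at least a, so an input
-- whose consecutive blocks of length a are reversed is left alone until the last pass, which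
-- then makes about n a / 4 exchanges.  All generators are at most a^K, so the grid contains
-- the (m + 1)^r products with exponents at most m as long as a^(K r m) < n;  hence
-- (m + 1)^r ≤ p for the largest such m, and log n ≤ K r (m + 1) log a gives
-- log n / p^(1/r) ≤ K r log a.
--
-- Upper bound.  Let k^r ≤ p < (k + 1)^r, let t be largest with (1 + r! t)^k < n, and put
-- y = 1 + r! t, D = r! (t + 1).  The generators 1 + D, 1 + 2 D, …, 1 + r D are pairwise coprime
-- (Gödel's β-function), have k-th powers ≥ n, which bounds the grid by k^r, and are at most
-- y², which bounds it below.  When the pass with gap h starts, the array is sorted with the gaps
-- h a and h b for the first two generators a and b = 2 a - 1, hence in each chain with every
-- step ≥ 2 a², so each insertion makes O(y²) comparisons, and log y ≤ log n / k.
--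
-- The minimum in (3) lies between these bounds since p ≤ exp(log n / p^(1/r)).
module Submission where

-- The hypothesis p = o((log n)^r) acts only through `small-powers`: for every fixed M, eventually
-- k^r ≤ p forces M^k < n. In the lower bound this excludes small least generators, for which n a /
-- 4 exchanges would be too few; in the upper bound it pushes t beyond any constant depending on r
-- and K, so that factors such as r + 1 are swallowed by powers of y. Two consecutive values of t
-- serve opposite needs: (1 + r! t)^k < n controls the cost and fills the grid, while n ≤ (1 + r! (t
-- + 1))^k caps the exponents. The two bases differ by at most a factor 2, so nothing is lost
-- between the two bounds. Roots and floors of reals are avoided. All counting uses integer
-- inequalities such as m^r ≤ P and n ≤ a^N, which logarithms turn into statements about the rate
-- only at the end. Likewise K enters as an integer above it in the lower bound and as a fraction (N
-- + 2)/(N + 1) below it in the upper bound.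

-- Order and arithmetic of Cauchy reals

module RealArithmetic where

  open import Defs
  open import Data.Nat as ℕ using (ℕ; zero; suc)
  import Data.Nat.Properties as ℕ
  open import Data.Integer as ℤ using (+_)
  import Data.Integer.Properties as ℤ
  open import Data.Rational
  open import Data.Rational.Properties
  open import Data.Rational.Solver
  open import Data.Sum using (inj₁; inj₂)
  open import Data.Product using (∃; _,_; _×_; proj₁; proj₂)
  open import Relation.Binary.PropositionalEquality
  open import Algebra.Bundles using (CommutativeSemiring)
  import Data.Empty
  import Relation.Nullary
  open import Level using (0ℓ)
  open +-*-Solver using (solve; _:+_; _:*_; _:-_; :-_; _:=_; con)
  open CauchyLemmas public using (ι; u; ι-*; ι-suc; uι; ι-mono; 0≤ι; u-anti; 0≤u; arch; ≤-add; bounded; 0≤+; half; ½+½; scale; *-monoˡ; *-monoʳ; 0≤*)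

  infix 4 _≼_

  _≼_ : (f g : ℕ → ℚ) → Set
  f ≼ g = ∀ ε → 0ℚ < ε → Eventually λ n → f n ≤ g n + ε

  both : {P Q : ℕ → Set} → Eventually P → Eventually Q → Eventually λ n → P n × Q n
  both (M , p) (N , q) = M ℕ.⊔ N , λ n le →
    p n (ℕ.≤-trans (ℕ.m≤m⊔n M N) le) , q n (ℕ.≤-trans (ℕ.m≤n⊔m M N) le)

  eventually-map : {P Q : ℕ → Set} → (∀ n → P n → Q n) → Eventually P → Eventually Q
  eventually-map h (N , p) = N , λ n le → h n (p n le)

  eventually≤⇒≼ : ∀ {f g} → Eventually (λ n → f n ≤ g n) → f ≼ g
  eventually≤⇒≼ {f} {g} e ε 0<ε = eventually-map (λ n le → ≤-trans le (≤-add {ε} {g n} (<⇒≤ 0<ε))) e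

  ≤⇒≼ : ∀ {f g} → (∀ n → f n ≤ g n) → f ≼ g
  ≤⇒≼ h = eventually≤⇒≼ (0 , λ n _ → h n)

  ≡⇒≼ : ∀ {f g} → (∀ n → f n ≡ g n) → f ≼ g
  ≡⇒≼ h = ≤⇒≼ (λ n → ≤-reflexive (h n))

  ≼-trans : ∀ {f g h} → f ≼ g → g ≼ h → f ≼ h
  ≼-trans {f} {g} {h} p q ε 0<ε = eventually-map
    (λ n (a , b) → begin
      f n                          ≤⟨ a ⟩
      g n + ½ * ε                  ≤⟨ +-monoˡ-≤ (½ * ε) b ⟩
      h n + ½ * ε + ½ * ε          ≡⟨ +-assoc (h n) _ _ ⟩
      h n + (½ * ε + ½ * ε)        ≡⟨ cong (λ z → h n + z) (½+½ ε) ⟩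
      h n + ε                      ∎)
    (both (p _ (half ε 0<ε)) (q _ (half ε 0<ε)))
    where open ≤-Reasoning

  ≼-+ : ∀ {f f′ g g′} → f ≼ f′ → g ≼ g′ → (λ n → f n + g n) ≼ (λ n → f′ n + g′ n)
  ≼-+ {f} {f′} {g} {g′} p q ε 0<ε = eventually-map
    (λ n (a , b) → begin
      f n + g n                            ≤⟨ +-mono-≤ a b ⟩
      f′ n + ½ * ε + (g′ n + ½ * ε)        ≡⟨ solve 3 (λ a b e → a :+ con ½ :* e :+ (b :+ con ½ :* e) := a :+ b :+ e) refl (f′ n) (g′ n) ε ⟩
      f′ n + g′ n + ε                      ∎)
    (both (p _ (half ε 0<ε)) (q _ (half ε 0<ε)))
    where open ≤-Reasoning

  p≤∣p∣ : ∀ p → p ≤ ∣ p ∣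
  p≤∣p∣ p with ≤-total 0ℚ p
  ... | inj₁ 0≤p = ≤-reflexive (sym (0≤p⇒∣p∣≡p 0≤p))
  ... | inj₂ p≤0 = ≤-trans p≤0 (0≤∣p∣ p)

  -p≤∣p∣ : ∀ p → - p ≤ ∣ p ∣
  -p≤∣p∣ p = subst (- p ≤_) (∣-p∣≡∣p∣ p) (p≤∣p∣ (- p))

  ∣p∣≤ : ∀ {p q} → p ≤ q → - p ≤ q → ∣ p ∣ ≤ q
  ∣p∣≤ {p} {q} a b with ∣p∣≡p∨∣p∣≡-p p
  ... | inj₁ e = subst (_≤ q) (sym e) a
  ... | inj₂ e = subst (_≤ q) (sym e) b

  ≤+⇒-≤ : ∀ {a b} e → a ≤ b + e → a - b ≤ e
  ≤+⇒-≤ {a} {b} e le = subst (a - b ≤_) (solve 2 (λ b e → b :+ e :- b := e) refl b e) (+-monoˡ-≤ (- b) le)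

  -≤⇒≤+ : ∀ {a b} e → a - b ≤ e → a ≤ b + e
  -≤⇒≤+ {a} {b} e le = subst₂ _≤_ (solve 2 (λ a b → a :- b :+ b := a) refl a b) (+-comm e b) (+-monoˡ-≤ b le)

  ∣-∣≤⇒≤+ : ∀ {a b e} → ∣ a - b ∣ ≤ e → a ≤ b + e
  ∣-∣≤⇒≤+ {a} {b} {e} le = -≤⇒≤+ e (≤-trans (p≤∣p∣ (a - b)) le)

  ∣-∣≤⇒≤+′ : ∀ {a b e} → ∣ a - b ∣ ≤ e → b ≤ a + e
  ∣-∣≤⇒≤+′ {a} {b} {e} le = ∣-∣≤⇒≤+ {b} {a} (subst (_≤ e) (CauchyLemmas.∣-∣-sym a b) le)

  0≤sub : ∀ {a b} → 0ℚ ≤ b - a → a ≤ b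
  0≤sub {a} {b} le = subst₂ _≤_ (+-identityˡ a) (solve 2 (λ a b → b :- a :+ a := b) refl a b) (+-monoˡ-≤ a le)

  ≼-close : ∀ {f g} → f ≼ g → g ≼ f → ∀ ε → 0ℚ < ε → Eventually λ n → ∣ f n - g n ∣ ≤ ε
  ≼-close {f} {g} p q ε 0<ε = eventually-map
    (λ n (a , b) → ∣p∣≤ (≤+⇒-≤ {f n} {g n} ε a)
       (subst (_≤ ε) (solve 2 (λ f g → g :- f := :- (f :- g)) refl (f n) (g n)) (≤+⇒-≤ {g n} {f n} ε b)))
    (both (p ε 0<ε) (q ε 0<ε))

  close⇒≼ : ∀ {f g} → (∀ ε → 0ℚ < ε → Eventually λ n → ∣ f n - g n ∣ ≤ ε) → f ≼ g
  close⇒≼ {f} {g} h ε 0<ε = eventually-map (λ n → ∣-∣≤⇒≤+ {f n} {g n}) (h ε 0<ε)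

  close⇒≽ : ∀ {f g} → (∀ ε → 0ℚ < ε → Eventually λ n → ∣ f n - g n ∣ ≤ ε) → g ≼ f
  close⇒≽ {f} {g} h ε 0<ε = eventually-map (λ n → ∣-∣≤⇒≤+′ {f n} {g n}) (h ε 0<ε)

  -- The factor `h` may change sign here, because the two-sided gap |f - g| is what gets multiplied
  -- by a bound for |h|.
  ≼-*-cong : ∀ {f g h} → Cauchy h → f ≼ g → g ≼ f → (λ n → f n * h n) ≼ (λ n → g n * h n)
  ≼-*-cong {f} {g} {h} ch p q = close⇒≼ {λ n → f n * h n} {λ n → g n * h n} λ ε 0<ε →
    let B , 0≤B , h≤B = bounded {h} ch
        δ , 0<δ , Bδ≤ε = scale B 0≤B ε 0<ε
    in eventually-map (λ n le → begin
      ∣ f n * h n - g n * h n ∣     ≡⟨ cong ∣_∣ (solve 3 (λ f g h → f :* h :- g :* h := h :* (f :- g)) refl (f n) (g n) (h n)) ⟩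
      ∣ h n * (f n - g n) ∣         ≡⟨ ∣p*q∣≡∣p∣*∣q∣ (h n) _ ⟩
      ∣ h n ∣ * ∣ f n - g n ∣       ≤⟨ *-monoʳ (0≤∣p∣ _) (h≤B n) ⟩
      B * ∣ f n - g n ∣             ≤⟨ *-monoˡ 0≤B le ⟩
      B * δ                         ≤⟨ Bδ≤ε ⟩
      ε                             ∎)
      (≼-close {f} {g} p q δ 0<δ)
    where open ≤-Reasoning

  -- With x ≥ -δ and z - y ≥ -δ expand 0 ≤ (x + δ)(z - y + δ).
  ≼-*-mono : ∀ {x y z} → Cauchy x → Cauchy y → Cauchy z → (λ _ → 0ℚ) ≼ x → y ≼ z →
             (λ n → x n * y n) ≼ (λ n → x n * z n)
  ≼-*-mono {x} {y} {z} cx cy cz 0≼x y≼z ε 0<ε = eventually-map step (both (0≼x δ 0<δ) (y≼z δ 0<δ))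
    where
    open ≤-Reasoning
    X = proj₁ (bounded {x} cx)
    Y = proj₁ (bounded {y} cy)
    Z = proj₁ (bounded {z} cz)
    0≤X = proj₁ (proj₂ (bounded {x} cx))
    0≤Y = proj₁ (proj₂ (bounded {y} cy))
    0≤Z = proj₁ (proj₂ (bounded {z} cz))
    S = X + (Y + Z) + ε
    0≤X+ = 0≤+ 0≤X (0≤+ 0≤Y 0≤Z)
    1+S = S + 1ℚ
    sc = scale 1+S (0≤+ (0≤+ 0≤X+ (<⇒≤ 0<ε)) (0≤ι 1)) ε 0<ε
    δ = proj₁ sc
    0<δ = proj₁ (proj₂ sc)
    δ≤ε : δ ≤ ε
    δ≤ε = begin
      δ               ≡⟨ sym (*-identityˡ δ) ⟩
      1ℚ * δ          ≤⟨ *-monoʳ (<⇒≤ 0<δ) (subst (_≤ 1+S) (+-identityˡ 1ℚ) (+-monoˡ-≤ 1ℚ (0≤+ 0≤X+ (<⇒≤ 0<ε)))) ⟩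
      1+S * δ         ≤⟨ proj₂ (proj₂ sc) ⟩
      ε               ∎
    step : ∀ n → 0ℚ ≤ x n + δ × y n ≤ z n + δ → x n * y n ≤ x n * z n + ε
    step n (a , b) = begin
      x n * y n
        ≤⟨ 0≤sub {x n * y n} (subst (0ℚ ≤_)
             (solve 4 (λ x y z d → (x :+ d) :* (z :+ d :- y) := x :* z :+ (x :+ (z :- y) :+ d) :* d :- x :* y) refl (x n) (y n) (z n) δ)
             (0≤* a (CauchyLemmas.≤-sub b))) ⟩
      x n * z n + (x n + (z n - y n) + δ) * δ
        ≤⟨ +-monoʳ-≤ (x n * z n) (*-monoʳ (<⇒≤ 0<δ) (+-mono-≤ (+-mono-≤ xb zyb) δ≤ε)) ⟩
      x n * z n + S * δ
        ≤⟨ +-monoʳ-≤ (x n * z n) (*-monoʳ (<⇒≤ 0<δ) (≤-add {1ℚ} {S} (0≤ι 1))) ⟩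
      x n * z n + 1+S * δ
        ≤⟨ +-monoʳ-≤ (x n * z n) (proj₂ (proj₂ sc)) ⟩
      x n * z n + ε ∎
      where
      xb = ≤-trans (p≤∣p∣ (x n)) (proj₂ (proj₂ (bounded {x} cx)) n)
      zyb : z n - y n ≤ Y + Z
      zyb = subst (z n - y n ≤_) (+-comm Z Y) (+-mono-≤
        (≤-trans (p≤∣p∣ (z n)) (proj₂ (proj₂ (bounded {z} cz)) n))
        (≤-trans (-p≤∣p∣ (y n)) (proj₂ (proj₂ (bounded {y} cy)) n)))

  cauchy-+ : ∀ {f g} → Cauchy f → Cauchy g → Cauchy (λ n → f n + g n)
  cauchy-+ {f} {g} cf cg ε 0<ε = N , λ m n N≤m N≤n → begin
      ∣ f m + g m - (f n + g n) ∣       ≡⟨ cong ∣_∣ (solve 4 (λ a b c d → a :+ b :- (c :+ d) := a :- c :+ (b :- d)) refl (f m) (g m) (f n) (g n)) ⟩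
      ∣ f m - f n + (g m - g n) ∣       ≤⟨ ∣p+q∣≤∣p∣+∣q∣ (f m - f n) (g m - g n) ⟩
      ∣ f m - f n ∣ + ∣ g m - g n ∣     ≤⟨ +-mono-≤
         (proj₂ hf m n (ℕ.≤-trans (ℕ.m≤m⊔n _ (proj₁ hg)) N≤m) (ℕ.≤-trans (ℕ.m≤m⊔n _ (proj₁ hg)) N≤n))
         (proj₂ hg m n (ℕ.≤-trans (ℕ.m≤n⊔m (proj₁ hf) _) N≤m) (ℕ.≤-trans (ℕ.m≤n⊔m (proj₁ hf) _) N≤n)) ⟩
      ½ * ε + ½ * ε                     ≡⟨ ½+½ ε ⟩
      ε                                 ∎
    where
    open ≤-Reasoning
    hf = cf _ (half ε 0<ε)
    hg = cg _ (half ε 0<ε)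
    N = proj₁ hf ℕ.⊔ proj₁ hg

  reciprocal : ∀ ε → 0ℚ < ε → ∃ λ N → 1ℚ ≤ ι (suc N) * ε
  reciprocal ε 0<ε = N , subst (_≤ ι (suc N) * ε) (*-inverseˡ ε)
      (*-monoʳ (<⇒≤ 0<ε) (≤-trans (proj₂ (arch (1/ ε))) (ι-mono (ℕ.n≤1+n N))))
    where
    instance
      ε≢0 : NonZero ε
      ε≢0 = >-nonZero 0<ε
    N = proj₁ (arch (1/ ε))

  stretch : ∀ N ε q → 1ℚ ≤ ι (suc N) * ε → 1ℚ + ε ≤ q → ι (suc (suc N)) ≤ ι (suc N) * q
  stretch N ε q 1≤ h = begin
    ι (suc (suc N))            ≡⟨ ι-suc (suc N) ⟩
    1ℚ + ι (suc N)             ≤⟨ +-monoˡ-≤ (ι (suc N)) 1≤ ⟩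
    ι (suc N) * ε + ι (suc N)  ≡⟨ solve 2 (λ n e → n :* e :+ n := n :* (con 1ℚ :+ e)) refl (ι (suc N)) ε ⟩
    ι (suc N) * (1ℚ + ε)       ≤⟨ *-monoˡ (0≤ι (suc N)) h ⟩
    ι (suc N) * q              ∎
    where open ≤-Reasoning

  infix 4 _⊑_ _≈_

  -- A record, unlike the function ≤ℝ, lets Agda recover x and y from x ⊑ y.
  record _⊑_ (x y : ℝ) : Set where
    constructor ⊑-intro
    field ⊑-elim : x ≤ℝ y

  open _⊑_ public

  record _≈_ (x y : ℝ) : Set where
    constructor _,≈_
    field
      ≈⇒⊑ : x ⊑ y
      ≈⇒⊒ : y ⊑ x

  open _≈_ public

  ⊑-refl : ∀ {x} → x ⊑ x
  ⊑-refl {x} = ⊑-intro (≡⇒≼ {seq x} {seq x} (λ _ → refl))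

  ⊑-trans : ∀ {x y z} → x ⊑ y → y ⊑ z → x ⊑ z
  ⊑-trans {x} {y} {z} (⊑-intro p) (⊑-intro q) = ⊑-intro (≼-trans {seq x} {seq y} {seq z} p q)

  ≈-refl : ∀ {x} → x ≈ x
  ≈-refl = ⊑-refl ,≈ ⊑-refl

  ≈-sym : ∀ {x y} → x ≈ y → y ≈ x
  ≈-sym (p ,≈ q) = q ,≈ p

  ≈-trans : ∀ {x y z} → x ≈ y → y ≈ z → x ≈ z
  ≈-trans (p ,≈ q) (p′ ,≈ q′) = ⊑-trans p p′ ,≈ ⊑-trans q′ q

  pointwise : ∀ x y → (∀ n → seq x n ≡ seq y n) → x ≈ y
  pointwise x y h = ⊑-intro (≡⇒≼ {seq x} {seq y} h) ,≈ ⊑-intro (≡⇒≼ {seq y} {seq x} (λ n → sym (h n)))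

  infixl 6 _⊞_
  infixl 7 _⊠_

  -- Opaque, since unfolding products of reals during unification is very slow.
  opaque

    _⊞_ _⊠_ : ℝ → ℝ → ℝ
    x ⊞ y = mkℝ (λ n → seq x n + seq y n) (cauchy-+ {seq x} {seq y} (cauchy x) (cauchy y))
    x ⊠ y = x *ℝ y

    cst : ℕ → ℝ
    cst = fromℕ

    rat : ℚ → ℝ
    rat = fromℚ

  opaque
    unfolding _⊞_

    ⊠-def : ∀ x y → x ⊠ y ≡ x *ℝ y
    ⊠-def x y = refl

    cst-def : ∀ n → cst n ≡ fromℕ n
    cst-def n = refl

    rat-def : ∀ q → rat q ≡ fromℚ q
    rat-def q = refl

    ⊞-mono : ∀ {x x′ y y′} → x ⊑ x′ → y ⊑ y′ → x ⊞ y ⊑ x′ ⊞ y′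
    ⊞-mono {x} {x′} {y} {y′} (⊑-intro p) (⊑-intro q) =
      ⊑-intro (≼-+ {seq x} {seq x′} {seq y} {seq y′} p q)

    ⊠-monoʳ : ∀ {x y z} → cst 0 ⊑ x → y ⊑ z → x ⊠ y ⊑ x ⊠ z
    ⊠-monoʳ {x} {y} {z} (⊑-intro p) (⊑-intro q) =
      ⊑-intro (≼-*-mono {seq x} {seq y} {seq z} (cauchy x) (cauchy y) (cauchy z) p q)

    ⊠-congˡ : ∀ {x y z} → x ≈ y → x ⊠ z ≈ y ⊠ z
    ⊠-congˡ {x} {y} {z} (⊑-intro p ,≈ ⊑-intro q) =
      ⊑-intro (≼-*-cong {seq x} {seq y} {seq z} (cauchy z) p q) ,≈
      ⊑-intro (≼-*-cong {seq y} {seq x} {seq z} (cauchy z) q p)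

    ⊞-assoc : ∀ x y z → (x ⊞ y) ⊞ z ≈ x ⊞ (y ⊞ z)
    ⊞-assoc x y z = pointwise ((x ⊞ y) ⊞ z) (x ⊞ (y ⊞ z)) (λ n → +-assoc (seq x n) (seq y n) (seq z n))

    ⊞-comm : ∀ x y → x ⊞ y ≈ y ⊞ x
    ⊞-comm x y = pointwise (x ⊞ y) (y ⊞ x) (λ n → +-comm (seq x n) (seq y n))

    ⊞-identityˡ : ∀ x → cst 0 ⊞ x ≈ x
    ⊞-identityˡ x = pointwise (cst 0 ⊞ x) x (λ n → +-identityˡ (seq x n))

    ⊠-assoc : ∀ x y z → (x ⊠ y) ⊠ z ≈ x ⊠ (y ⊠ z)
    ⊠-assoc x y z = pointwise ((x ⊠ y) ⊠ z) (x ⊠ (y ⊠ z)) (λ n → *-assoc (seq x n) (seq y n) (seq z n))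

    ⊠-comm : ∀ x y → x ⊠ y ≈ y ⊠ x
    ⊠-comm x y = pointwise (x ⊠ y) (y ⊠ x) (λ n → *-comm (seq x n) (seq y n))

    ⊠-identityˡ : ∀ x → cst 1 ⊠ x ≈ x
    ⊠-identityˡ x = pointwise (cst 1 ⊠ x) x (λ n → *-identityˡ (seq x n))

    ⊠-zeroˡ : ∀ x → cst 0 ⊠ x ≈ cst 0
    ⊠-zeroˡ x = pointwise (cst 0 ⊠ x) (cst 0) (λ n → *-zeroˡ (seq x n))

    ⊠-distribʳ-⊞ : ∀ x y z → (y ⊞ z) ⊠ x ≈ y ⊠ x ⊞ z ⊠ x
    ⊠-distribʳ-⊞ x y z = pointwise ((y ⊞ z) ⊠ x) (y ⊠ x ⊞ z ⊠ x) (λ n → *-distribʳ-+ (seq x n) (seq y n) (seq z n))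

    cst-* : ∀ m n → cst (m ℕ.* n) ≈ cst m ⊠ cst n
    cst-* m n = pointwise (cst (m ℕ.* n)) (cst m ⊠ cst n) (λ _ → ι-* m n)

    cst-suc : ∀ n → cst (suc n) ≈ cst 1 ⊞ cst n
    cst-suc n = pointwise (cst (suc n)) (cst 1 ⊞ cst n) (λ _ → ι-suc n)

    cst-mono : ∀ {m n} → m ℕ.≤ n → cst m ⊑ cst n
    cst-mono {m} {n} m≤n = ⊑-intro (≤⇒≼ {λ _ → ι m} {λ _ → ι n} (λ _ → ι-mono m≤n))

    rat-mono : ∀ {p q} → p ≤ q → rat p ⊑ rat q
    rat-mono {p} {q} p≤q = ⊑-intro (≤⇒≼ {λ _ → p} {λ _ → q} (λ _ → p≤q))

    rat-+ : ∀ p q → rat (p + q) ≈ rat p ⊞ rat q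
    rat-+ p q = pointwise (rat (p + q)) (rat p ⊞ rat q) (λ _ → refl)

    rat-* : ∀ p q → rat (p * q) ≈ rat p ⊠ rat q
    rat-* p q = pointwise (rat (p * q)) (rat p ⊠ rat q) (λ _ → refl)

    rat-ι : ∀ n → rat (ι n) ≈ cst n
    rat-ι n = pointwise (rat (ι n)) (cst n) (λ _ → refl)

    rat-positive : ∀ q → 0ℚ < q → 0ℝ <ℝ rat q
    rat-positive q 0<q = q , 0<q , 0 , λ _ _ → ≤-reflexive (+-identityˡ q)

    -- The way back from reals to integers: if n + 1 ≤ m, the tolerance ½ would yield 1 ≤ ½.
    cst-reflect : ∀ {m n} → cst m ⊑ cst n → m ℕ.≤ n
    cst-reflect {m} {n} (⊑-intro p) with m ℕ.≤? n
    ... | Relation.Nullary.yes m≤n = m≤n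
    ... | Relation.Nullary.no m≰n with p ½ (*<* (ℤ.+<+ (ℕ.s≤s ℕ.z≤n)))
    ...   | N , h = Relation.Nullary.contradiction
      (≤-trans (subst (_≤ ι m) (ι-suc n) (ι-mono (ℕ.≰⇒> m≰n))) (h N ℕ.≤-refl))
      (λ le → 1≰½ (subst₂ _≤_ (solve 1 (λ n → con 1ℚ :+ n :- n := con 1ℚ) refl (ι n)) (solve 1 (λ n → n :+ con ½ :- n := con ½) refl (ι n)) (+-monoˡ-≤ (- ι n) le)))
      where
      1≰½ : 1ℚ ≤ ½ → Data.Empty.⊥
      1≰½ (*≤* (ℤ.+≤+ (ℕ.s≤s ())))

    archimedean : ∀ x → ∃ λ N → x ⊑ cst N
    archimedean x =
      let B , _ , x≤B = bounded {seq x} (cauchy x)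
          N , B≤N = arch B
      in N , ⊑-intro (≤⇒≼ {seq x} {λ _ → ι N} (λ n → ≤-trans (p≤∣p∣ (seq x n)) (≤-trans (x≤B n) B≤N)))

    ⊑-cst-⊠ : ∀ m k x → (λ _ → ι m) ≼ (λ n → ι k * seq x n) → cst m ⊑ cst k ⊠ x
    ⊑-cst-⊠ m k x h = ⊑-intro h

    -- Allows `EXP-LOG` to be shown up to a rational error. Half of ε pays for that error and half
    -- for the tolerance built into `≤ℝ`.
    ⊑-closure : ∀ x y → (∀ ε → 0ℚ < ε → x ⊑ y ⊞ rat ε) → x ⊑ y
    ⊑-closure x y h = ⊑-intro λ ε 0<ε → eventually-map
      (λ n le → subst (seq x n ≤_) (trans (+-assoc (seq y n) _ _) (cong (λ z → seq y n + z) (½+½ ε))) le)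
      (⊑-elim (h (½ * ε) (half ε 0<ε)) (½ * ε) (half ε 0<ε))

  -- Trades the real K for a fraction (N + 2)/(N + 1) ≤ K, so that the ratio condition can be met by
  -- an inequality between integer powers.
  above-one : ∀ {K} → 1ℝ <ℝ K → ∃ λ N → cst (suc (suc N)) ⊑ cst (suc N) ⊠ K
  above-one {K} (ε , 0<ε , M , h) = N , ⊑-cst-⊠ (suc (suc N)) (suc N) K
      (eventually≤⇒≼ {λ _ → ι (suc (suc N))} {λ n → ι (suc N) * seq K n}
        (M , λ n M≤n → stretch N ε (seq K n) (proj₂ (reciprocal ε 0<ε)) (h n M≤n)))
    where
    N : ℕ
    N = proj₁ (reciprocal ε 0<ε)

  opaque
    unfolding _⊞_

    ⊞-cancelˡ : ∀ x {y z} → x ⊞ y ⊑ x ⊞ z → y ⊑ z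
    ⊞-cancelˡ x {y} {z} (⊑-intro h) = ⊑-intro λ ε 0<ε → eventually-map
      (λ n le → subst₂ _≤_ (solve 2 (λ x y → :- x :+ (x :+ y) := y) refl (seq x n) (seq y n))
        (solve 3 (λ x z e → :- x :+ (x :+ z :+ e) := z :+ e) refl (seq x n) (seq z n) ε)
        (+-monoʳ-≤ (- seq x n) le))
      (h ε 0<ε)

  ⊞-cong : ∀ {x x′ y y′} → x ≈ x′ → y ≈ y′ → x ⊞ y ≈ x′ ⊞ y′
  ⊞-cong (p ,≈ q) (p′ ,≈ q′) = ⊞-mono p p′ ,≈ ⊞-mono q q′

  ⊠-cong : ∀ {x x′ y y′} → x ≈ x′ → y ≈ y′ → x ⊠ y ≈ x′ ⊠ y′
  ⊠-cong {x} {x′} {y} {y′} p q = ≈-trans (⊠-congˡ p) (≈-trans (⊠-comm x′ y) (≈-trans (⊠-congˡ q) (⊠-comm y′ x′)))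

  ⊠-congʳ : ∀ {x y y′} → y ≈ y′ → x ⊠ y ≈ x ⊠ y′
  ⊠-congʳ = ⊠-cong ≈-refl

  -- Serves the solver `solveℝ`; the identities to be solved involve only sums and products.
  ℝ-commutativeSemiring : CommutativeSemiring 0ℓ 0ℓ
  ℝ-commutativeSemiring = record
    { Carrier = ℝ ; _≈_ = _≈_ ; _+_ = _⊞_ ; _*_ = _⊠_ ; 0# = cst 0 ; 1# = cst 1
    ; isCommutativeSemiring = record
      { isSemiring = record
        { isSemiringWithoutAnnihilatingZero = record
          { +-isCommutativeMonoid = record
            { isMonoid = record
              { isSemigroup = record
                { isMagma = record
                  { isEquivalence = record { refl = ≈-refl ; sym = ≈-sym ; trans = ≈-trans }
                  ; ∙-cong = ⊞-cong }
                ; assoc = ⊞-assoc }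
              ; identity = ⊞-identityˡ , λ x → ≈-trans (⊞-comm x (cst 0)) (⊞-identityˡ x) }
            ; comm = ⊞-comm }
          ; *-cong = ⊠-cong
          ; *-assoc = ⊠-assoc
          ; *-identity = ⊠-identityˡ , λ x → ≈-trans (⊠-comm x (cst 1)) (⊠-identityˡ x)
          ; distrib = (λ x y z → ≈-trans (⊠-comm x (y ⊞ z)) (≈-trans (⊠-distribʳ-⊞ x y z) (⊞-cong (⊠-comm y x) (⊠-comm z x))))
                    , ⊠-distribʳ-⊞ }
        ; zero = ⊠-zeroˡ , λ x → ≈-trans (⊠-comm x (cst 0)) (⊠-zeroˡ x) }
      ; *-comm = ⊠-comm } }

  ⊠-monoˡ : ∀ {x y z} → cst 0 ⊑ z → x ⊑ y → x ⊠ z ⊑ y ⊠ z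
  ⊠-monoˡ {x} {y} {z} 0⊑z x⊑y =
    ⊑-trans (≈⇒⊑ (⊠-comm x z)) (⊑-trans (⊠-monoʳ 0⊑z x⊑y) (≈⇒⊑ (⊠-comm z y)))

  0⊑cst : ∀ n → cst 0 ⊑ cst n
  0⊑cst n = cst-mono ℕ.z≤n

  0⊑⊠ : ∀ {x y} → cst 0 ⊑ x → cst 0 ⊑ y → cst 0 ⊑ x ⊠ y
  0⊑⊠ {x} {y} 0⊑x 0⊑y = ⊑-trans (≈⇒⊒ (⊠-zeroˡ y)) (⊠-monoˡ 0⊑y 0⊑x)

  cst-⊠-rat : ∀ k → cst (suc k) ⊠ rat (u k) ≈ cst 1
  cst-⊠-rat k = ≈-trans (⊠-congˡ (≈-sym (rat-ι (suc k)))) (≈-trans (≈-sym (rat-* (ι (suc k)) (u k)))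
    (subst (λ z → rat z ≈ cst 1) (sym (trans (*-comm (ι (suc k)) (u k)) (uι k))) (rat-ι 1)))

  0⊑rat : ∀ {q} → 0ℚ ≤ q → cst 0 ⊑ rat q
  0⊑rat 0≤q = ⊑-trans (≈⇒⊒ (rat-ι 0)) (rat-mono 0≤q)

-- Truncated exponential series: addition law, positivity, monotonicity

module ExponentialSums where

  open import Defs hiding (W; C)
  open RealArithmetic
  open import Data.Nat as ℕ using (ℕ; zero; suc)
  import Data.Nat.Properties as ℕ
  open import Data.Rational
  open import Data.Rational.Properties
  open import Data.Rational.Solver
  open import Data.Sum using (inj₁; inj₂)
  open import Data.Product using (_,_; proj₁; proj₂)
  open import Function using (_∘_)
  open import Relation.Binary.PropositionalEquality
  open +-*-Solver using (solve; _:+_; _:*_; _:-_; :-_; _:=_; con)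
  open ExpLemmas using (0≤term; ∣term∣; 0≤1; module Tail)

  -- Sums over i ≤ n of f i, over i + j = n of f i g j, over i + j ≤ n of f i g j, and
  -- over the rest i + j > n of the square i, j ≤ n.
  partial : (ℕ → ℚ) → ℕ → ℚ
  partial f zero    = f 0
  partial f (suc n) = f 0 + partial (f ∘ suc) n

  convolution triangle corner : (f g : ℕ → ℚ) → ℕ → ℚ
  convolution f g zero    = f 0 * g 0
  convolution f g (suc n) = f 0 * g (suc n) + convolution (f ∘ suc) g n
  triangle f g zero    = f 0 * g 0
  triangle f g (suc n) = f 0 * partial g (suc n) + triangle (f ∘ suc) g n
  corner f g zero    = 0ℚ
  corner f g (suc n) = corner (f ∘ suc) g n + partial (f ∘ suc) n * g (suc n)

  partial-snoc : ∀ f n → partial f (suc n) ≡ partial f n + f (suc n)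
  partial-snoc f zero    = refl
  partial-snoc f (suc n) = trans (cong (f 0 +_) (partial-snoc (f ∘ suc) n)) (sym (+-assoc (f 0) _ _))

  triangle-snoc : ∀ f g n → triangle f g (suc n) ≡ triangle f g n + convolution f g (suc n)
  triangle-snoc f g zero = solve 4 (λ a b c d → a :* (c :+ d) :+ b :* c := a :* c :+ (a :* d :+ b :* c)) refl (f 0) (f 1) (g 0) (g 1)
  triangle-snoc f g (suc n) = trans
    (cong₂ (λ a b → f 0 * a + b) (partial-snoc g (suc n)) (triangle-snoc (f ∘ suc) g n))
    (solve 5 (λ a e g t c → a :* (e :+ g) :+ (t :+ c) := a :* e :+ t :+ (a :* g :+ c)) refl
      (f 0) (partial g (suc n)) (g (suc (suc n))) (triangle (f ∘ suc) g n) (convolution (f ∘ suc) g (suc n)))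

  square : ∀ f g n → partial f n * partial g n ≡ triangle f g n + corner f g n
  square f g zero    = sym (+-identityʳ _)
  square f g (suc n) = begin
    (f 0 + F) * G
      ≡⟨ *-distribʳ-+ G (f 0) F ⟩
    f 0 * G + F * G
      ≡⟨ cong (λ z → f 0 * G + F * z) (partial-snoc g n) ⟩
    f 0 * G + F * (partial g n + g (suc n))
      ≡⟨ cong (f 0 * G +_) (*-distribˡ-+ F (partial g n) (g (suc n))) ⟩
    f 0 * G + (F * partial g n + F * g (suc n))
      ≡⟨ cong (λ z → f 0 * G + (z + F * g (suc n))) (square (f ∘ suc) g n) ⟩
    f 0 * G + (triangle (f ∘ suc) g n + corner (f ∘ suc) g n + F * g (suc n))
      ≡⟨ solve 4 (λ a t c r → a :+ (t :+ c :+ r) := a :+ t :+ (c :+ r)) refl (f 0 * G) (triangle (f ∘ suc) g n) _ _ ⟩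
    f 0 * G + triangle (f ∘ suc) g n + (corner (f ∘ suc) g n + F * g (suc n)) ∎
    where
    open ≡-Reasoning
    F = partial (f ∘ suc) n
    G = partial g (suc n)

  convolution-+ : ∀ {f k h} g → (∀ i → h i ≡ f i + k i) → ∀ n →
                  convolution h g n ≡ convolution f g n + convolution k g n
  convolution-+ {f} {k} g e zero    = trans (cong (_* g 0) (e 0)) (*-distribʳ-+ (g 0) (f 0) (k 0))
  convolution-+ {f} {k} g e (suc n) = trans (cong₂ (λ a b → a * g (suc n) + b) (e 0) (convolution-+ g (e ∘ suc) n))
    (solve 5 (λ a b g c d → (a :+ b) :* g :+ (c :+ d) := a :* g :+ c :+ (b :* g :+ d)) refl
      (f 0) (k 0) (g (suc n)) (convolution (f ∘ suc) g n) (convolution (k ∘ suc) g n))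

  convolution-scaleˡ : ∀ {f h} x g → (∀ i → h i ≡ x * f i) → ∀ n → convolution h g n ≡ x * convolution f g n
  convolution-scaleˡ {f} x g e zero    = trans (cong (_* g 0) (e 0)) (*-assoc x (f 0) (g 0))
  convolution-scaleˡ {f} x g e (suc n) = trans (cong₂ (λ a b → a * g (suc n) + b) (e 0) (convolution-scaleˡ x g (e ∘ suc) n))
    (solve 4 (λ x f g c → x :* f :* g :+ x :* c := x :* (f :* g :+ c)) refl x (f 0) (g (suc n)) (convolution (f ∘ suc) g n))

  convolution-scaleʳ : ∀ f {g h} y → (∀ i → h i ≡ y * g i) → ∀ n → convolution f h n ≡ y * convolution f g n
  convolution-scaleʳ f {g} y e zero    = trans (cong (f 0 *_) (e 0)) (solve 3 (λ y f g → f :* (y :* g) := y :* (f :* g)) refl y (f 0) (g 0))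
  convolution-scaleʳ f {g} y e (suc n) = trans (cong₂ (λ a b → f 0 * a + b) (e (suc n)) (convolution-scaleʳ (f ∘ suc) y e n))
    (solve 4 (λ y f g c → f :* (y :* g) :+ y :* c := y :* (f :* g :+ c)) refl y (f 0) (g (suc n)) (convolution (f ∘ suc) g n))

  -- The coefficients of the derivative of the power series with coefficients f.
  derivative : (ℕ → ℚ) → ℕ → ℚ
  derivative f i = ι (suc i) * f (suc i)

  -- The product rule (f g)′ = f′ g + f g′, read off at the n-th coefficient.
  leibniz : ∀ f g n → ι (suc n) * convolution f g (suc n) ≡
                      convolution (derivative f) g n + convolution f (derivative g) n
  leibniz f g zero = solve 5 (λ o a b c d → o :* (a :* d :+ b :* c) := o :* b :* c :+ a :* (o :* d)) refl (ι 1) (f 0) (f 1) (g 0) (g 1)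
  leibniz f g (suc n) = begin
    ι (suc (suc n)) * (f 0 * g″ + (f 1 * g (suc n) + C))
      ≡⟨ solve 4 (λ m a b c → m :* (a :* b :+ c) := a :* (m :* b) :+ m :* c) refl (ι (suc (suc n))) (f 0) g″ (f 1 * g (suc n) + C) ⟩
    f 0 * (ι (suc (suc n)) * g″) + ι (suc (suc n)) * (f 1 * g (suc n) + C)
      ≡⟨ cong (λ z → f 0 * G + z * (f 1 * g (suc n) + C)) (ι-suc (suc n)) ⟩
    f 0 * G + (1ℚ + ι (suc n)) * (f 1 * g (suc n) + C)
      ≡⟨ cong (f 0 * G +_) (trans (*-distribʳ-+ (f 1 * g (suc n) + C) 1ℚ (ι (suc n))) (cong (1ℚ * (f 1 * g (suc n) + C) +_) (leibniz (f ∘ suc) g n))) ⟩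
    f 0 * G + (1ℚ * (f 1 * g (suc n) + C) + (P + Q))
      ≡⟨ solve 5 (λ a p q b c → a :+ (con 1ℚ :* (b :+ c) :+ (p :+ q)) := b :+ (p :+ c) :+ (a :+ q)) refl (f 0 * G) P Q (f 1 * g (suc n)) C ⟩
    f 1 * g (suc n) + (P + C) + (f 0 * G + Q)
      ≡⟨ cong₂ (λ a b → a * g (suc n) + b + (f 0 * G + Q)) (sym (*-identityˡ (f 1)))
           (sym (convolution-+ g (λ i → trans (cong (_* f (suc (suc i))) (ι-suc (suc i)))
              (solve 2 (λ m f → (con 1ℚ :+ m) :* f := m :* f :+ f) refl (ι (suc i)) (f (suc (suc i))))) n)) ⟩
    derivative f 0 * g (suc n) + convolution (derivative f ∘ suc) g n + (f 0 * G + Q) ∎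
    where
    open ≡-Reasoning
    g″ = g (suc (suc n))
    G = ι (suc (suc n)) * g″
    C = convolution (f ∘ suc ∘ suc) g n
    P = convolution (derivative (f ∘ suc)) g n
    Q = convolution (f ∘ suc) (derivative g) n

  derivative-term : ∀ x i → derivative (term x) i ≡ x * term x i
  derivative-term x i = begin
    ι (suc i) * (term x i * x * u i)      ≡⟨ solve 4 (λ n t x u → n :* (t :* x :* u) := x :* t :* (u :* n)) refl (ι (suc i)) (term x i) x (u i) ⟩
    x * term x i * (u i * ι (suc i))      ≡⟨ cong (x * term x i *_) (uι i) ⟩
    x * term x i * 1ℚ                     ≡⟨ *-identityʳ _ ⟩
    x * term x i                          ∎
    where open ≡-Reasoning

  -- Both sides satisfy (n + 1) c(n + 1) = (x + y) c(n). For the left side this is the product rule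
  -- applied to two series with f′ = x f and g′ = y g, which keeps binomial coefficients out of the
  -- argument.
  binomial : ∀ x y n → convolution (term x) (term y) n ≡ term (x + y) n
  binomial x y zero    = refl
  binomial x y (suc n) = begin
    c (suc n)                               ≡⟨ sym (*-identityˡ _) ⟩
    1ℚ * c (suc n)                          ≡⟨ cong (_* c (suc n)) (sym (uι n)) ⟩
    u n * ι (suc n) * c (suc n)             ≡⟨ *-assoc (u n) (ι (suc n)) _ ⟩
    u n * (ι (suc n) * c (suc n))           ≡⟨ cong (u n *_) (leibniz (term x) (term y) n) ⟩
    u n * (convolution (derivative (term x)) (term y) n + convolution (term x) (derivative (term y)) n)
      ≡⟨ cong₂ (λ a b → u n * (a + b)) (convolution-scaleˡ x (term y) (derivative-term x) n) (convolution-scaleʳ (term x) y (derivative-term y) n) ⟩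
    u n * (x * c n + y * c n)               ≡⟨ solve 4 (λ u x y c → u :* (x :* c :+ y :* c) := c :* (x :+ y) :* u) refl (u n) x y (c n) ⟩
    c n * (x + y) * u n                     ≡⟨ cong (λ z → z * (x + y) * u n) (binomial x y n) ⟩
    term (x + y) n * (x + y) * u n          ∎
    where
    open ≡-Reasoning
    c = convolution (term x) (term y)

  expSum-partial : ∀ x n → expSum x n ≡ partial (term x) n
  expSum-partial x zero    = refl
  expSum-partial x (suc n) = trans (cong (_+ term x (suc n)) (expSum-partial x n)) (sym (partial-snoc (term x) n))

  expSum-triangle : ∀ x y n → triangle (term x) (term y) n ≡ expSum (x + y) n
  expSum-triangle x y zero    = refl
  expSum-triangle x y (suc n) = trans (triangle-snoc (term x) (term y) n)
    (cong₂ _+_ (expSum-triangle x y n) (binomial x y (suc n)))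

  partial-dominated : ∀ {f F} → (∀ i → ∣ f i ∣ ≤ F i) → ∀ n → ∣ partial f n ∣ ≤ partial F n
  partial-dominated f≤F zero        = f≤F 0
  partial-dominated {f} f≤F (suc n) =
    ≤-trans (∣p+q∣≤∣p∣+∣q∣ (f 0) _) (+-mono-≤ (f≤F 0) (partial-dominated (f≤F ∘ suc) n))

  corner-dominated : ∀ {f g F G} → (∀ i → ∣ f i ∣ ≤ F i) → (∀ i → ∣ g i ∣ ≤ G i) →
                     ∀ n → ∣ corner f g n ∣ ≤ corner F G n
  corner-dominated f≤F g≤G zero = ≤-refl
  corner-dominated {f} {g} {F} {G} f≤F g≤G (suc n) = begin
    ∣ corner (f ∘ suc) g n + partial (f ∘ suc) n * g (suc n) ∣
      ≤⟨ ∣p+q∣≤∣p∣+∣q∣ (corner (f ∘ suc) g n) _ ⟩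
    ∣ corner (f ∘ suc) g n ∣ + ∣ partial (f ∘ suc) n * g (suc n) ∣
      ≡⟨ cong (∣ corner (f ∘ suc) g n ∣ +_) (∣p*q∣≡∣p∣*∣q∣ (partial (f ∘ suc) n) (g (suc n))) ⟩
    ∣ corner (f ∘ suc) g n ∣ + ∣ partial (f ∘ suc) n ∣ * ∣ g (suc n) ∣
      ≤⟨ +-mono-≤ (corner-dominated (f≤F ∘ suc) g≤G n)
           (≤-trans (*-monoʳ (0≤∣p∣ _) f≤) (*-monoˡ (≤-trans (0≤∣p∣ _) f≤) (g≤G (suc n)))) ⟩
    corner (F ∘ suc) G n + partial (F ∘ suc) n * G (suc n) ∎
    where
    open ≤-Reasoning
    f≤ = partial-dominated (f≤F ∘ suc) n

  0≤partial : ∀ {f} → (∀ i → 0ℚ ≤ f i) → ∀ n → 0ℚ ≤ partial f n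
  0≤partial 0≤f zero    = 0≤f 0
  0≤partial 0≤f (suc n) = 0≤+ (0≤f 0) (0≤partial (0≤f ∘ suc) n)

  0≤triangle : ∀ {f g} → (∀ i → 0ℚ ≤ f i) → (∀ i → 0ℚ ≤ g i) → ∀ n → 0ℚ ≤ triangle f g n
  0≤triangle 0≤f 0≤g zero    = 0≤* (0≤f 0) (0≤g 0)
  0≤triangle 0≤f 0≤g (suc n) = 0≤+ (0≤* (0≤f 0) (0≤partial 0≤g (suc n))) (0≤triangle (0≤f ∘ suc) 0≤g n)

  -- The rectangle i ≤ m, j ≤ n lies inside the triangle i + j ≤ m + n, and all terms are
  -- nonnegative.
  rectangle≤triangle : ∀ {f g} → (∀ i → 0ℚ ≤ f i) → (∀ i → 0ℚ ≤ g i) →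
                       ∀ m n → partial f m * partial g n ≤ triangle f g (m ℕ.+ n)
  rectangle≤triangle 0≤f 0≤g zero zero    = ≤-refl
  rectangle≤triangle 0≤f 0≤g zero (suc n) = ≤-add (0≤triangle (0≤f ∘ suc) 0≤g n)
  rectangle≤triangle {f} {g} 0≤f 0≤g (suc m) n = begin
    (f 0 + partial (f ∘ suc) m) * partial g n
      ≡⟨ *-distribʳ-+ (partial g n) (f 0) _ ⟩
    f 0 * partial g n + partial (f ∘ suc) m * partial g n
      ≤⟨ +-mono-≤ (*-monoˡ (0≤f 0) (grow (suc m))) (rectangle≤triangle (0≤f ∘ suc) 0≤g m n) ⟩
    f 0 * partial g (suc m ℕ.+ n) + triangle (f ∘ suc) g (m ℕ.+ n) ∎
    where
    open ≤-Reasoning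
    grow : ∀ k → partial g n ≤ partial g (k ℕ.+ n)
    grow zero    = ≤-refl
    grow (suc k) = ≤-trans (grow k) (subst (partial g (k ℕ.+ n) ≤_) (sym (partial-snoc g (k ℕ.+ n))) (≤-add (0≤g _)))

  -- The defect of the addition law is the corner n < i + j of the square i, j ≤ n. Termwise it is
  -- at most the corner for b, b, and since that square lies in the triangle i + j ≤ 2 n, it is at
  -- most a piece of the tail of the series at 2 b.
  defect-dominated : ∀ {b x y} → 0ℚ ≤ b → ∣ x ∣ ≤ b → ∣ y ∣ ≤ b → ∀ n →
    ∣ expSum x n * expSum y n - expSum (x + y) n ∣ ≤ expSum (b + b) (n ℕ.+ n) - expSum (b + b) n
  defect-dominated {b} {x} {y} 0≤b x≤b y≤b n = begin
    ∣ expSum x n * expSum y n - expSum (x + y) n ∣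
      ≡⟨ cong ∣_∣ (defect x y) ⟩
    ∣ corner (term x) (term y) n ∣
      ≤⟨ corner-dominated (∣term∣ 0≤b x≤b) (∣term∣ 0≤b y≤b) n ⟩
    corner (term b) (term b) n
      ≡⟨ sym (defect b b) ⟩
    expSum b n * expSum b n - expSum (b + b) n
      ≤⟨ +-monoˡ-≤ (- expSum (b + b) n) (subst₂ _≤_ (cong₂ _*_ (sym (expSum-partial b n)) (sym (expSum-partial b n)))
           (expSum-triangle b b (n ℕ.+ n)) (rectangle≤triangle (0≤term 0≤b) (0≤term 0≤b) n n)) ⟩
    expSum (b + b) (n ℕ.+ n) - expSum (b + b) n ∎
    where
    open ≤-Reasoning
    defect : ∀ x y → expSum x n * expSum y n - expSum (x + y) n ≡ corner (term x) (term y) n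
    defect x y = trans
      (cong₂ _-_ (trans (cong₂ _*_ (expSum-partial x n) (expSum-partial y n)) (square (term x) (term y) n)) (sym (expSum-triangle x y n)))
      (solve 2 (λ t c → t :+ c :- t := c) refl (triangle (term x) (term y) n) (corner (term x) (term y) n))

  -- Uniform in x and y, because in `expℝ` the argument moves together with the truncation index.
  expSum-+ : ∀ b → 0ℚ ≤ b → ∀ ε → 0ℚ < ε → Eventually λ n → ∀ x y → ∣ x ∣ ≤ b → ∣ y ∣ ≤ b →
             ∣ expSum x n * expSum y n - expSum (x + y) n ∣ ≤ ε
  expSum-+ b 0≤b ε 0<ε = N , λ n N≤n x y x≤b y≤b → ≤-trans (defect-dominated 0≤b x≤b y≤b n)
      (≤-trans (p≤∣p∣ _) (close (b + b) (≤-reflexive (0≤p⇒∣p∣≡p 0≤2b)) n (n ℕ.+ n) N≤n (ℕ.m≤m+n n n)))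
    where
    0≤2b = 0≤+ 0≤b 0≤b
    N = proj₁ (Tail.series (b + b) 0≤2b ε 0<ε)
    close = proj₂ (Tail.series (b + b) 0≤2b ε 0<ε)

  1+x≤expSum : ∀ {x} → 0ℚ ≤ x → ∀ n → 1ℚ + x ≤ expSum x (suc n)
  1+x≤expSum {x} 0≤x zero = ≤-reflexive (cong (1ℚ +_) (solve 1 (λ x → x := con 1ℚ :* x :* con 1ℚ) refl x))
  1+x≤expSum 0≤x (suc n)  = ≤-trans (1+x≤expSum 0≤x n) (≤-add (0≤term 0≤x (suc (suc n))))

  1≤expSum : ∀ {x} → 0ℚ ≤ x → ∀ n → 1ℚ ≤ expSum x n
  1≤expSum 0≤x zero    = ≤-refl
  1≤expSum 0≤x (suc n) = ≤-trans (≤-add 0≤x) (1+x≤expSum 0≤x n)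

  0≤square : ∀ x → 0ℚ ≤ x * x
  0≤square x with ≤-total 0ℚ x
  ... | inj₁ 0≤x = 0≤* 0≤x 0≤x
  ... | inj₂ x≤0 = subst (0ℚ ≤_) (solve 1 (λ x → :- x :* :- x := x :* x) refl x)
    (0≤* (neg-antimono-≤ x≤0) (neg-antimono-≤ x≤0))

  -- Up to a small error, the sum at x is the square of the sum at x/2.
  -ε≤expSum : ∀ b → 0ℚ ≤ b → ∀ ε → 0ℚ < ε → Eventually λ n → ∀ x → ∣ x ∣ ≤ b → 0ℚ ≤ expSum x n + ε
  -ε≤expSum b 0≤b ε 0<ε = N , λ n N≤n x x≤b →
    ≤-trans (0≤square (expSum (½ * x) n))
      (subst (λ z → expSum (½ * x) n * expSum (½ * x) n ≤ expSum z n + ε) (½+½ x)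
        (∣-∣≤⇒≤+ {expSum (½ * x) n * expSum (½ * x) n} (law n N≤n (½ * x) (½ * x) (halve x x≤b) (halve x x≤b))))
    where
    N = proj₁ (expSum-+ b 0≤b ε 0<ε)
    law = proj₂ (expSum-+ b 0≤b ε 0<ε)
    halve : ∀ x → ∣ x ∣ ≤ b → ∣ ½ * x ∣ ≤ b
    halve x x≤b = begin
      ∣ ½ * x ∣                     ≡⟨ ∣p*q∣≡∣p∣*∣q∣ ½ x ⟩
      ½ * ∣ x ∣                     ≤⟨ ≤-add (0≤* (nonNegative⁻¹ ½) (0≤∣p∣ x)) ⟩
      ½ * ∣ x ∣ + ½ * ∣ x ∣         ≡⟨ ½+½ ∣ x ∣ ⟩
      ∣ x ∣                         ≤⟨ x≤b ⟩
      b                             ∎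
      where open ≤-Reasoning

  -- Multiply the sum at x by the sum at y - x, which is at least 1, and use the addition law. If
  -- the truncated sum at x is negative, near-positivity of the sum at y settles the claim instead.
  expSum-mono : ∀ b → 0ℚ ≤ b → ∀ ε → 0ℚ < ε → Eventually λ n → ∀ x y → x ≤ y → ∣ x ∣ ≤ b → ∣ y ∣ ≤ b →
                expSum x n ≤ expSum y n + ε
  expSum-mono b 0≤b ε 0<ε = eventually-map step (both (expSum-+ (b + b) 0≤2b ε 0<ε) (-ε≤expSum b 0≤b ε 0<ε))
    where
    0≤2b = 0≤+ 0≤b 0≤b
    step : ∀ n → _ → ∀ x y → x ≤ y → ∣ x ∣ ≤ b → ∣ y ∣ ≤ b → expSum x n ≤ expSum y n + ε
    step n (law , nonneg) x y x≤y x≤b y≤b with ≤-total 0ℚ (expSum x n)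
    ... | inj₂ e≤0 = ≤-trans e≤0 (nonneg y y≤b)
    ... | inj₁ 0≤e = begin
      expSum x n                      ≡⟨ sym (*-identityʳ _) ⟩
      expSum x n * 1ℚ                 ≤⟨ *-monoˡ 0≤e (1≤expSum (CauchyLemmas.≤-sub x≤y) n) ⟩
      expSum x n * expSum (y - x) n   ≤⟨ ∣-∣≤⇒≤+ {expSum x n * expSum (y - x) n} (law x (y - x) (≤-trans x≤b (≤-add 0≤b))
                                           (≤-trans (∣p-q∣≤∣p∣+∣q∣ y x) (+-mono-≤ y≤b x≤b))) ⟩
      expSum (x + (y - x)) n + ε      ≡⟨ cong (λ z → expSum z n + ε) (solve 2 (λ x y → x :+ (y :- x) := y) refl x y) ⟩
      expSum y n + ε                  ∎
      where open ≤-Reasoning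

  -- The invariant is stronger than (1 - x) e^x ≤ 1, so that the induction goes through.
  expSum-upper : ∀ {x} → 0ℚ ≤ x → x ≤ 1ℚ → ∀ n → (1ℚ - x) * expSum x n + x * term x n ≤ 1ℚ
  expSum-upper {x} 0≤x x≤1 zero = ≤-reflexive (solve 1 (λ x → (con 1ℚ :- x) :* con 1ℚ :+ x :* con 1ℚ := con 1ℚ) refl x)
  expSum-upper {x} 0≤x x≤1 (suc n) = begin
    (1ℚ - x) * (e + t′) + x * t′        ≡⟨ solve 3 (λ x e t → (con 1ℚ :- x) :* (e :+ t) :+ x :* t := (con 1ℚ :- x) :* e :+ t) refl x e t′ ⟩
    (1ℚ - x) * e + t * x * u n          ≤⟨ +-monoʳ-≤ ((1ℚ - x) * e) (*-monoˡ (0≤* (0≤term 0≤x n) 0≤x) (u-anti {0} {n} ℕ.z≤n)) ⟩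
    (1ℚ - x) * e + t * x * 1ℚ           ≡⟨ cong ((1ℚ - x) * e +_) (solve 2 (λ t x → t :* x :* con 1ℚ := x :* t) refl t x) ⟩
    (1ℚ - x) * e + x * t                ≤⟨ expSum-upper 0≤x x≤1 n ⟩
    1ℚ                                  ∎
    where
    open ≤-Reasoning
    e = expSum x n
    t = term x n
    t′ = term x (suc n)

-- The exponential function on reals

module Exponential where

  open import Defs hiding (W; C)
  open RealArithmetic
  open ExponentialSums
  open import Data.Nat as ℕ using (ℕ; suc)
  import Data.Nat.Properties as ℕ
  open import Data.Rational
  open import Data.Rational.Properties
  open import Data.Rational.Solver
  open import Data.Product using (_,_; proj₁; proj₂)
  open import Relation.Binary.PropositionalEquality
  open +-*-Solver using (solve; _:+_; _:*_; _:-_; :-_; _:=_; con)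
  open ExpLemmas using (module Tail)

  -- Monotonicity is applied to f and g + δ, which are eventually ordered without tolerance; the
  -- Lipschitz bound then removes the shift δ.
  expSum-≼ : ∀ {f g} → Cauchy f → Cauchy g → f ≼ g → (λ n → expSum (f n) n) ≼ (λ n → expSum (g n) n)
  expSum-≼ {f} {g} cf cg f≼g ε 0<ε = eventually-map step
      (both (f≼g δ 0<δ) (expSum-mono b 0≤b (½ * ε) (half ε 0<ε)))
    where
    open ≤-Reasoning
    F = proj₁ (bounded {f} cf)
    G = proj₁ (bounded {g} cg)
    0≤F = proj₁ (proj₂ (bounded {f} cf))
    0≤G = proj₁ (proj₂ (bounded {g} cg))
    0≤½ε = <⇒≤ (half ε 0<ε)
    -- The shifted argument `g n + δ` must be covered as well, whence the summand ½ ε ≥ δ.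
    b = F + (G + ½ * ε)
    0≤b = 0≤+ 0≤F (0≤+ 0≤G 0≤½ε)
    open Tail b 0≤b using (M; 0≤M; lipschitz)
    -- The factor M + 1 makes M δ and δ at most ½ ε at the same time.
    sc = scale (M + 1ℚ) (0≤+ 0≤M (0≤ι 1)) (½ * ε) (half ε 0<ε)
    δ = proj₁ sc
    0<δ = proj₁ (proj₂ sc)
    Mδ+δ≤ : M * δ + δ ≤ ½ * ε
    Mδ+δ≤ = subst (_≤ ½ * ε) (solve 2 (λ m d → (m :+ con 1ℚ) :* d := m :* d :+ d) refl M δ) (proj₂ (proj₂ sc))
    Mδ≤ : M * δ ≤ ½ * ε
    Mδ≤ = ≤-trans (≤-add (<⇒≤ 0<δ)) Mδ+δ≤
    δ≤ : δ ≤ ½ * ε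
    δ≤ = ≤-trans (subst (δ ≤_) (+-comm δ (M * δ)) (≤-add (0≤* 0≤M (<⇒≤ 0<δ)))) Mδ+δ≤
    f≤b : ∀ n → ∣ f n ∣ ≤ b
    f≤b n = ≤-trans (proj₂ (proj₂ (bounded {f} cf)) n) (≤-add (0≤+ 0≤G 0≤½ε))
    g≤ : ∀ n → ∣ g n ∣ ≤ G
    g≤ n = proj₂ (proj₂ (bounded {g} cg)) n
    G+½ε≤b : G + ½ * ε ≤ b
    G+½ε≤b = subst (G + ½ * ε ≤_) (+-comm (G + ½ * ε) F) (≤-add 0≤F)
    g≤b : ∀ n → ∣ g n ∣ ≤ b
    g≤b n = ≤-trans (≤-trans (g≤ n) (≤-add 0≤½ε)) G+½ε≤b
    gδ≤b : ∀ n → ∣ g n + δ ∣ ≤ b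
    gδ≤b n = ≤-trans (∣p+q∣≤∣p∣+∣q∣ (g n) δ)
      (≤-trans (+-mono-≤ (g≤ n) (subst (_≤ ½ * ε) (sym (0≤p⇒∣p∣≡p (<⇒≤ 0<δ))) δ≤)) G+½ε≤b)
    step : ∀ n → _ → expSum (f n) n ≤ expSum (g n) n + ε
    step n (le , mono) = begin
      expSum (f n) n                          ≤⟨ mono (f n) (g n + δ) le (f≤b n) (gδ≤b n) ⟩
      expSum (g n + δ) n + ½ * ε              ≤⟨ +-monoˡ-≤ (½ * ε) (∣-∣≤⇒≤+ {expSum (g n + δ) n} (lipschitz (g n + δ) (g n) (gδ≤b n) (g≤b n) n)) ⟩
      expSum (g n) n + M * ∣ g n + δ - g n ∣ + ½ * ε
        ≡⟨ cong (λ z → expSum (g n) n + M * z + ½ * ε) (trans (cong ∣_∣ (solve 2 (λ g d → g :+ d :- g := d) refl (g n) δ)) (0≤p⇒∣p∣≡p (<⇒≤ 0<δ))) ⟩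
      expSum (g n) n + M * δ + ½ * ε          ≤⟨ +-monoˡ-≤ (½ * ε) (+-monoʳ-≤ (expSum (g n) n) Mδ≤) ⟩
      expSum (g n) n + ½ * ε + ½ * ε          ≡⟨ trans (+-assoc (expSum (g n) n) _ _) (cong (expSum (g n) n +_) (½+½ ε)) ⟩
      expSum (g n) n + ε                      ∎

  expSum-homomorphic : ∀ {f g} → Cauchy f → Cauchy g → ∀ ε → 0ℚ < ε →
    Eventually λ n → ∣ expSum (f n) n * expSum (g n) n - expSum (f n + g n) n ∣ ≤ ε
  expSum-homomorphic {f} {g} cf cg ε 0<ε =
    let F , 0≤F , f≤ = bounded {f} cf
        G , 0≤G , g≤ = bounded {g} cg
    in eventually-map
        (λ n law → law (f n) (g n) (≤-trans (f≤ n) (≤-add 0≤G)) (≤-trans (g≤ n) (subst (G ≤_) (+-comm G F) (≤-add 0≤F))))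
        (expSum-+ (F + G) (0≤+ 0≤F 0≤G) ε 0<ε)

  0≼expSum : ∀ {f} → Cauchy f → (λ _ → 0ℚ) ≼ (λ n → expSum (f n) n)
  0≼expSum {f} cf ε 0<ε =
    let F , 0≤F , f≤ = bounded {f} cf
    in eventually-map (λ n nonneg → nonneg (f n) (f≤ n)) (-ε≤expSum F 0≤F ε 0<ε)

  opaque

    EXP : ℝ → ℝ
    EXP = expℝ

  opaque
    unfolding EXP _⊞_

    EXP-def : ∀ x → EXP x ≡ expℝ x
    EXP-def x = refl

    EXP-mono : ∀ {x y} → x ⊑ y → EXP x ⊑ EXP y
    EXP-mono {x} {y} (⊑-intro p) = ⊑-intro (expSum-≼ {seq x} {seq y} (cauchy x) (cauchy y) p)

    EXP-⊞ : ∀ x y → EXP x ⊠ EXP y ≈ EXP (x ⊞ y)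
    EXP-⊞ x y =
      ⊑-intro (close⇒≼ {λ n → expSum (seq x n) n * expSum (seq y n) n} {λ n → expSum (seq x n + seq y n) n}
        (expSum-homomorphic {seq x} {seq y} (cauchy x) (cauchy y))) ,≈
      ⊑-intro (close⇒≽ {λ n → expSum (seq x n) n * expSum (seq y n) n} {λ n → expSum (seq x n + seq y n) n}
        (expSum-homomorphic {seq x} {seq y} (cauchy x) (cauchy y)))

    0⊑EXP : ∀ x → cst 0 ⊑ EXP x
    0⊑EXP x = ⊑-intro (0≼expSum {seq x} (cauchy x))

    1+⊑EXP : ∀ {q} → 0ℚ ≤ q → rat (1ℚ + q) ⊑ EXP (rat q)
    1+⊑EXP {q} 0≤q = ⊑-intro (eventually≤⇒≼ {λ _ → 1ℚ + q} {λ n → expSum q n} (1 , λ { (suc n) _ → 1+x≤expSum 0≤q n }))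

    EXP-upper : ∀ {q} → 0ℚ ≤ q → q ≤ 1ℚ → rat (1ℚ - q) ⊠ EXP (rat q) ⊑ cst 1
    EXP-upper {q} 0≤q q≤1 = ⊑-intro (≤⇒≼ {λ n → (1ℚ - q) * expSum q n} {λ _ → 1ℚ}
      (λ n → ≤-trans (≤-add (0≤* 0≤q (ExpLemmas.0≤term 0≤q n))) (expSum-upper 0≤q q≤1 n)))

  EXP-cong : ∀ {x y} → x ≈ y → EXP x ≈ EXP y
  EXP-cong (p ,≈ q) = EXP-mono p ,≈ EXP-mono q

  EXP-0 : EXP (cst 0) ≈ cst 1
  EXP-0 = ⊑-trans (≈⇒⊑ (≈-trans (EXP-cong (≈-sym (rat-ι 0))) (≈-trans (≈-sym (⊠-identityˡ _)) (⊠-congˡ (≈-sym (rat-ι 1))))))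
                  (EXP-upper ≤-refl (0≤ι 1)) ,≈
          ⊑-trans (≈⇒⊒ (rat-ι 1)) (⊑-trans (1+⊑EXP ≤-refl) (≈⇒⊑ (EXP-cong (rat-ι 0))))

  cst-⊠-cancelˡ : ∀ k {x y} → cst (suc k) ⊠ x ⊑ cst (suc k) ⊠ y → x ⊑ y
  cst-⊠-cancelˡ k {x} {y} h = ⊑-trans (≈⇒⊒ (unit x)) (⊑-trans (⊠-monoʳ (0⊑rat (0≤u k)) h) (≈⇒⊑ (unit y)))
    where
    unit : ∀ z → rat (u k) ⊠ (cst (suc k) ⊠ z) ≈ z
    unit z = ≈-trans (≈-sym (⊠-assoc _ _ z)) (≈-trans (⊠-congˡ (≈-trans (⊠-comm (rat (u k)) (cst (suc k))) (cst-⊠-rat k))) (⊠-identityˡ z))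

  rat⊠cst : ∀ q k p → ι k * q ≡ p → cst k ⊠ rat q ≈ rat p
  rat⊠cst q k p refl = ≈-trans (⊠-congˡ (≈-sym (rat-ι k))) (≈-sym (rat-* (ι k) q))

  -- With q = 1/(a + 1) this is e^q ≤ 1/(1 - q) = (a + 1)/a, cleared of the denominator so that a =
  -- 0 is allowed. It is one factor of a telescoping product for e^(log n).
  EXP-u-upper : ∀ a → cst a ⊠ EXP (rat (u a)) ⊑ cst (suc a)
  EXP-u-upper a = ⊑-trans (⊠-monoˡ (0⊑EXP _) (≈⇒⊑ (≈-trans (≈-sym (rat-ι a)) (≈-sym (rat⊠cst (1ℚ - u a) (suc a) (ι a) eq)))))
    (⊑-trans (≈⇒⊑ (⊠-assoc _ _ _)) (⊑-trans (⊠-monoʳ (0⊑cst (suc a)) (EXP-upper (0≤u a) (u-anti {0} {a} ℕ.z≤n)))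
      (≈⇒⊑ (≈-trans (⊠-comm _ _) (⊠-identityˡ _)))))
    where
    open ≡-Reasoning
    eq : ι (suc a) * (1ℚ - u a) ≡ ι a
    eq = begin
      ι (suc a) * (1ℚ - u a)        ≡⟨ solve 2 (λ n v → n :* (con 1ℚ :- v) := n :- v :* n) refl (ι (suc a)) (u a) ⟩
      ι (suc a) - u a * ι (suc a)   ≡⟨ cong₂ _-_ (ι-suc a) (uι a) ⟩
      1ℚ + ι a - 1ℚ                 ≡⟨ solve 1 (λ a → con 1ℚ :+ a :- con 1ℚ := a) refl (ι a) ⟩
      ι a                           ∎

  -- The companion factor, from 1 + q ≤ e^q with q = 1/(a + 1).
  EXP-u-lower : ∀ a → cst (suc (suc a)) ⊑ cst (suc a) ⊠ EXP (rat (u a))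
  EXP-u-lower a = ⊑-trans (≈⇒⊑ (≈-trans (≈-sym (rat-ι _)) (≈-sym (rat⊠cst (1ℚ + u a) (suc a) (ι (suc (suc a))) eq))))
                          (⊠-monoʳ (0⊑cst (suc a)) (1+⊑EXP (0≤u a)))
    where
    open ≡-Reasoning
    eq : ι (suc a) * (1ℚ + u a) ≡ ι (suc (suc a))
    eq = begin
      ι (suc a) * (1ℚ + u a)        ≡⟨ solve 2 (λ n v → n :* (con 1ℚ :+ v) := v :* n :+ n) refl (ι (suc a)) (u a) ⟩
      u a * ι (suc a) + ι (suc a)   ≡⟨ cong (_+ ι (suc a)) (uι a) ⟩
      1ℚ + ι (suc a)                ≡⟨ sym (ι-suc (suc a)) ⟩
      ι (suc (suc a))               ∎

-- Logarithms of integers, inverted by the exponential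

module Logarithm where

  open import Defs hiding (W; C)
  open RealArithmetic
  open Exponential
  open import Data.Nat as ℕ using (ℕ; zero; suc)
  import Data.Nat.Properties as ℕ
  open import Data.Rational
  open import Data.Rational.Properties
  open import Data.Rational.Solver
  open import Data.Product using (∃; _,_; proj₁; proj₂)
  open import Relation.Binary.PropositionalEquality
  import Algebra.Solver.Ring.NaturalCoefficients.Default ℝ-commutativeSemiring as ℝ-Solver
  open +-*-Solver using (solve; _:+_; _:*_; _:-_; :-_; _:=_; con)
  open LogLemmas using (module Log; H-lower; cancel)

  harmonic-mono : ∀ {m n} → m ℕ.≤′ n → harmonic m ≤ harmonic n
  harmonic-mono ℕ.≤′-refl                     = ≤-refl
  harmonic-mono {n = suc n} (ℕ.≤′-step m≤n) = ≤-trans (harmonic-mono m≤n) (≤-add (0≤u n))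

  opaque

    LOG : ℕ → ℝ
    LOG = log

  opaque
    unfolding LOG _⊞_

    LOG-def : ∀ n → LOG n ≡ log n
    LOG-def n = refl

    0⊑LOG : ∀ n → cst 0 ⊑ LOG n
    0⊑LOG zero    = ⊑-refl
    0⊑LOG (suc k) = ⊑-intro (≤⇒≼ {λ _ → 0ℚ} {λ i → logSum (suc k) (suc i)}
      (λ i → CauchyLemmas.≤-sub (harmonic-mono (ℕ.≤⇒≤′ (ℕ.m≤n*m (suc i) (suc k))))))

    LOG-mono-suc : ∀ {j k} → j ℕ.≤ k → LOG (suc j) ⊑ LOG (suc k)
    LOG-mono-suc {j} {k} j≤k = ⊑-intro (≤⇒≼ {λ i → logSum (suc j) (suc i)} {λ i → logSum (suc k) (suc i)}
      (λ i → +-monoˡ-≤ (- harmonic (suc i)) (harmonic-mono (ℕ.≤⇒≤′ (ℕ.*-monoˡ-≤ (suc i) (ℕ.s≤s j≤k))))))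

    -- harmonic telescopes: logSum (ab) m = logSum a (bm) + logSum b m.
    LOG-*-suc : ∀ a b → LOG (suc a ℕ.* suc b) ≈ LOG (suc a) ⊞ LOG (suc b)
    LOG-*-suc a b = ⊑-intro (close⇒≼ {f} {g} close) ,≈ ⊑-intro (close⇒≽ {f} {g} close)
      where
      f g : ℕ → ℚ
      f i = logSum (suc a ℕ.* suc b) (suc i)
      g i = logSum (suc a) (suc i) + logSum (suc b) (suc i)
      split : ∀ i → f i - g i ≡ logSum (suc a) (suc (i ℕ.+ b ℕ.* suc i)) - logSum (suc a) (suc i)
      split i = trans
        (cong (λ z → harmonic z - harmonic (suc i) - g i) (ℕ.*-assoc (suc a) (suc b) (suc i)))
        (solve 4 (λ x h y z → x :- h :- (z :+ (y :- h)) := x :- y :- z) refl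
          (harmonic (suc a ℕ.* (suc b ℕ.* suc i))) (harmonic (suc i)) (harmonic (suc b ℕ.* suc i)) (logSum (suc a) (suc i)))
      close : ∀ ε → 0ℚ < ε → Eventually λ i → ∣ f i - g i ∣ ≤ ε
      close ε 0<ε = proj₁ (Log.cauchy-log a ε 0<ε) , λ i N≤i → subst (_≤ ε) (cong ∣_∣ (sym (split i)))
        (proj₂ (Log.cauchy-log a ε 0<ε) (i ℕ.+ b ℕ.* suc i) i (ℕ.≤-trans N≤i (ℕ.m≤m+n i _)) N≤i)

    -- The Riemann sums increase with m, while the sums plus `u` decrease. Together with `LOG⊑rat`
    -- this encloses the logarithm between rationals at every mesh.
    rat⊑LOG : ∀ k m → rat (logSum (suc k) (suc m)) ⊑ LOG (suc k)
    rat⊑LOG k m = ⊑-intro (eventually≤⇒≼ {λ _ → logSum (suc k) (suc m)} {λ i → logSum (suc k) (suc i)}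
      (m , λ i m≤i → Log.ups k i (ℕ.≤⇒≤′ m≤i)))

    LOG⊑rat : ∀ k m → LOG (suc k) ⊑ rat (logSum (suc k) (suc m)) ⊞ rat (u m)
    LOG⊑rat k m = ⊑-intro (eventually≤⇒≼ {λ i → logSum (suc k) (suc i)} {λ _ → logSum (suc k) (suc m) + u m}
      (m , λ i m≤i → ≤-trans (≤-add (0≤u i)) (Log.downs k i (ℕ.≤⇒≤′ m≤i))))

    LOG-1 : LOG 1 ≈ cst 0
    LOG-1 = pointwise (LOG 1) (cst 0) (λ i →
      trans (cong (λ z → harmonic z - harmonic (suc i)) (ℕ.*-identityˡ (suc i))) (+-inverseʳ (harmonic (suc i))))

  LOG-mono : ∀ {m n} → 1 ℕ.≤ m → m ℕ.≤ n → LOG m ⊑ LOG n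
  LOG-mono (ℕ.s≤s ℕ.z≤n) (ℕ.s≤s m≤n) = LOG-mono-suc m≤n

  LOG-* : ∀ {a b} → 1 ℕ.≤ a → 1 ℕ.≤ b → LOG (a ℕ.* b) ≈ LOG a ⊞ LOG b
  LOG-* {suc a} {suc b} (ℕ.s≤s ℕ.z≤n) (ℕ.s≤s ℕ.z≤n) = LOG-*-suc a b

  ½⊑LOG : ∀ {n} → 2 ℕ.≤ n → rat ½ ⊑ LOG n
  ½⊑LOG {n} 2≤n = ⊑-trans (rat-mono ½≤) (⊑-trans (rat⊑LOG 1 0) (LOG-mono (ℕ.s≤s ℕ.z≤n) 2≤n))
    where
    ½≤ : ½ ≤ logSum 2 1
    ½≤ = ≤-refl

  -- EXP of the harmonic segment from a to a + j telescopes between the products of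
  -- (i + 2)/(i + 1) and of (i + 1)/i over a ≤ i < a + j.
  segment : ℕ → ℕ → ℚ
  segment a j = harmonic (j ℕ.+ a) - harmonic a

  EXP-segment-suc : ∀ a j → EXP (rat (segment a (suc j))) ≈ EXP (rat (segment a j)) ⊠ EXP (rat (u (j ℕ.+ a)))
  EXP-segment-suc a j = ≈-sym (≈-trans (EXP-⊞ _ _) (EXP-cong (≈-trans (≈-sym (rat-+ _ _))
    (subst (λ q → rat (segment a j + u (j ℕ.+ a)) ≈ rat q)
      (solve 3 (λ h v g → h :- g :+ v := h :+ v :- g) refl (harmonic (j ℕ.+ a)) (u (j ℕ.+ a)) (harmonic a)) ≈-refl))))

  EXP-segment-0 : ∀ a → EXP (rat (segment a 0)) ≈ cst 1
  EXP-segment-0 a = subst (λ q → EXP (rat q) ≈ cst 1) (sym (+-inverseʳ (harmonic a)))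
    (≈-trans (EXP-cong (rat-ι 0)) EXP-0)

  ⊠-identityʳ : ∀ x → x ⊠ cst 1 ≈ x
  ⊠-identityʳ x = ≈-trans (⊠-comm x (cst 1)) (⊠-identityˡ x)

  EXP-segment-upper : ∀ a j → cst a ⊠ EXP (rat (segment a j)) ⊑ cst (j ℕ.+ a)
  EXP-segment-upper a zero    = ≈⇒⊑ (≈-trans (⊠-congʳ (EXP-segment-0 a)) (⊠-identityʳ _))
  EXP-segment-upper a (suc j) =
    ⊑-trans (≈⇒⊑ (≈-trans (⊠-congʳ (EXP-segment-suc a j)) (≈-sym (⊠-assoc _ _ _))))
      (⊑-trans (⊠-monoˡ (0⊑EXP _) (EXP-segment-upper a j)) (EXP-u-upper (j ℕ.+ a)))

  EXP-segment-lower : ∀ a j → cst (suc (j ℕ.+ a)) ⊑ cst (suc a) ⊠ EXP (rat (segment a j))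
  EXP-segment-lower a zero    = ≈⇒⊒ (≈-trans (⊠-congʳ (EXP-segment-0 a)) (⊠-identityʳ _))
  EXP-segment-lower a (suc j) =
    ⊑-trans (EXP-u-lower (j ℕ.+ a)) (⊑-trans (⊠-monoˡ (0⊑EXP _) (EXP-segment-lower a j))
      (≈⇒⊒ (≈-trans (⊠-congʳ (EXP-segment-suc a j)) (≈-sym (⊠-assoc _ _ _)))))

  logSum-segment : ∀ k m → logSum (suc k) m ≡ segment m (k ℕ.* m)
  logSum-segment k m = cong (λ z → harmonic z - harmonic m) (ℕ.+-comm m (k ℕ.* m))

  open ℝ-Solver public using () renaming (solve to solveℝ; _:+_ to _⊕_; _:*_ to _⊗_; _:=_ to _≐_)

  reciprocal-bound : ∀ k ε → 0ℚ < ε → ∃ λ j → cst (suc k) ⊑ cst (suc j) ⊠ rat ε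
  reciprocal-bound k ε 0<ε = _ ,
    ⊑-trans (≈⇒⊒ (⊠-identityʳ _))
    (⊑-trans (⊠-monoʳ (0⊑cst (suc k)) (⊑-trans (≈⇒⊒ (rat-ι 1)) (⊑-trans (rat-mono (proj₂ (reciprocal ε 0<ε))) (≈⇒⊒ (rat⊠cst ε (suc N) _ refl)))))
    (≈⇒⊑ (≈-trans (≈-sym (⊠-assoc _ _ _)) (⊠-congˡ (≈-sym (cst-* (suc k) (suc N)))))))
    where
    N : ℕ
    N = proj₁ (reciprocal ε 0<ε)

  -- Let n = k + 1. At mesh 1/(m + 1) the telescoping product gives at most n, and the enclosure
  -- error `u m` costs a factor (m + 1)/m. The surplus n/m is at most ε for m = j + 1 as chosen.
  EXP-LOG⊑ : ∀ k → EXP (LOG (suc k)) ⊑ cst (suc k)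
  EXP-LOG⊑ k = ⊑-closure _ _ λ ε 0<ε → at ε (proj₁ (reciprocal-bound k ε 0<ε)) (proj₂ (reciprocal-bound k ε 0<ε))
    where
    at : ∀ ε j → cst (suc k) ⊑ cst (suc j) ⊠ rat ε → EXP (LOG (suc k)) ⊑ cst (suc k) ⊞ rat ε
    at ε j small =
      ⊑-trans (EXP-mono (LOG⊑rat k m))
      (⊑-trans (≈⇒⊒ (EXP-⊞ _ _))
      (⊑-trans (⊠-monoˡ (0⊑EXP _) (cst-⊠-cancelˡ m upper))
      (cst-⊠-cancelˡ j
        (⊑-trans (≈⇒⊑ (solveℝ 3 (λ m n v → m ⊗ (n ⊗ v) ≐ n ⊗ (m ⊗ v)) ≈-refl (cst m) (cst (suc k)) (EXP (rat (u m)))))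
        (⊑-trans (⊠-monoʳ (0⊑cst (suc k)) (EXP-u-upper m))
        (⊑-trans (≈⇒⊑ (≈-trans (⊠-congʳ (cst-suc m)) (solveℝ 3 (λ n o m → n ⊗ (o ⊕ m) ≐ m ⊗ n ⊕ n ⊗ o) ≈-refl (cst (suc k)) (cst 1) (cst m))))
        (⊑-trans (⊞-mono ⊑-refl (⊑-trans (≈⇒⊑ (⊠-identityʳ _)) small))
          (≈⇒⊒ (solveℝ 3 (λ m n e → m ⊗ (n ⊕ e) ≐ m ⊗ n ⊕ m ⊗ e) ≈-refl (cst m) (cst (suc k)) (rat ε))))))))))
      where
      m : ℕ
      m = suc j
      upper : cst (suc m) ⊠ EXP (rat (logSum (suc k) (suc m))) ⊑ cst (suc m) ⊠ cst (suc k)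
      upper = ⊑-trans
        (subst (λ z → cst (suc m) ⊠ EXP (rat z) ⊑ cst (k ℕ.* suc m ℕ.+ suc m)) (sym (logSum-segment k (suc m))) (EXP-segment-upper (suc m) (k ℕ.* suc m)))
        (⊑-trans (cst-mono (ℕ.≤-reflexive (trans (ℕ.+-comm (k ℕ.* suc m) (suc m)) (ℕ.*-comm (suc k) (suc m))))) (≈⇒⊑ (cst-* (suc m) (suc k))))

  -- With E the value of the exponential, the lower telescoping product loses a factor (j + 2)/(j +
  -- 1), that is, a summand E/(j + 1). A crude integer bound for E lets j be fixed beforehand so
  -- that this summand is at most ε.
  EXP-LOG⊒ : ∀ k → cst (suc k) ⊑ EXP (LOG (suc k))
  EXP-LOG⊒ k = ⊑-closure _ _ λ ε 0<ε → at ε (proj₁ (reciprocal-bound B ε 0<ε)) (proj₂ (reciprocal-bound B ε 0<ε))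
    where
    E : ℝ
    E = EXP (LOG (suc k))
    B : ℕ
    B = proj₁ (archimedean E)
    E⊑B : E ⊑ cst (suc B)
    E⊑B = ⊑-trans (proj₂ (archimedean E)) (cst-mono (ℕ.n≤1+n B))
    at : ∀ ε j → cst (suc B) ⊑ cst (suc j) ⊠ rat ε → cst (suc k) ⊑ E ⊞ rat ε
    at ε j small = cst-⊠-cancelˡ j
      (⊑-trans (≈⇒⊒ (cst-* (suc j) (suc k)))
      (⊑-trans lower
      (⊑-trans (⊠-monoʳ (0⊑cst (suc (suc j))) (EXP-mono (rat⊑LOG k j)))
      (⊑-trans (≈⇒⊑ (≈-trans (⊠-congˡ (cst-suc (suc j))) (solveℝ 3 (λ o m e → (o ⊕ m) ⊗ e ≐ m ⊗ e ⊕ o ⊗ e) ≈-refl (cst 1) (cst (suc j)) E)))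
      (⊑-trans (⊞-mono ⊑-refl (⊑-trans (≈⇒⊑ (⊠-identityˡ _)) (⊑-trans E⊑B small)))
        (≈⇒⊒ (solveℝ 3 (λ m n e → m ⊗ (n ⊕ e) ≐ m ⊗ n ⊕ m ⊗ e) ≈-refl (cst (suc j)) E (rat ε))))))))
      where
      lower : cst (suc j ℕ.* suc k) ⊑ cst (suc (suc j)) ⊠ EXP (rat (logSum (suc k) (suc j)))
      lower = ⊑-trans
        (cst-mono (ℕ.≤-trans (ℕ.≤-reflexive (trans (ℕ.*-comm (suc j) (suc k)) (ℕ.+-comm (suc j) (k ℕ.* suc j)))) (ℕ.n≤1+n _)))
        (subst (λ z → cst (suc (k ℕ.* suc j ℕ.+ suc j)) ⊑ cst (suc (suc j)) ⊠ EXP (rat z)) (sym (logSum-segment k (suc j))) (EXP-segment-lower (suc j) (k ℕ.* suc j)))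

  EXP-LOG : ∀ {n} → 1 ℕ.≤ n → EXP (LOG n) ≈ cst n
  EXP-LOG {suc k} (ℕ.s≤s ℕ.z≤n) = EXP-LOG⊑ k ,≈ EXP-LOG⊒ k

  LOG-^ : ∀ {a} → 1 ℕ.≤ a → ∀ k → LOG (a ℕ.^ k) ≈ cst k ⊠ LOG a
  LOG-^ {a} 1≤a zero    = ≈-trans LOG-1 (≈-sym (⊠-zeroˡ (LOG a)))
  LOG-^ {a} 1≤a (suc k) = ≈-trans (LOG-* 1≤a (ℕ.m^n>0 a {{ℕ.>-nonZero 1≤a}} k))
    (≈-trans (⊞-cong (≈-sym (⊠-identityˡ _)) (LOG-^ 1≤a k))
    (≈-trans (≈-sym (⊠-distribʳ-⊞ (LOG a) (cst 1) (cst k))) (⊠-congˡ (≈-sym (cst-suc k)))))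

-- Estimates for log n / P^(1/r)

module Rates where

  open import Defs hiding (W; C)
  open RealArithmetic
  open Exponential
  open Logarithm
  open import Data.Nat as ℕ using (ℕ; zero; suc)
  import Data.Nat.Properties as ℕ
  open import Data.Rational using (-_)
  import Data.Rational.Properties as ℚ
  open import Data.Empty using (⊥; ⊥-elim)
  open import Data.Product using (_,_; proj₁; proj₂)
  open import Relation.Binary.PropositionalEquality
  open import Relation.Nullary using (yes; no)

  POW : ℝ → ℕ → ℝ
  POW x zero    = cst 1
  POW x (suc k) = x ⊠ POW x k

  POW-def : ∀ x k → POW x k ≡ x ^ℕ k
  POW-def x zero    = cst-def 1
  POW-def x (suc k) = trans (cong (x ⊠_) (POW-def x k)) (⊠-def x (x ^ℕ k))

  0⊑POW : ∀ {x} → cst 0 ⊑ x → ∀ k → cst 0 ⊑ POW x k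
  0⊑POW 0⊑x zero    = 0⊑cst 1
  0⊑POW 0⊑x (suc k) = 0⊑⊠ 0⊑x (0⊑POW 0⊑x k)

  ⊠-mono : ∀ {x x′ y y′} → cst 0 ⊑ x′ → cst 0 ⊑ y → x ⊑ x′ → y ⊑ y′ → x ⊠ y ⊑ x′ ⊠ y′
  ⊠-mono 0⊑x′ 0⊑y p q = ⊑-trans (⊠-monoˡ 0⊑y p) (⊠-monoʳ 0⊑x′ q)

  POW-mono : ∀ {x y} → cst 0 ⊑ x → x ⊑ y → ∀ k → POW x k ⊑ POW y k
  POW-mono 0⊑x x⊑y zero    = ⊑-refl
  POW-mono 0⊑x x⊑y (suc k) = ⊠-mono (⊑-trans 0⊑x x⊑y) (0⊑POW 0⊑x k) x⊑y (POW-mono 0⊑x x⊑y k)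

  POW-cst : ∀ m k → POW (cst m) k ≈ cst (m ℕ.^ k)
  POW-cst m zero    = ≈-refl
  POW-cst m (suc k) = ≈-trans (⊠-congʳ (POW-cst m k)) (≈-sym (cst-* m (m ℕ.^ k)))

  POW-⊠ : ∀ x y k → POW (x ⊠ y) k ≈ POW x k ⊠ POW y k
  POW-⊠ x y zero    = ≈-sym (⊠-identityˡ (cst 1))
  POW-⊠ x y (suc k) = ≈-trans (⊠-congʳ (POW-⊠ x y k))
    (solveℝ 4 (λ x y p q → x ⊗ y ⊗ (p ⊗ q) ≐ x ⊗ p ⊗ (y ⊗ q)) ≈-refl x y (POW x k) (POW y k))

  -- Below r = s + 1, so that u s = 1/r;  decay s P is P^{-1/r}.
  root decay : ℕ → ℕ → ℝ
  root  s P = EXP (rat (u s) ⊠ LOG P)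
  decay s P = EXP (rat (- u s) ⊠ LOG P)

  RATE : ℕ → ℕ → ℕ → ℝ
  RATE s P n = LOG n ⊠ decay s P

  root⊠decay : ∀ s P → root s P ⊠ decay s P ≈ cst 1
  root⊠decay s P = ≈-trans (EXP-⊞ _ _) (≈-trans (EXP-cong (≈-trans (≈-sym (⊠-distribʳ-⊞ (LOG P) _ _))
    (≈-trans (⊠-congˡ (≈-trans (≈-sym (rat-+ (u s) (- u s))) (subst (λ q → rat q ≈ cst 0) (sym (ℚ.+-inverseʳ (u s))) (rat-ι 0)))) (⊠-zeroˡ (LOG P))))) EXP-0)

  u⊠LOG-^ : ∀ {a} → 1 ℕ.≤ a → ∀ s → rat (u s) ⊠ LOG (a ℕ.^ suc s) ≈ LOG a
  u⊠LOG-^ {a} 1≤a s = ≈-trans (⊠-congʳ (LOG-^ 1≤a (suc s))) (≈-trans (≈-sym (⊠-assoc _ _ _))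
    (≈-trans (⊠-congˡ (≈-trans (⊠-comm _ _) (cst-⊠-rat s))) (⊠-identityˡ (LOG a))))

  root-lower : ∀ s {m P} → 1 ℕ.≤ m → m ℕ.^ suc s ℕ.≤ P → cst m ⊑ root s P
  root-lower s {m} 1≤m le = ⊑-trans (≈⇒⊒ (EXP-LOG 1≤m)) (EXP-mono (⊑-trans (≈⇒⊒ (u⊠LOG-^ 1≤m s))
    (⊠-monoʳ (0⊑rat (0≤u s)) (LOG-mono (ℕ.m^n>0 m {{ℕ.>-nonZero 1≤m}} (suc s)) le))))

  root-upper : ∀ s {k P} → 1 ℕ.≤ k → 1 ℕ.≤ P → P ℕ.≤ k ℕ.^ suc s → root s P ⊑ cst k
  root-upper s 1≤k 1≤P le = ⊑-trans (EXP-mono (⊑-trans (⊠-monoʳ (0⊑rat (0≤u s)) (LOG-mono 1≤P le))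
    (≈⇒⊑ (u⊠LOG-^ 1≤k s)))) (≈⇒⊑ (EXP-LOG 1≤k))

  decay-upper : ∀ s {m P} → 1 ℕ.≤ m → m ℕ.^ suc s ℕ.≤ P → cst m ⊠ decay s P ⊑ cst 1
  decay-upper s {P = P} 1≤m le = ⊑-trans (⊠-monoˡ (0⊑EXP _) (root-lower s 1≤m le)) (≈⇒⊑ (root⊠decay s P))

  decay-lower : ∀ s {k P} → 1 ℕ.≤ k → 1 ℕ.≤ P → P ℕ.≤ k ℕ.^ suc s → cst 1 ⊑ cst k ⊠ decay s P
  decay-lower s {P = P} 1≤k 1≤P le = ⊑-trans (≈⇒⊒ (root⊠decay s P)) (⊠-monoˡ (0⊑EXP _) (root-upper s 1≤k 1≤P le))

  -- Here log n ≤ N m log a, and the factor m is cancelled by P^(-1/r) ≤ 1/m.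
  RATE-upper : ∀ s N {m P n a} → 1 ℕ.≤ m → 1 ℕ.≤ a → 1 ℕ.≤ n → n ℕ.≤ a ℕ.^ (N ℕ.* m) → m ℕ.^ suc s ℕ.≤ P →
               RATE s P n ⊑ cst N ⊠ LOG a
  RATE-upper s N {m} {P} {n} {a} 1≤m 1≤a 1≤n n≤ le =
    ⊑-trans (⊠-monoˡ (0⊑EXP _) (⊑-trans (LOG-mono 1≤n n≤) (≈⇒⊑ (≈-trans (LOG-^ 1≤a (N ℕ.* m)) (⊠-congˡ (cst-* N m))))))
    (⊑-trans (≈⇒⊑ (solveℝ 4 (λ n m l d → n ⊗ m ⊗ l ⊗ d ≐ n ⊗ l ⊗ (m ⊗ d)) ≈-refl (cst N) (cst m) (LOG a) (decay s P)))
    (⊑-trans (⊠-monoʳ (0⊑⊠ (0⊑cst N) (0⊑LOG a)) (decay-upper s 1≤m le)) (≈⇒⊑ (⊠-identityʳ _))))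

  -- The origin of the constant in the lower bound: the coefficient is 1/(2 N), where N bounds the
  -- rate by N log a and the 2 pays for replacing a by the number b of exchanges per key, with a ≤
  -- b².
  EXP-RATE-upper : ∀ s N j {m P n a b} → suc j ≡ N ℕ.* 2 → 1 ℕ.≤ m → 1 ℕ.≤ a → 1 ℕ.≤ n → 1 ℕ.≤ b → a ℕ.≤ b ℕ.^ 2 →
                   n ℕ.≤ a ℕ.^ (N ℕ.* m) → m ℕ.^ suc s ℕ.≤ P →
                   EXP (rat (u j) ⊠ RATE s P n) ⊑ cst b
  EXP-RATE-upper s N j {a = a} {b} eq 1≤m 1≤a 1≤n 1≤b a≤b² n≤ le = ⊑-trans (EXP-mono
    (⊑-trans (⊠-monoʳ (0⊑rat (0≤u j)) (RATE-upper s N 1≤m 1≤a 1≤n n≤ le))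
    (⊑-trans (⊠-monoʳ (0⊑rat (0≤u j)) (⊠-monoʳ (0⊑cst N) (⊑-trans (LOG-mono 1≤a a≤b²) (≈⇒⊑ (LOG-^ 1≤b 2)))))
    (≈⇒⊑ (≈-trans (solveℝ 4 (λ u n t l → u ⊗ (n ⊗ (t ⊗ l)) ≐ n ⊗ t ⊗ u ⊗ l) ≈-refl (rat (u j)) (cst N) (cst 2) (LOG b))
      (≈-trans (⊠-congˡ (≈-trans (⊠-congˡ (≈-trans (≈-sym (cst-* N 2)) (subst (λ z → cst z ≈ cst (suc j)) eq ≈-refl))) (cst-⊠-rat j)))
        (⊠-identityˡ (LOG b))))))))
    (≈⇒⊑ (EXP-LOG 1≤b))

  -- The constant 10 is 5 · 2: the fifth power of y is the cost per key and pass, and P^(1/r) ≤ 2 k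
  -- replaces k by the root of P.
  power⊑EXP-RATE : ∀ s {k P n y} → 1 ℕ.≤ k → 1 ℕ.≤ P → 1 ℕ.≤ y → y ℕ.^ k ℕ.≤ n → P ℕ.≤ (2 ℕ.* k) ℕ.^ suc s →
                   cst (y ℕ.^ 5) ⊑ EXP (cst 10 ⊠ RATE s P n)
  power⊑EXP-RATE s {k} {P} {n} {y} 1≤k 1≤P 1≤y le P≤ =
    ⊑-trans (≈⇒⊒ (EXP-LOG (ℕ.m^n>0 y {{ℕ.>-nonZero 1≤y}} 5))) (EXP-mono
    (⊑-trans (≈⇒⊑ (≈-trans (LOG-^ 1≤y 5) (≈-sym (⊠-identityʳ _))))
    (⊑-trans (⊠-monoʳ (0⊑⊠ (0⊑cst 5) (0⊑LOG y)) (decay-lower s (ℕ.≤-trans 1≤k (ℕ.m≤n*m k 2)) 1≤P P≤))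
    (⊑-trans (≈⇒⊑ (≈-trans (⊠-congʳ (⊠-congˡ (cst-* 2 k)))
      (≈-trans (solveℝ 5 (λ f l t k d → f ⊗ l ⊗ (t ⊗ k ⊗ d) ≐ f ⊗ t ⊗ (k ⊗ l ⊗ d)) ≈-refl (cst 5) (LOG y) (cst 2) (cst k) (decay s P))
        (⊠-congˡ (≈-sym (cst-* 5 2))))))
    (⊠-monoʳ (0⊑cst 10) (⊠-monoˡ (0⊑EXP _) (⊑-trans (≈⇒⊒ (LOG-^ 1≤y k)) (LOG-mono (ℕ.m^n>0 y {{ℕ.>-nonZero 1≤y}} k) le))))))))

  absorb-P : ∀ s {P n} → 1 ℕ.≤ P → LOG P ⊑ RATE s P n → cst P ⊠ EXP (cst 10 ⊠ RATE s P n) ⊑ EXP (cst 11 ⊠ RATE s P n)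
  absorb-P s {P} {n} 1≤P h = ⊑-trans (⊠-monoˡ (0⊑EXP _) (⊑-trans (≈⇒⊒ (EXP-LOG 1≤P)) (EXP-mono h)))
    (≈⇒⊑ (≈-trans (EXP-⊞ _ _) (EXP-cong (≈-trans (⊞-cong (≈-sym (⊠-identityˡ _)) ≈-refl)
      (≈-trans (≈-sym (⊠-distribʳ-⊞ (RATE s P n) (cst 1) (cst 10))) (⊠-congˡ (≈-sym (cst-suc 10))))))))

  -- Let B ≥ log (M + 1). If n ≤ (M + 1)^k, then log n ≤ B k, so (log n)^r ≤ B^r k^r ≤ B^r P. Using
  -- the hypothesis with ε = 1/(2 B^r) gives (log n)^r ≤ ½ (log n)^r, hence (log n)^r ≤ 0, against
  -- log n ≥ ½.
  small-powers : ∀ {P : ℕ → ℕ} r → (∀ j → Eventually λ n → cst (P n) ⊑ rat (u j) ⊠ POW (LOG n) r) →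
                 ∀ M → Eventually λ n → ∀ k → k ℕ.^ r ℕ.≤ P n → suc M ℕ.^ k ℕ.< n
  small-powers {P} r o M = eventually-map conclude (both (2 , λ n 2≤n → 2≤n) (o j))
    where
    B : ℕ
    B = suc (proj₁ (archimedean (LOG (suc M))))
    LOG⊑B : LOG (suc M) ⊑ cst B
    LOG⊑B = ⊑-trans (proj₂ (archimedean (LOG (suc M)))) (cst-mono (ℕ.n≤1+n _))
    j : ℕ
    j = ℕ.pred (2 ℕ.* B ℕ.^ r)
    1+j : suc j ≡ 2 ℕ.* B ℕ.^ r
    1+j = ℕ.suc-pred (2 ℕ.* B ℕ.^ r) {{ℕ.m*n≢0 2 (B ℕ.^ r) {{_}} {{ℕ.m^n≢0 B r}}}}
    1≰0 : cst 1 ⊑ cst 0 → ⊥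
    1≰0 h with cst-reflect h
    ... | ()
    absurd : ∀ n k → 2 ℕ.≤ n → cst (P n) ⊑ rat (u j) ⊠ POW (LOG n) r → k ℕ.^ r ℕ.≤ P n → n ℕ.≤ suc M ℕ.^ k → ⊥
    absurd n k 2≤n le k≤ n≤ = 1≰0 (⊑-trans 1⊑ (⊑-trans (⊠-monoʳ (0⊑cst (2 ℕ.^ r)) x⊑0) (≈⇒⊑ (≈-trans (⊠-comm _ _) (⊠-zeroˡ _)))))
      where
      x : ℝ
      x = POW (LOG n) r
      LOGn⊑ : LOG n ⊑ cst k ⊠ cst B
      LOGn⊑ = ⊑-trans (LOG-mono (ℕ.≤-trans (ℕ.s≤s ℕ.z≤n) 2≤n) n≤) (⊑-trans (≈⇒⊑ (LOG-^ (ℕ.s≤s ℕ.z≤n) k)) (⊠-monoʳ (0⊑cst k) LOG⊑B))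
      x⊑ : x ⊑ cst (B ℕ.^ r) ⊠ (rat (u j) ⊠ x)
      x⊑ = ⊑-trans (POW-mono (0⊑LOG n) LOGn⊑ r) (⊑-trans (≈⇒⊑ (≈-trans (POW-⊠ (cst k) (cst B) r)
        (≈-trans (⊠-cong (POW-cst k r) (POW-cst B r)) (⊠-comm _ _))))
        (⊠-monoʳ (0⊑cst (B ℕ.^ r)) (⊑-trans (cst-mono k≤) le)))
      2x⊑x : cst 2 ⊠ x ⊑ x
      2x⊑x = ⊑-trans (⊠-monoʳ (0⊑cst 2) x⊑) (≈⇒⊑
        (≈-trans (solveℝ 4 (λ t b u x → t ⊗ (b ⊗ (u ⊗ x)) ≐ t ⊗ b ⊗ u ⊗ x) ≈-refl (cst 2) (cst (B ℕ.^ r)) (rat (u j)) x)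
        (≈-trans (⊠-congˡ (≈-trans (⊠-congˡ (≈-trans (≈-sym (cst-* 2 (B ℕ.^ r))) (subst (λ z → cst z ≈ cst (suc j)) 1+j ≈-refl))) (cst-⊠-rat j)))
          (⊠-identityˡ x))))
      x⊑0 : x ⊑ cst 0
      x⊑0 = ⊞-cancelˡ x (⊑-trans
        (≈⇒⊒ (≈-trans (⊠-congˡ (cst-suc 1)) (≈-trans (⊠-distribʳ-⊞ x (cst 1) (cst 1)) (⊞-cong (⊠-identityˡ x) (⊠-identityˡ x)))))
        (⊑-trans 2x⊑x (≈⇒⊒ (≈-trans (⊞-comm x (cst 0)) (⊞-identityˡ x)))))
      1⊑2LOG : cst 1 ⊑ cst 2 ⊠ LOG n
      1⊑2LOG = ⊑-trans (≈⇒⊒ (cst-⊠-rat 1)) (⊠-monoʳ (0⊑cst 2) (½⊑LOG 2≤n))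
      1⊑ : cst 1 ⊑ cst (2 ℕ.^ r) ⊠ x
      1⊑ = ⊑-trans (subst (λ z → cst z ⊑ POW (cst 1) r) (ℕ.^-zeroˡ r) (≈⇒⊒ (POW-cst 1 r)))
        (⊑-trans (POW-mono (0⊑cst 1) 1⊑2LOG r) (≈⇒⊑ (≈-trans (POW-⊠ (cst 2) (LOG n) r) (⊠-congˡ (POW-cst 2 r)))))
    conclude : ∀ n → _ → ∀ k → k ℕ.^ r ℕ.≤ P n → suc M ℕ.^ k ℕ.< n
    conclude n (2≤n , le) k k≤ with suc M ℕ.^ k ℕ.<? n
    ... | yes lt = lt
    ... | no ≮n  = ⊥-elim (absurd n k 2≤n le k≤ (ℕ.≮⇒≥ ≮n))

  -- The integer inequality says b ≤ a^((N + 2)/(N + 1)), and the exponent is at most K.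
  ≤^⇒ratio : ∀ {K} N {a b} → 1 ℕ.≤ a → 1 ℕ.≤ b → cst (suc (suc N)) ⊑ cst (suc N) ⊠ K →
             b ℕ.^ suc N ℕ.≤ a ℕ.^ suc (suc N) → cst b ⊑ EXP (K ⊠ LOG a)
  ≤^⇒ratio {K} N {a} {b} 1≤a 1≤b hK le = ⊑-trans (≈⇒⊒ (EXP-LOG 1≤b)) (EXP-mono (cst-⊠-cancelˡ N
    (⊑-trans (≈⇒⊒ (LOG-^ 1≤b (suc N)))
    (⊑-trans (LOG-mono (ℕ.m^n>0 b {{ℕ.>-nonZero 1≤b}} (suc N)) le)
    (⊑-trans (≈⇒⊑ (LOG-^ 1≤a (suc (suc N))))
    (⊑-trans (⊠-monoˡ (0⊑LOG a) hK) (≈⇒⊑ (⊠-assoc _ _ _))))))))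

  ratio⇒≤^ : ∀ {K} N {a b} → 1 ℕ.≤ a → K ⊑ cst N → cst b ⊑ EXP (K ⊠ LOG a) → b ℕ.≤ a ℕ.^ N
  ratio⇒≤^ N {a} 1≤a K⊑N h = cst-reflect (⊑-trans h (⊑-trans (EXP-mono (⊑-trans (⊠-monoˡ (0⊑LOG a) K⊑N) (≈⇒⊒ (LOG-^ 1≤a N))))
    (≈⇒⊑ (EXP-LOG (ℕ.m^n>0 a {{ℕ.>-nonZero 1≤a}} N)))))

-- A single insertion, described by counting keys

module Sifting where

  open import Defs hiding (W; C)
  open import Data.Bool using (true; false; if_then_else_; T)
  open import Data.Nat
  open import Data.Nat.Properties
  open import Data.Empty using (⊥-elim)
  open import Data.Sum using (inj₁; inj₂)
  open import Function using (_∘_)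
  open import Relation.Binary.PropositionalEquality
  open import Relation.Nullary using (yes; no)

  at-most : ℕ → ℕ → ℕ
  at-most v x = if x ≤ᵇ v then 1 else 0

  -- Threshold counts represent the multiset of the first m keys: rearranging these keys leaves them
  -- unchanged, and for a sorted prefix they determine which positions hold keys ≤ v.
  count : (ℕ → ℕ) → ℕ → ℕ → ℕ
  count X v zero    = 0
  count X v (suc m) = at-most v (X m) + count X v m

  at-most-yes : ∀ {v x} → x ≤ v → at-most v x ≡ 1
  at-most-yes {v} {x} x≤v with x ≤ᵇ v in eq
  ... | true  = refl
  ... | false = ⊥-elim (subst T eq (≤⇒≤ᵇ x≤v))

  at-most-no : ∀ {v x} → v < x → at-most v x ≡ 0
  at-most-no {v} {x} v<x with x ≤ᵇ v in eq
  ... | true  = ⊥-elim (<⇒≱ v<x (≤ᵇ⇒≤ x v (subst T (sym eq) _)))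
  ... | false = refl

  at-most≤1 : ∀ v x → at-most v x ≤ 1
  at-most≤1 v x with x ≤ᵇ v
  ... | true  = ≤-refl
  ... | false = z≤n

  at-most-anti : ∀ v {x y} → x ≤ y → at-most v y ≤ at-most v x
  at-most-anti v {x} {y} x≤y with y ≤? v
  ... | yes y≤v = ≤-reflexive (trans (at-most-yes y≤v) (sym (at-most-yes (≤-trans x≤y y≤v))))
  ... | no  y≰v = subst (_≤ at-most v x) (sym (at-most-no (≰⇒> y≰v))) z≤n

  count-cong : ∀ {X Y} v m → (∀ l → l < m → X l ≡ Y l) → count X v m ≡ count Y v m
  count-cong v zero    h = refl
  count-cong v (suc m) h = cong₂ _+_ (cong (at-most v) (h m ≤-refl)) (count-cong v m (λ l l<m → h l (m≤n⇒m≤1+n l<m)))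

  count≤ : ∀ X v m → count X v m ≤ m
  count≤ X v zero    = z≤n
  count≤ X v (suc m) = +-mono-≤ (at-most≤1 v (X m)) (count≤ X v m)

  count-mono : ∀ X v {m n} → m ≤ n → count X v m ≤ count X v n
  count-mono X v m≤n = go (≤⇒≤′ m≤n)
    where
    go : ∀ {m n} → m ≤′ n → count X v m ≤ count X v n
    go ≤′-refl       = ≤-refl
    go (≤′-step m≤n) = ≤-trans (go m≤n) (m≤n+m _ _)

  count-full : ∀ X v m → (∀ l → l < m → X l ≤ v) → count X v m ≡ m
  count-full X v zero    h = refl
  count-full X v (suc m) h = cong₂ _+_ (at-most-yes (h m ≤-refl)) (count-full X v m (λ l l<m → h l (m≤n⇒m≤1+n l<m)))

  count-full⁻ : ∀ X v m → m ≤ count X v m → ∀ l → l < m → X l ≤ v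
  count-full⁻ X v (suc m) full l l≤m with X m ≤? v
  ... | no  ≰v = ⊥-elim (<⇒≱ (s≤s (count≤ X v m)) (subst (λ z → suc m ≤ z + count X v m) (at-most-no (≰⇒> ≰v)) full))
  ... | yes ≤v with m≤n⇒m<n∨m≡n (≤-pred l≤m)
  ...   | inj₂ refl = ≤v
  ...   | inj₁ l<m  = count-full⁻ X v m (≤-pred (subst (λ z → suc m ≤ z + count X v m) (at-most-yes ≤v) full)) l l<m

  count-above : ∀ X v k m → (∀ l → k ≤ l → l < m → v < X l) → count X v m ≤ k
  count-above X v k zero    h = z≤n
  count-above X v k (suc m) h with k ≤? m
  ... | yes k≤m = subst (λ z → z + count X v m ≤ k) (sym (at-most-no (h m k≤m ≤-refl)))
                    (count-above X v k m (λ l k≤l l<m → h l k≤l (m≤n⇒m≤1+n l<m)))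
  ... | no  k≰m = ≤-trans (count≤ X v (suc m)) (≰⇒> k≰m)

  SortedTo : (ℕ → ℕ) → ℕ → Set
  SortedTo X m = ∀ l → suc l < m → X l ≤ X (suc l)

  sorted-≤ : ∀ {X m} → SortedTo X m → ∀ {i j} → i ≤ j → j < m → X i ≤ X j
  sorted-≤ {X} {m} s i≤j = go (≤⇒≤′ i≤j)
    where
    go : ∀ {i j} → i ≤′ j → j < m → X i ≤ X j
    go ≤′-refl       _   = ≤-refl
    go (≤′-step i≤j) j<m = ≤-trans (go i≤j (<-trans (n<1+n _) j<m)) (s _ j<m)

  -- Together with its converse this makes "the key at position l is ≤ v" the same as "more than l
  -- keys are ≤ v". All later comparisons of keys after sorting go through this translation.
  sorted-count : ∀ {X m v} → SortedTo X m → ∀ {l} → l < m → X l ≤ v → l < count X v m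
  sorted-count {X} {m} {v} s {l} l<m Xl≤v = ≤-trans
    (≤-reflexive (sym (count-full X v (suc l) (λ i i≤l → ≤-trans (sorted-≤ {X} s (≤-pred i≤l) l<m) Xl≤v))))
    (count-mono X v l<m)

  sorted-count⁻ : ∀ {X m v} → SortedTo X m → ∀ {l} → l < count X v m → X l ≤ v
  sorted-count⁻ {X} {m} {v} s {l} lt with X l ≤? v
  ... | yes p = p
  ... | no ≰v = ⊥-elim (<⇒≱ lt (count-above X v l m (λ i l≤i i<m → <-≤-trans (≰⇒> ≰v) (sorted-≤ {X} s l≤i i<m))))

  swap-left : ∀ i j (key : ℕ → ℕ) → swap i j key i ≡ key j
  swap-left i j key with i ≡ᵇ i in eq
  ... | true  = refl
  ... | false = ⊥-elim (subst T eq (≡⇒≡ᵇ i i refl))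

  swap-right : ∀ {i j} (key : ℕ → ℕ) → i ≢ j → swap i j key j ≡ key i
  swap-right {i} {j} key i≢j with j ≡ᵇ i in eq
  ... | true  = ⊥-elim (i≢j (sym (≡ᵇ⇒≡ j i (subst T (sym eq) _))))
  ... | false with j ≡ᵇ j in eq′
  ...   | true  = refl
  ...   | false = ⊥-elim (subst T eq′ (≡⇒≡ᵇ j j refl))

  swap-other : ∀ {i j p} (key : ℕ → ℕ) → p ≢ i → p ≢ j → swap i j key p ≡ key p
  swap-other {i} {j} {p} key p≢i p≢j with p ≡ᵇ i in eq
  ... | true  = ⊥-elim (p≢i (≡ᵇ⇒≡ p i (subst T (sym eq) _)))
  ... | false with p ≡ᵇ j in eq′
  ...   | true  = ⊥-elim (p≢j (≡ᵇ⇒≡ p j (subst T (sym eq′) _)))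
  ...   | false = refl

  count-exchange : ∀ {X Y} k v → Y k ≡ X (suc k) → Y (suc k) ≡ X k → (∀ l → l ≢ k → l ≢ suc k → Y l ≡ X l) →
                   ∀ M → suc k < M → count Y v M ≡ count X v M
  count-exchange {X} {Y} k v e₀ e₁ e (suc M) (s≤s k<M) with m≤n⇒m<n∨m≡n k<M
  ... | inj₁ lt = cong₂ _+_ (cong (at-most v) (e M (>⇒≢ k<M) (>⇒≢ lt))) (count-exchange {X} {Y} k v e₀ e₁ e M lt)
  ... | inj₂ refl = begin
      at-most v (Y (suc k)) + (at-most v (Y k) + count Y v k)
        ≡⟨ cong₂ (λ a b → at-most v a + (at-most v b + count Y v k)) e₁ e₀ ⟩
      a + (b + count Y v k)
        ≡⟨ cong (λ z → a + (b + z)) (count-cong v k (λ l l<k → e l (<⇒≢ l<k) (<⇒≢ (m≤n⇒m≤1+n l<k)))) ⟩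
      a + (b + count X v k)
        ≡⟨ trans (sym (+-assoc a b _)) (trans (cong (_+ count X v k) (+-comm a b)) (+-assoc b a _)) ⟩
      b + (a + count X v k) ∎
    where
    open ≡-Reasoning
    a = at-most v (X k)
    b = at-most v (X (suc k))

  chain : (h c : ℕ) → (ℕ → ℕ) → ℕ → ℕ
  chain h c key l = key (c + l * h)

  position-injective : ∀ h .{{_ : NonZero h}} c {k l} → c + k * h ≡ c + l * h → k ≡ l
  position-injective h c {k} {l} eq = *-cancelʳ-≡ k l h (+-cancelˡ-≡ c _ _ eq)

  sift-stop : ∀ h c k key e m → key (c + k * h) ≤ key (c + suc k * h) →
              sift h c (suc k) (state key e m) ≡ state key e (suc m)
  sift-stop h c k key e m le with key (c + suc k * h) <ᵇ key (c + k * h) in eq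
  ... | true  = ⊥-elim (<⇒≱ (<ᵇ⇒< _ _ (subst T (sym eq) _)) le)
  ... | false = refl

  sift-swap : ∀ h c k key e m → key (c + suc k * h) < key (c + k * h) →
              sift h c (suc k) (state key e m) ≡
              sift h c k (state (swap (c + k * h) (c + suc k * h) key) (suc e) (suc m))
  sift-swap h c k key e m lt with key (c + suc k * h) <ᵇ key (c + k * h) in eq
  ... | true  = refl
  ... | false = ⊥-elim (subst T eq (<⇒<ᵇ lt))

  -- Everything used later about one insertion, collected so that a single induction proves it.
  -- `few-compared` caps the cost when the first t keys already lie below the inserted one, the
  -- extra 1 being the comparison that stops; `exchanged` says that d larger keys directly in front
  -- force d exchanges.
  record Sifted (h c k : ℕ) (s s′ : State) : Set where
    private
      X  = chain h c (key s)
      X′ = chain h c (key s′)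
    field
      elsewhere    : ∀ p → (∀ l → l ≤ k → p ≢ c + l * h) → key s′ p ≡ key s p
      counts       : ∀ v M → k < M → count X′ v M ≡ count X v M
      extends      : SortedTo X k → SortedTo X′ (suc k)
      few-compared : ∀ t → t ≤ k → (∀ l → l < t → X l ≤ X k) → comparisons s′ ≤ comparisons s + suc (k ∸ t)
      exchanged    : ∀ d → d ≤ k → (∀ l → l < k → k ≤ l + d → X k < X l) → exchanges s + d ≤ exchanges s′
      -- The increase in exchanges is at most the increase in comparisons, arranged without
      -- subtraction.
      compared     : exchanges s′ + comparisons s ≤ comparisons s′ + exchanges s

  open Sifted public

  sifted : ∀ h .{{_ : NonZero h}} c k s → Sifted h c k s (sift h c k s)
  sifted h c zero s = record
    { elsewhere    = λ _ _ → refl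
    ; counts       = λ _ _ _ → refl
    ; extends      = λ _ l → λ { (s≤s ()) }
    ; few-compared = λ _ _ _ → m≤m+n _ _
    ; exchanged    = λ { zero _ _ → ≤-reflexive (+-identityʳ _) }
    ; compared     = ≤-reflexive (+-comm (exchanges s) (comparisons s))
    }
  sifted h c (suc k) (state key₀ e m) with key₀ (c + suc k * h) <? key₀ (c + k * h)
  ... | no ≮ = subst (Sifted h c (suc k) (state key₀ e m)) (sym (sift-stop h c k key₀ e m (≮⇒≥ ≮))) record
    { elsewhere    = λ _ _ → refl
    ; counts       = λ _ _ _ → refl
    ; extends      = extend
    ; few-compared = λ t _ _ → subst (_≤ m + suc (suc k ∸ t)) (+-comm m 1) (+-monoʳ-≤ m (s≤s z≤n))
    ; exchanged    = λ { zero _ _ → ≤-reflexive (+-identityʳ _)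
                       ; (suc d) _ h → ⊥-elim (≮ (h k ≤-refl (subst (suc k ≤_) (sym (+-suc k d)) (s≤s (m≤m+n k d))))) }
    ; compared     = subst (_≤ suc m + e) (+-comm m e) (n≤1+n _)
    }
    where
    extend : SortedTo (chain h c key₀) (suc k) → SortedTo (chain h c key₀) (suc (suc k))
    extend s l (s≤s l≤k) with m≤n⇒m<n∨m≡n l≤k
    ... | inj₁ l<k  = s l l<k
    ... | inj₂ refl = ≮⇒≥ ≮
  ... | yes lt = subst (Sifted h c (suc k) (state key₀ e m)) (sym (sift-swap h c k key₀ e m lt)) record
    { elsewhere    = λ p off → trans (elsewhere ih p (λ l l≤k → off l (m≤n⇒m≤1+n l≤k)))
                       (swap-other key₀ (off k (n≤1+n k)) (off (suc k) ≤-refl))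
    ; counts       = λ v M k<M → trans (counts ih v M (<-trans (n<1+n k) k<M)) (count-exchange {X} {Y} k v Yk Ysk Yl M k<M)
    ; extends      = extend
    ; few-compared = few
    ; exchanged    = exch
    ; compared     = ≤-pred (subst₂ _≤_ (+-suc _ m) (+-suc _ e) (compared ih))
    }
    where
    s₁ = state (swap (c + k * h) (c + suc k * h) key₀) (suc e) (suc m)
    s₂ = sift h c k s₁
    ih = sifted h c k s₁
    X = chain h c key₀
    Y = chain h c (key s₁)
    Z = chain h c (key s₂)
    inj : ∀ {k l} → c + k * h ≡ c + l * h → k ≡ l
    inj = position-injective h c
    Yk : Y k ≡ X (suc k)
    Yk = swap-left (c + k * h) (c + suc k * h) key₀
    Ysk : Y (suc k) ≡ X k
    Ysk = swap-right {c + k * h} {c + suc k * h} key₀ (λ eq → 1+n≢n (sym (inj {k} {suc k} eq)))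
    Yl : ∀ l → l ≢ k → l ≢ suc k → Y l ≡ X l
    Yl l l≢k l≢sk = swap-other {c + k * h} {c + suc k * h} {c + l * h} key₀ (l≢k ∘ inj {l} {k}) (l≢sk ∘ inj {l} {suc k})
    Yl< : ∀ l → l < k → Y l ≡ X l
    Yl< l l<k = Yl l (<⇒≢ l<k) (<⇒≢ (m≤n⇒m≤1+n l<k))
    extend : SortedTo X (suc k) → SortedTo Z (suc (suc k))
    extend s = λ l lt → go l lt (m≤n⇒m<n∨m≡n (≤-pred lt))
      where
      s′ : SortedTo Z (suc k)
      s′ = extends ih (λ l sl<k → subst₂ _≤_ (sym (Yl< l (<-trans (n<1+n l) sl<k))) (sym (Yl< (suc l) sl<k)) (s l (m≤n⇒m≤1+n sl<k)))
      Y≤ : ∀ l → l < suc k → Y l ≤ X k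
      Y≤ l l≤k with m≤n⇒m<n∨m≡n (≤-pred l≤k)
      ... | inj₁ l<k  = subst (_≤ X k) (sym (Yl< l l<k)) (sorted-≤ {X} s (<⇒≤ l<k) ≤-refl)
      ... | inj₂ refl = subst (_≤ X k) (sym Yk) (<⇒≤ lt)
      Zsk : Z (suc k) ≡ X k
      Zsk = trans (elsewhere ih (c + suc k * h) (λ l l≤k eq → >⇒≢ (s≤s l≤k) (inj {suc k} {l} eq))) Ysk
      -- The first k + 1 keys of `Z` are those of `Y` rearranged, and all of these are at most
      -- `X k`; so the threshold count at `X k` is full.
      Zk : Z k ≤ X k
      Zk = count-full⁻ Z (X k) (suc k) (≤-reflexive (sym (trans (counts ih (X k) (suc k) ≤-refl) (count-full Y (X k) (suc k) Y≤)))) k ≤-refl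
      go : ∀ l → suc l < suc (suc k) → _ → Z l ≤ Z (suc l)
      go l _ (inj₁ l<k)  = s′ l l<k
      go l _ (inj₂ refl) = subst (Z k ≤_) (sym Zsk) Zk
    few : ∀ t → t ≤ suc k → (∀ l → l < t → X l ≤ X (suc k)) → comparisons s₂ ≤ m + suc (suc k ∸ t)
    few t _ below = subst (comparisons s₂ ≤_)
        (trans (cong (λ z → suc (m + z)) (sym (+-∸-assoc 1 t≤k))) (sym (+-suc m _)))
        (few-compared ih t t≤k (λ l l<t → subst₂ _≤_ (sym (Yl< l (<-≤-trans l<t t≤k))) (sym Yk) (below l l<t)))
      where
      -- The exchange shows that `X k` exceeds the inserted key, so position k is not among the
      -- first t.
      t≤k : t ≤ k
      t≤k = ≮⇒≥ (λ k<t → <⇒≱ lt (below k k<t))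
    exch : ∀ d → d ≤ suc k → (∀ l → l < suc k → suc k ≤ l + d → X (suc k) < X l) → e + d ≤ exchanges s₂
    exch zero    _ _ = ≤-trans (n≤1+n _) (exchanged ih 0 z≤n (λ l l<k k≤l → ⊥-elim (<⇒≱ l<k (subst (k ≤_) (+-identityʳ l) k≤l))))
    exch (suc d) (s≤s d≤k) above = subst (_≤ exchanges s₂) (sym (+-suc e d))
      (exchanged ih d d≤k (λ l l<k k≤ → subst₂ _<_ (sym Yk) (sym (Yl< l l<k))
        (above l (m≤n⇒m≤1+n l<k) (subst (suc k ≤_) (sym (+-suc l d)) (s≤s k≤)))))

-- Whole passes: cost, sortedness, and its preservation

module Passes where

  open import Defs hiding (W; C)
  open Sifting
  open import Data.Nat
  open import Data.Nat.Properties
  open import Data.Nat.DivMod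
  open import Data.List using (_∷_; _++_; [_]; filter; foldl; upTo)
  open import Data.List.Properties using (upTo-∷ʳ; filter-++; filter-accept; filter-reject; foldl-++; ++-identityʳ)
  open import Data.Empty using (⊥-elim)
  open import Data.Product using (∃; _,_; _×_; proj₁; proj₂)
  open import Data.Sum using (inj₁; inj₂)
  open import Function using (_∘_)
  open import Relation.Binary.PropositionalEquality hiding ([_])
  open import Relation.Nullary using (¬_; yes; no)
  open import Relation.Unary using (Pred; Decidable)
  open import Level using (0ℓ)

  sumTo : (ℕ → ℕ) → ℕ → ℕ
  sumTo d zero    = 0
  sumTo d (suc N) = sumTo d N + d N

  iterate : (ℕ → State → State) → ℕ → State → State
  iterate f zero    s = s
  iterate f (suc N) s = f N (iterate f N s)

  foldl-upTo : ∀ (f : ℕ → State → State) N s → foldl (λ s k → f k s) s (upTo N) ≡ iterate f N s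
  foldl-upTo f zero    s = refl
  foldl-upTo f (suc N) s = trans (cong (foldl (λ s k → f k s) s) (sym (upTo-∷ʳ N)))
    (trans (foldl-++ (λ s k → f k s) s (upTo N) [ N ]) (cong (f N) (foldl-upTo f N s)))

  -- The indices of a chain that stay inside the array are closed downwards, so filtering them
  -- yields an initial segment and the fold over a chain becomes a plain iteration.
  filter-upTo : ∀ {P : Pred ℕ 0ℓ} (P? : Decidable P) → (∀ {k l} → k ≤ l → P l → P k) →
                ∀ n → ∃ λ N → N ≤ n × filter P? (upTo n) ≡ upTo N × (∀ k → k < N → P k) × (∀ k → k < n → P k → k < N)
  filter-upTo P? closed zero = 0 , z≤n , refl , (λ _ ()) , (λ _ ())
  filter-upTo {P} P? closed (suc n) with filter-upTo P? closed n | P? n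
  ... | N , N≤n , eq , sound , complete | no ¬p =
    N , m≤n⇒m≤1+n N≤n ,
    trans (cong (filter P?) (sym (upTo-∷ʳ n))) (trans (filter-++ P? (upTo n) [ n ])
      (trans (cong (filter P? (upTo n) ++_) (filter-reject P? ¬p)) (trans (++-identityʳ _) eq))) ,
    sound , complete′
    where
    complete′ : ∀ k → k < suc n → P k → k < N
    complete′ k k≤n pk with m≤n⇒m<n∨m≡n (≤-pred k≤n)
    ... | inj₁ k<n  = complete k k<n pk
    ... | inj₂ refl = ⊥-elim (¬p pk)
  ... | N , N≤n , eq , sound , complete | yes p with m≤n⇒m<n∨m≡n N≤n
  ...   | inj₁ N<n  = ⊥-elim (<-irrefl refl (complete N N<n (closed N≤n p)))
  ...   | inj₂ refl = suc n , ≤-refl ,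
    trans (cong (filter P?) (sym (upTo-∷ʳ n))) (trans (filter-++ P? (upTo n) [ n ])
      (trans (cong₂ _++_ eq (filter-accept P? p)) (upTo-∷ʳ n))) ,
    (λ k k≤n → closed (≤-pred k≤n) p) , (λ _ k<n _ → k<n)

  record Sorted (n h : ℕ) (key : ℕ → ℕ) : Set where
    constructor sorted
    field ordered : ∀ i → i + h < n → key i ≤ key (i + h)

  open Sorted public

  module Chains (n h : ℕ) {{_ : NonZero h}} where

    chainLength : ∀ c → ∃ λ N → filter (λ k → c + k * h <? n) (upTo n) ≡ upTo N ×
                                (∀ k → k < N → c + k * h < n) × (∀ k → c + k * h < n → k < N)
    chainLength c with filter-upTo (λ k → c + k * h <? n) (λ k≤l → ≤-<-trans (+-monoʳ-≤ c (*-monoˡ-≤ h k≤l))) n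
    ... | N , _ , eq , sound , complete = N , eq , sound ,
      λ k lt → complete k (≤-<-trans (≤-trans (m≤m*n k h) (m≤n+m (k * h) c)) lt) lt

    len : ℕ → ℕ
    len c = proj₁ (chainLength c)

    len-sound : ∀ c {k} → k < len c → c + k * h < n
    len-sound c = proj₁ (proj₂ (proj₂ (chainLength c))) _

    len-complete : ∀ c {k} → c + k * h < n → k < len c
    len-complete c = proj₂ (proj₂ (proj₂ (chainLength c))) _

    len≤ : ∀ c → len c ≤ suc (n / h)
    len≤ c with len c in eq
    ... | zero  = z≤n
    ... | suc N = s≤s (subst (_≤ n / h) (m*n/n≡m N h) (/-monoˡ-≤ h (<⇒≤ (≤-<-trans (m≤n+m (N * h) c)
                    (len-sound c (subst (N <_) (sym eq) ≤-refl))))))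

    run : ℕ → ℕ → State → State
    run c = iterate (λ k → sift h c k)

    insertionSort-run : ∀ c s → insertionSort n h c s ≡ run c (len c) s
    insertionSort-run c s = trans (cong (foldl (λ s k → sift h c k s) s) (proj₁ (proj₂ (chainLength c))))
      (foldl-upTo (λ k → sift h c k) (len c) s)

    run-elsewhere : ∀ c N s p → (∀ l → l < N → p ≢ c + l * h) → key (run c N s) p ≡ key s p
    run-elsewhere c zero    s p off = refl
    run-elsewhere c (suc N) s p off = trans (elsewhere (sifted h c N (run c N s)) p (λ l l≤N → off l (s≤s l≤N)))
      (run-elsewhere c N s p (λ l l<N → off l (m≤n⇒m≤1+n l<N)))

    run-ahead : ∀ c N s {k} → N ≤ k → chain h c (key (run c N s)) k ≡ chain h c (key s) k
    run-ahead c N s {k} N≤k = run-elsewhere c N s (c + k * h) (λ l l<N eq → <⇒≢ (<-≤-trans l<N N≤k) (sym (position-injective h c {k} {l} eq)))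

    run-count : ∀ c N s v M → N ≤ M → count (chain h c (key (run c N s))) v M ≡ count (chain h c (key s)) v M
    run-count c zero    s v M _   = refl
    run-count c (suc N) s v M N<M = trans (counts (sifted h c N (run c N s)) v M N<M) (run-count c N s v M (<⇒≤ N<M))

    run-sorted : ∀ c N s → SortedTo (chain h c (key (run c N s))) N
    run-sorted c zero    s = λ _ ()
    run-sorted c (suc N) s = extends (sifted h c N (run c N s)) (run-sorted c N s)

    -- The hypothesis concerns the chain before sorting. Its first N - D keys are all ≤ key N, so at
    -- least N - D of the first N keys are. Sorting moves them to the front, and the insertion of
    -- key N stops after at most D + 1 comparisons.
    run-comparisons : ∀ D c N s → (∀ k l → k < N → l + D ≤ k → chain h c (key s) l ≤ chain h c (key s) k) →
                      comparisons (run c N s) ≤ comparisons s + N * suc D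
    run-comparisons D c zero    s far = ≤-reflexive (sym (+-identityʳ _))
    run-comparisons D c (suc N) s far = begin
      comparisons (run c (suc N) s)
        ≤⟨ few-compared (sifted h c N (run c N s)) (N ∸ D) (m∸n≤m N D) below ⟩
      comparisons (run c N s) + suc (N ∸ (N ∸ D))
        ≤⟨ +-mono-≤ (run-comparisons D c N s (λ k l k<N → far k l (m≤n⇒m≤1+n k<N))) (s≤s (m∸[m∸n]≤n N D)) ⟩
      comparisons s + N * suc D + suc D
        ≡⟨ trans (+-assoc (comparisons s) _ _) (cong (comparisons s +_) (+-comm (N * suc D) (suc D))) ⟩
      comparisons s + suc N * suc D ∎
      where
      open ≤-Reasoning
      X = chain h c (key s)
      Y = chain h c (key (run c N s))
      m∸[m∸n]≤n : ∀ m n → m ∸ (m ∸ n) ≤ n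
      m∸[m∸n]≤n m n with ≤-total n m
      ... | inj₁ n≤m = ≤-reflexive (m∸[m∸n]≡n n≤m)
      ... | inj₂ m≤n = subst (λ z → m ∸ z ≤ n) (sym (m≤n⇒m∸n≡0 m≤n)) m≤n
      far′ : ∀ l → l < N ∸ D → X l ≤ X N
      far′ l lt = far N l ≤-refl (≤-trans (+-monoˡ-≤ D (<⇒≤ lt)) (≤-reflexive (m∸n+n≡m {N} {D} (<⇒≤ (m∸n≢0⇒n<m {N} {D} (λ eq → n≮0 (subst (l <_) eq lt)))))))
      below : ∀ l → l < N ∸ D → Y l ≤ Y N
      below l lt = subst (Y l ≤_) (sym (run-ahead c N s ≤-refl))
        (sorted-count⁻ {Y} (run-sorted c N s) (subst (l <_) (sym (run-count c N s (X N) N ≤-refl))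
          (≤-trans lt (≤-trans (≤-reflexive (sym (count-full X (X N) (N ∸ D) far′))) (count-mono X (X N) (m∸n≤m N D))))))

    run-compared : ∀ c N s → exchanges s ≤ comparisons s → exchanges (run c N s) ≤ comparisons (run c N s)
    run-compared c zero    s e≤c = e≤c
    run-compared c (suc N) s e≤c = +-cancelʳ-≤ (comparisons (run c N s)) _ _
      (≤-trans (compared (sifted h c N (run c N s))) (+-monoʳ-≤ _ (run-compared c N s e≤c)))

    -- `d k` is a lower bound for the number of earlier keys larger than key k. Once the earlier
    -- keys are sorted, the larger ones occupy at least the last `d k` places, and key k must pass
    -- them all.
    run-exchanges : ∀ c N s (d : ℕ → ℕ) →
      (∀ k → k < N → d k ≤ k × count (chain h c (key s)) (chain h c (key s) k) k + d k ≤ k) →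
      exchanges s + sumTo d N ≤ exchanges (run c N s)
    run-exchanges c zero    s d deep = ≤-reflexive (+-identityʳ _)
    run-exchanges c (suc N) s d deep = begin
      exchanges s + (sumTo d N + d N)     ≡⟨ sym (+-assoc (exchanges s) _ _) ⟩
      exchanges s + sumTo d N + d N       ≤⟨ +-monoˡ-≤ (d N) (run-exchanges c N s d (λ k k<N → deep k (m≤n⇒m≤1+n k<N))) ⟩
      exchanges (run c N s) + d N         ≤⟨ exchanged (sifted h c N (run c N s)) (d N) (proj₁ (deep N ≤-refl)) above ⟩
      exchanges (run c (suc N) s)         ∎
      where
      open ≤-Reasoning
      X = chain h c (key s)
      Y = chain h c (key (run c N s))
      above : ∀ l → l < N → N ≤ l + d N → Y N < Y l
      above l l<N N≤ = subst (_< Y l) (sym (run-ahead c N s ≤-refl)) (≰⇒> λ Yl≤ → <-irrefl refl (begin-strict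
        l + d N                              <⟨ +-monoˡ-< (d N) (subst (l <_) (run-count c N s (X N) N ≤-refl) (sorted-count {Y} (run-sorted c N s) l<N Yl≤)) ⟩
        count X (X N) N + d N                ≤⟨ proj₂ (deep N ≤-refl) ⟩
        N                                    ≤⟨ N≤ ⟩
        l + d N                              ∎))

    sweep : ℕ → State → State
    sweep = iterate (λ c → insertionSort n h c)

    pass-sweep : ∀ s → pass n h s ≡ sweep h s
    pass-sweep s = foldl-upTo (λ c → insertionSort n h c) h s

    residue-injective : ∀ {c c′ k l} → c < h → c′ < h → c + k * h ≡ c′ + l * h → c ≡ c′
    residue-injective {c} {c′} {k} {l} c<h c′<h eq = begin
      c                   ≡⟨ sym (m<n⇒m%n≡m c<h) ⟩
      c % h               ≡⟨ sym ([m+kn]%n≡m%n c k h) ⟩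
      (c + k * h) % h     ≡⟨ cong (_% h) eq ⟩
      (c′ + l * h) % h    ≡⟨ [m+kn]%n≡m%n c′ l h ⟩
      c′ % h              ≡⟨ m<n⇒m%n≡m c′<h ⟩
      c′                  ∎
      where open ≡-Reasoning

    sort-other : ∀ {c c′} → c < h → c′ < h → c ≢ c′ → ∀ s k → key (insertionSort n h c s) (c′ + k * h) ≡ key s (c′ + k * h)
    sort-other {c} {c′} c<h c′<h c≢c′ s k = trans (cong (λ z → key z (c′ + k * h)) (insertionSort-run c s))
      (run-elsewhere c (len c) s (c′ + k * h) (λ l _ eq → c≢c′ (sym (residue-injective {c′} {c} {k} {l} c′<h c<h eq))))

    sweep-ahead : ∀ m s {c} → m ≤ h → m ≤ c → c < h → ∀ k → key (sweep m s) (c + k * h) ≡ key s (c + k * h)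
    sweep-ahead zero    s m≤h m≤c c<h k = refl
    sweep-ahead (suc m) s m<h m<c c<h k = trans (sort-other m<h c<h (<⇒≢ m<c) (sweep m s) k)
      (sweep-ahead m s (<⇒≤ m<h) (<⇒≤ m<c) c<h k)

    sweep-behind : ∀ m s {c} → m ≤ h → c < m → ∀ k →
                   key (sweep m s) (c + k * h) ≡ key (run c (len c) (sweep c s)) (c + k * h)
    sweep-behind (suc m) s {c} m<h c≤m k with m≤n⇒m<n∨m≡n (≤-pred c≤m)
    ... | inj₁ c<m  = trans (sort-other m<h (<-trans c<m m<h) (>⇒≢ c<m) (sweep m s) k) (sweep-behind m s (<⇒≤ m<h) c<m k)
    ... | inj₂ refl = cong (λ z → key z (c + k * h)) (insertionSort-run c (sweep c s))

    pass-chain : ∀ s {c} → c < h → ∀ k → chain h c (key (pass n h s)) k ≡ chain h c (key (run c (len c) (sweep c s))) k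
    pass-chain s {c} c<h k = trans (cong (λ z → key z (c + k * h)) (pass-sweep s)) (sweep-behind h s ≤-refl c<h k)

    chain-count : ∀ s {c} → c < h → ∀ v →
      count (chain h c (key (run c (len c) (sweep c s)))) v (len c) ≡ count (chain h c (key s)) v (len c)
    chain-count s {c} c<h v = trans (run-count c (len c) (sweep c s) v (len c) ≤-refl)
      (count-cong v (len c) (λ l _ → sweep-ahead c s (<⇒≤ c<h) ≤-refl c<h l))

    -- A pass preserves the number of keys ≤ v in each chain, and afterwards position k of the
    -- chain holds a key ≤ v exactly when this number exceeds k.
    pass-front : ∀ s {c} → c < h → ∀ {k} → k < len c → ∀ v → chain h c (key (pass n h s)) k ≤ v → k < count (chain h c (key s)) v (len c)
    pass-front s {c} c<h {k} k<N v le = subst (k <_) (chain-count s c<h v)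
        (sorted-count {Z} (run-sorted c (len c) (sweep c s)) k<N (subst (_≤ v) (pass-chain s c<h k) le))
      where Z = chain h c (key (run c (len c) (sweep c s)))

    pass-front⁻ : ∀ s {c} → c < h → ∀ {k} v → k < count (chain h c (key s)) v (len c) → chain h c (key (pass n h s)) k ≤ v
    pass-front⁻ s {c} c<h {k} v lt = subst (_≤ v) (sym (pass-chain s c<h k))
        (sorted-count⁻ {Z} (run-sorted c (len c) (sweep c s)) (subst (k <_) (sym (chain-count s c<h v)) lt))
      where Z = chain h c (key (run c (len c) (sweep c s)))

    coordinates : ∀ i → i % h + i / h * h ≡ i
    coordinates i = sym (m≡m%n+[m/n]*n i h)

    pass-sorts : ∀ s → Sorted n h (key (pass n h s))
    pass-sorts s = sorted λ i lt → subst₂ (λ a b → key (pass n h s) a ≤ key (pass n h s) b) (coordinates i) (next i)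
        (step (i % h) (i / h) (m%n<n i h) (subst (_< n) (sym (next i)) lt))
      where
      next : ∀ i → i % h + suc (i / h) * h ≡ i + h
      next i = trans (cong (i % h +_) (+-comm h (i / h * h))) (trans (sym (+-assoc (i % h) _ h)) (cong (_+ h) (coordinates i)))
      step : ∀ c k → c < h → c + suc k * h < n → key (pass n h s) (c + k * h) ≤ key (pass n h s) (c + suc k * h)
      step c k c<h lt = pass-front⁻ s c<h _ (<-trans (n<1+n k) (pass-front s c<h (len-complete c lt) _ ≤-refl))

    count-shift : ∀ X v q t → count X v (q + t) ≤ q + count (λ l → X (q + l)) v t
    count-shift X v q zero    = count≤ X v (q + 0)
    count-shift X v q (suc t) = subst (λ z → count X v z ≤ q + count (λ l → X (q + l)) v (suc t)) (sym (+-suc q t))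
      (≤-trans (+-monoʳ-≤ (at-most v (X (q + t))) (count-shift X v q t))
        (≤-reflexive (trans (sym (+-assoc a q _)) (trans (cong (_+ count (λ l → X (q + l)) v t) (+-comm a q)) (+-assoc q a _)))))
      where a = at-most v (X (q + t))

    count-≤ : ∀ {X Y} v m → (∀ l → l < m → Y l ≤ X l) → count X v m ≤ count Y v m
    count-≤ v zero    le = z≤n
    count-≤ v (suc m) le = +-mono-≤ (at-most-anti v (le m ≤-refl)) (count-≤ v m (λ l l<m → le l (m≤n⇒m≤1+n l<m)))

    -- The classical fact that h-sorting keeps an array g-sorted. Moving by g takes entry l of chain
    -- c to entry q + l of chain c′, where c + g = c′ + q h. By the old g-order, chain c′ has at
    -- most q more keys ≤ v than chain c. If v is the new key at entry q + k of c′, more than q + k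
    -- keys of c′ are ≤ v, hence more than k keys of c, and the new key at entry k of c is ≤ v.
    pass-preserves : ∀ g s → Sorted n g (key s) → Sorted n g (key (pass n h s))
    pass-preserves g s srt = sorted λ i lt →
        subst₂ (λ a b → key (pass n h s) a ≤ key (pass n h s) b) (coordinates i)
          (trans (shift (i % h) (i / h)) (trans (swap-+ (i % h) g (i / h * h)) (cong (_+ g) (coordinates i))))
          (step (i % h) (i / h) (m%n<n i h) (subst (_< n) (sym (trans (swap-+ (i % h) g (i / h * h)) (cong (_+ g) (coordinates i)))) lt))
      where
      swap-+ : ∀ a b c → a + b + c ≡ a + c + b
      swap-+ a b c = trans (+-assoc a b c) (trans (cong (a +_) (+-comm b c)) (sym (+-assoc a c b)))
      shift : ∀ c k → (c + g) % h + ((c + g) / h + k) * h ≡ c + g + k * h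
      shift c k = trans (cong ((c + g) % h +_) (*-distribʳ-+ h ((c + g) / h) k))
        (trans (sym (+-assoc ((c + g) % h) _ _)) (cong (_+ k * h) (coordinates (c + g))))
      step : ∀ c k → c < h → c + g + k * h < n →
             key (pass n h s) (c + k * h) ≤ key (pass n h s) ((c + g) % h + ((c + g) / h + k) * h)
      step c k c<h lt = pass-front⁻ s c<h v
          (+-cancelˡ-< q k (count X v (len c)) (<-≤-trans (pass-front s (m%n<n (c + g) h) (len-complete c′ (subst (_< n) (sym (shift c k)) lt)) v ≤-refl) moved))
        where
        q = (c + g) / h
        c′ = (c + g) % h
        v = key (pass n h s) (c′ + (q + k) * h)
        X = chain h c (key s)
        X′ = chain h c′ (key s)
        moved : count X′ v (len c′) ≤ q + count X v (len c)
        moved with ≤-total (len c′) q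
        ... | inj₁ N≤q = ≤-trans (count≤ X′ v (len c′)) (≤-trans N≤q (m≤m+n q _))
        ... | inj₂ q≤N = begin
          count X′ v (len c′)                         ≡⟨ cong (count X′ v) (sym q+t) ⟩
          count X′ v (q + t)                          ≤⟨ count-shift X′ v q t ⟩
          q + count (λ l → X′ (q + l)) v t            ≤⟨ +-monoʳ-≤ q (count-≤ v t (λ l l<t → X≤X′ l (in-range l l<t))) ⟩
          q + count X v t                             ≤⟨ +-monoʳ-≤ q (count-mono X v t≤N) ⟩
          q + count X v (len c)                       ∎
          where
          open ≤-Reasoning
          t = len c′ ∸ q
          q+t : q + t ≡ len c′
          q+t = m+[n∸m]≡n q≤N
          in-range : ∀ l → l < t → c + g + l * h < n
          in-range l l<t = subst (_< n) (shift c l) (len-sound c′ (subst (q + l <_) q+t (+-monoʳ-< q l<t)))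
          X≤X′ : ∀ l → c + g + l * h < n → X l ≤ X′ (q + l)
          X≤X′ l lt = subst (λ z → X l ≤ key s z) (trans (sym (swap-+ c g (l * h))) (sym (shift c l)))
            (ordered srt (c + l * h) (subst (_< n) (swap-+ c g (l * h)) lt))
          t≤N : t ≤ len c
          t≤N with t in eq
          ... | zero   = z≤n
          ... | suc t′ = len-complete c (≤-<-trans (+-monoˡ-≤ (t′ * h) (m≤m+n c g)) (in-range t′ (subst (t′ <_) (sym eq) ≤-refl)))

    -- The h chains have at most h (n/h + 1) entries in all, which h < n bounds by 2 n.
    pass-comparisons : ∀ D s → h < n → (∀ i d → D ≤ d → i + d * h < n → key s i ≤ key s (i + d * h)) →
                       comparisons (pass n h s) ≤ comparisons s + 2 * n * suc D
    pass-comparisons D s h<n far = subst (λ z → comparisons z ≤ comparisons s + 2 * n * suc D) (sym (pass-sweep s))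
        (≤-trans (sweep-comparisons h ≤-refl) (+-monoʳ-≤ (comparisons s) (begin
          h * (suc (n / h) * suc D)       ≡⟨ sym (*-assoc h _ _) ⟩
          h * suc (n / h) * suc D         ≤⟨ *-monoˡ-≤ (suc D) total ⟩
          2 * n * suc D                   ∎)))
      where
      open ≤-Reasoning
      total : h * suc (n / h) ≤ 2 * n
      total = begin
        h * suc (n / h)       ≡⟨ *-suc h (n / h) ⟩
        h + h * (n / h)       ≡⟨ cong (h +_) (*-comm h (n / h)) ⟩
        h + n / h * h         ≤⟨ +-mono-≤ (<⇒≤ h<n) (m/n*n≤m n h) ⟩
        n + n                 ≡⟨ cong (n +_) (sym (+-identityʳ n)) ⟩
        2 * n                 ∎
      sweep-comparisons : ∀ m → m ≤ h → comparisons (sweep m s) ≤ comparisons s + m * (suc (n / h) * suc D)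
      sweep-comparisons zero    _   = ≤-reflexive (sym (+-identityʳ _))
      sweep-comparisons (suc m) m<h = begin
        comparisons (insertionSort n h m (sweep m s))
          ≡⟨ cong comparisons (insertionSort-run m (sweep m s)) ⟩
        comparisons (run m (len m) (sweep m s))
          ≤⟨ run-comparisons D m (len m) (sweep m s) far′ ⟩
        comparisons (sweep m s) + len m * suc D
          ≤⟨ +-mono-≤ (sweep-comparisons m (<⇒≤ m<h)) (*-monoˡ-≤ (suc D) (len≤ m)) ⟩
        comparisons s + m * (suc (n / h) * suc D) + suc (n / h) * suc D
          ≡⟨ trans (+-assoc (comparisons s) _ _) (cong (comparisons s +_) (+-comm (m * (suc (n / h) * suc D)) _)) ⟩
        comparisons s + suc m * (suc (n / h) * suc D) ∎
        where
        far′ : ∀ k l → k < len m → l + D ≤ k → chain h m (key (sweep m s)) l ≤ chain h m (key (sweep m s)) k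
        far′ k l k<N l+D≤k = subst₂ _≤_ (sym (sweep-ahead m s (<⇒≤ m<h) ≤-refl m<h l)) (sym (sweep-ahead m s (<⇒≤ m<h) ≤-refl m<h k))
          (subst (λ z → key s (m + l * h) ≤ key s z) eq (far (m + l * h) (k ∸ l) (m+n≤o⇒n≤o∸m l+D≤k) (subst (_< n) (sym eq) (len-sound m k<N))))
          where
          m+n≤o⇒n≤o∸m : l + D ≤ k → D ≤ k ∸ l
          m+n≤o⇒n≤o∸m le = subst (_≤ k ∸ l) (m+n∸m≡n l D) (∸-monoˡ-≤ l le)
          eq : m + l * h + (k ∸ l) * h ≡ m + k * h
          eq = trans (+-assoc m _ _) (cong (m +_) (trans (sym (*-distribʳ-+ h l (k ∸ l)))
                 (cong (_* h) (m+[n∸m]≡n (≤-trans (m≤m+n l D) l+D≤k)))))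

    pass-compared : ∀ s → exchanges s ≤ comparisons s → exchanges (pass n h s) ≤ comparisons (pass n h s)
    pass-compared s e≤c = subst (λ z → exchanges z ≤ comparisons z) (sym (pass-sweep s)) (go h)
      where
      go : ∀ m → exchanges (sweep m s) ≤ comparisons (sweep m s)
      go zero    = e≤c
      go (suc m) = subst (λ z → exchanges z ≤ comparisons z) (sym (insertionSort-run m (sweep m s))) (run-compared m (len m) (sweep m s) (go m))

    sift-sorted : ∀ c k s → (∀ l → l < k → chain h c (key s) l ≤ chain h c (key s) (suc l)) → key (sift h c k s) ≡ key s
    sift-sorted c zero    s le = refl
    sift-sorted c (suc k) (state key₀ e m) le = cong key (sift-stop h c k key₀ e m (le k ≤-refl))

    pass-sorted : ∀ s → Sorted n h (key s) → key (pass n h s) ≡ key s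
    pass-sorted s srt = trans (cong key (pass-sweep s)) (sweep-sorted h)
      where
      run-fixed : ∀ c N s′ → key s′ ≡ key s → N ≤ len c → key (run c N s′) ≡ key s
      run-fixed c zero    s′ eq _   = eq
      run-fixed c (suc N) s′ eq N<len = trans (sift-sorted c N (run c N s′) (λ l l<N →
        subst (λ z → z (c + l * h) ≤ z (c + suc l * h)) (sym ih) (subst (λ z → key s (c + l * h) ≤ key s z) (next l)
          (ordered srt (c + l * h) (subst (_< n) (sym (next l)) (len-sound c (≤-<-trans l<N N<len))))))) ih
        where
        ih = run-fixed c N s′ eq (<⇒≤ N<len)
        next : ∀ l → c + l * h + h ≡ c + suc l * h
        next l = trans (+-assoc c _ h) (cong (c +_) (+-comm (l * h) h))
      sweep-sorted : ∀ m → key (sweep m s) ≡ key s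
      sweep-sorted zero    = refl
      sweep-sorted (suc m) = trans (cong key (insertionSort-run m (sweep m s))) (run-fixed m (len m) (sweep m s) (sweep-sorted m) ≤-refl)

-- Comparisons for gap sets closed under two multipliers

module Costs where

  open import Defs
  open Passes
  open import Data.Nat
  open import Data.Nat.Properties
  open import Data.Nat.DivMod
  open import Data.List using (List; []; _∷_; foldl; length; upTo)
  import Data.List as List
  open import Data.List.Extrema.Nat using (max≤v⁺; v≤max⁺)
  open import Data.List.Membership.Propositional using (_∈_)
  open import Data.List.Membership.Propositional.Properties using (∈-map⁺)
  import Data.List.Relation.Unary.All as All
  import Data.List.Relation.Unary.All.Properties as All
  open import Data.List.Relation.Unary.AllPairs using (AllPairs; []; _∷_)
  open import Data.List.Relation.Unary.Any using (Any; here; there)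
  import Data.List.Relation.Unary.Any as Any
  open import Data.Empty using (⊥-elim)
  open import Data.Product using (∃₂; _,_; proj₁; proj₂)
  open import Data.Sum using (_⊎_; inj₁; inj₂)
  open import Function using (_∘_)
  open import Relation.Binary.PropositionalEquality
  open import Relation.Nullary using (yes; no)

  -- Since b = 2 a - 1, y = a - d mod a works.
  frobenius : ∀ a .{{_ : NonZero a}} b d → suc b ≡ 2 * a → 2 * a * a ≤ d → ∃₂ λ x y → d ≡ x * a + y * b
  frobenius a b d 1+b≡2a 2a²≤d = x , y , +-cancelʳ-≡ y d _ (begin
      d + y                           ≡⟨ cong (_+ y) (m≡m%n+[m/n]*n d a) ⟩
      d % a + q * a + y               ≡⟨ trans (+-assoc (d % a) _ y) (trans (cong (d % a +_) (+-comm (q * a) y)) (sym (+-assoc (d % a) y _))) ⟩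
      d % a + y + q * a               ≡⟨ cong (_+ q * a) (m+[n∸m]≡n (<⇒≤ (m%n<n d a))) ⟩
      suc q * a                       ≡⟨ cong (_* a) (sym (m∸n+n≡m 2y≤1+q)) ⟩
      (x + 2 * y) * a                 ≡⟨ *-distribʳ-+ a x (2 * y) ⟩
      x * a + 2 * y * a               ≡⟨ cong (x * a +_) (trans (cong (_* a) (*-comm 2 y)) (trans (*-assoc y 2 a) (cong (y *_) (sym 1+b≡2a)))) ⟩
      x * a + y * suc b               ≡⟨ cong (x * a +_) (trans (*-suc y b) (+-comm y (y * b))) ⟩
      x * a + (y * b + y)             ≡⟨ sym (+-assoc (x * a) _ y) ⟩
      x * a + y * b + y               ∎)
    where
    open ≡-Reasoning
    q = d / a
    y = a ∸ d % a
    x = suc q ∸ 2 * y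
    2y≤1+q : 2 * y ≤ suc q
    2y≤1+q = ≤-trans (*-monoʳ-≤ 2 (m∸n≤m a (d % a)))
      (≤-trans (subst (_≤ q) (m*n/n≡m (2 * a) a) (/-monoˡ-≤ a 2a²≤d)) (n≤1+n q))

  sorted-multiple : ∀ {n h key} → Sorted n h key → ∀ x i → i + x * h < n → key i ≤ key (i + x * h)
  sorted-multiple {n} {h} {key} srt zero    i lt = ≤-reflexive (cong key (sym (+-identityʳ i)))
  sorted-multiple {n} {h} {key} srt (suc x) i lt = ≤-trans (sorted-multiple srt x i (≤-<-trans (m≤m+n _ h) lt′))
      (subst (λ z → key (i + x * h) ≤ key z) eq (ordered srt (i + x * h) lt′))
    where
    eq : i + x * h + h ≡ i + suc x * h
    eq = trans (+-assoc i _ h) (cong (i +_) (+-comm (x * h) h))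
    lt′ : i + x * h + h < n
    lt′ = subst (_< n) (sym eq) lt

  -- Write d = x a + y b and walk x steps of length a h, then y steps of length b h. The walk only
  -- moves right, so it stays inside the array.
  sorted-far : ∀ {n h key a b} .{{_ : NonZero a}} → suc b ≡ 2 * a → Sorted n (a * h) key → Sorted n (b * h) key →
               ∀ i d → 2 * a * a ≤ d → i + d * h < n → key i ≤ key (i + d * h)
  sorted-far {n} {h} {key} {a} {b} eq sa sb i d le lt with frobenius a b d eq le
  ... | x , y , refl = ≤-trans (sorted-multiple sa x i (≤-<-trans (m≤m+n _ _) lt′))
      (subst (λ z → key (i + x * (a * h)) ≤ key z) (sym split) (sorted-multiple sb y (i + x * (a * h)) lt′))
    where
    split : i + (x * a + y * b) * h ≡ i + x * (a * h) + y * (b * h)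
    split = trans (cong (i +_) (trans (*-distribʳ-+ h (x * a) (y * b)) (cong₂ _+_ (*-assoc x a h) (*-assoc y b h)))) (sym (+-assoc i _ _))
    lt′ : i + x * (a * h) + y * (b * h) < n
    lt′ = subst (_< n) split lt

  sorted-beyond : ∀ {n h key} → n ≤ h → Sorted n h key
  sorted-beyond {h = h} n≤h = sorted λ i lt → ⊥-elim (<⇒≱ lt (≤-trans n≤h (m≤n+m h i)))

  module _ (n a b : ℕ) (2≤a : 2 ≤ a) (2≤b : 2 ≤ b) (1+b≡2a : suc b ≡ 2 * a) (H : List ℕ)
           (positive : ∀ {h} → h ∈ H → 1 ≤ h) (small : ∀ {h} → h ∈ H → h < n)
           (closed-a : ∀ {h} → h ∈ H → a * h < n → a * h ∈ H)
           (closed-b : ∀ {h} → h ∈ H → b * h < n → b * h ∈ H) where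

    -- The invariant is that each gap of `H` is still to come or the array is already sorted for it;
    -- `pass-preserves` maintains the second alternative through later passes.
    comparisons-from : ∀ L s → AllPairs _>_ L → (∀ {h} → h ∈ L → h ∈ H) →
      (∀ {g} → g ∈ H → g ∈ L ⊎ Sorted n g (key s)) →
      comparisons (foldl (λ s h → pass n h s) s L) ≤ comparisons s + length L * (2 * n * suc (2 * a * a))
    comparisons-from []      s _ _ _ = m≤m+n _ _
    comparisons-from (h ∷ L) s (h>L ∷ desc) L⊆H done = ≤-trans
        (comparisons-from L (pass n h s) desc (L⊆H ∘ there) done′)
        (≤-trans (+-monoˡ-≤ (length L * B) (pass-comparisons (2 * a * a) s (small h∈H) far))
          (≤-reflexive (+-assoc (comparisons s) B _)))
      where
      B = 2 * n * suc (2 * a * a)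
      h∈H = L⊆H (here refl)
      instance
        h≢0 : NonZero h
        h≢0 = >-nonZero (positive h∈H)
        a≢0 : NonZero a
        a≢0 = >-nonZero (≤-trans (n≤1+n 1) 2≤a)
      open Chains n h
      -- A multiple m h < n is a gap larger than h, so its pass is over; a multiple m h ≥ n imposes
      -- no order at all.
      multiple : ∀ m → 2 ≤ m → (m * h < n → m * h ∈ H) → Sorted n (m * h) (key s)
      multiple m 2≤m closed with m * h <? n
      ... | no  ≮n = sorted-beyond (≮⇒≥ ≮n)
      ... | yes <n with done (closed <n)
      ...   | inj₂ srt          = srt
      ...   | inj₁ (here eq)    = ⊥-elim (<⇒≢ (m<n*m h m 2≤m) (sym eq))
        where
        m<n*m : ∀ h m .{{_ : NonZero h}} → 2 ≤ m → h < m * h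
        m<n*m h m 2≤m = ≤-trans (+-monoˡ-≤ h (>-nonZero⁻¹ h)) (≤-trans (≤-reflexive (cong (h +_) (sym (+-identityʳ h)))) (*-monoˡ-≤ h 2≤m))
      ...   | inj₁ (there mh∈L) = ⊥-elim (<⇒≱ (All.lookup h>L mh∈L) (m≤n*m h m {{>-nonZero (≤-trans (n≤1+n 1) 2≤m)}}))
      far : ∀ i d → 2 * a * a ≤ d → i + d * h < n → key s i ≤ key s (i + d * h)
      far = sorted-far 1+b≡2a (multiple a 2≤a (closed-a h∈H)) (multiple b 2≤b (closed-b h∈H))
      done′ : ∀ {g} → g ∈ H → g ∈ L ⊎ Sorted n g (key (pass n h s))
      done′ g∈H with done g∈H
      ... | inj₁ (here refl) = inj₂ (pass-sorts s)
      ... | inj₁ (there g∈L) = inj₁ g∈L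
      ... | inj₂ srt         = inj₂ (pass-preserves _ s srt)

    C-upper : AllPairs _>_ H → C n H ≤ length H * (2 * n * suc (2 * a * a))
    C-upper desc = max≤v⁺ {xs = List.map (comparisons ∘ shellsort n H) (permutations (upTo n))} z≤n
      (All.map⁺ (All.universal (λ xs → comparisons-from H (state (keyAt xs) 0 0) desc (λ h∈H → h∈H) inj₁) _))

  worst-lower : ∀ cost n H {xs} → xs ∈ permutations (upTo n) → cost (shellsort n H xs) ≤ worst cost n H
  worst-lower cost n H xs∈ = v≤max⁺ 0 (List.map (cost ∘ shellsort n H) (permutations (upTo n)))
    (inj₂ (Any.map ≤-reflexive (∈-map⁺ (cost ∘ shellsort n H) xs∈)))

  -- Each exchange is triggered by its own comparison. This carries the lower bound from exchanges
  -- to comparisons.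
  W≤C : ∀ n H → (∀ {h} → h ∈ H → 1 ≤ h) → W n H ≤ C n H
  W≤C n H positive = max≤v⁺ {xs = List.map (exchanges ∘ shellsort n H) (permutations (upTo n))} z≤n
      (All.map⁺ (All.tabulate (λ {xs} xs∈ → ≤-trans (go H (state (keyAt xs) 0 0) positive z≤n) (worst-lower comparisons n H xs∈))))
    where
    go : ∀ L s → (∀ {h} → h ∈ L → 1 ≤ h) → exchanges s ≤ comparisons s →
         exchanges (foldl (λ s h → pass n h s) s L) ≤ comparisons (foldl (λ s h → pass n h s) s L)
    go []      s _   e≤c = e≤c
    go (h ∷ L) s pos e≤c = go L (pass n h s) (pos ∘ there)
      (Chains.pass-compared n h {{>-nonZero (pos (here refl))}} s e≤c)

-- The block-reversed input and its cost in the last pass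

module Adversary where

  open import Defs
  open Sifting
  open Passes
  open Costs
  open import Data.Nat
  open import Data.Nat.Properties
  open import Data.Nat.DivMod
  open import Data.List using (List; []; _∷_; _++_; foldl; upTo; map; applyUpTo)
  open import Data.List.Properties using (foldl-++; map-upTo)
  open import Data.List.Membership.Propositional using (_∈_)
  open import Data.List.Membership.Propositional.Properties using (∈-map⁺; ∈-map⁻; ∈-upTo⁺; ∈-upTo⁻)
  open import Data.List.Membership.Propositional.Properties.WithK using (unique∧set⇒bag)
  open import Data.List.Relation.Binary.BagAndSetEquality using (∼bag⇒↭)
  open import Data.List.Relation.Binary.Permutation.Propositional using (_↭_)
  open import Data.List.Relation.Unary.Any using (here; there)
  import Data.List.Relation.Unary.Unique.Propositional.Properties as Unique
  open import Data.Empty using (⊥-elim)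
  open import Data.Product using (_,_; _×_; proj₁; proj₂)
  open import Function using (_∘_; mk⇔; Equivalence)
  open import Relation.Binary.PropositionalEquality
  open import Relation.Nullary using (yes; no)

  keyAt-applyUpTo : ∀ (f : ℕ → ℕ) n {i} → i < n → keyAt (applyUpTo f n) i ≡ f i
  keyAt-applyUpTo f (suc n) {zero}  _         = refl
  keyAt-applyUpTo f (suc n) {suc i} (s≤s i<n) = keyAt-applyUpTo (f ∘ suc) n i<n

  sumTo-cong : ∀ {f g} N → (∀ k → k < N → f k ≡ g k) → sumTo f N ≡ sumTo g N
  sumTo-cong zero    h = refl
  sumTo-cong (suc N) h = cong₂ _+_ (sumTo-cong N (λ k k<N → h k (m≤n⇒m≤1+n k<N))) (h N ≤-refl)

  sumTo-mono : ∀ f {M N} → M ≤ N → sumTo f M ≤ sumTo f N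
  sumTo-mono f M≤N = go (≤⇒≤′ M≤N)
    where
    go : ∀ {M N} → M ≤′ N → sumTo f M ≤ sumTo f N
    go ≤′-refl       = ≤-refl
    go (≤′-step M≤N) = ≤-trans (go M≤N) (m≤m+n _ _)

  sumTo-id : ∀ N → 2 * sumTo (λ k → k) N + N ≡ N * N
  sumTo-id zero    = refl
  sumTo-id (suc N) = begin
    2 * (S + N) + suc N           ≡⟨ cong (_+ suc N) (*-distribˡ-+ 2 S N) ⟩
    2 * S + 2 * N + suc N         ≡⟨ cong (λ z → 2 * S + (N + z) + suc N) (+-identityʳ N) ⟩
    2 * S + (N + N) + suc N       ≡⟨ cong (_+ suc N) (sym (+-assoc (2 * S) N N)) ⟩
    2 * S + N + N + suc N         ≡⟨ cong (λ z → z + N + suc N) (sumTo-id N) ⟩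
    N * N + N + suc N             ≡⟨ trans (+-comm _ (suc N)) (cong (suc N +_) (trans (+-comm (N * N) N) (sym (*-suc N N)))) ⟩
    suc N + N * suc N             ∎
    where
    open ≡-Reasoning
    S = sumTo (λ k → k) N

  module Reversal (n a : ℕ) {{_ : NonZero a}} where

    full : ℕ
    full = n / a * a

    full≤n : full ≤ n
    full≤n = m/n*n≤m n a

    mirror : ℕ → ℕ
    mirror i = pred a ∸ i % a

    mirror<a : ∀ i → mirror i < a
    mirror<a i = ≤-<-trans (m∸n≤m (pred a) (i % a)) (pred[n]<n {a})
      where
      pred[n]<n : ∀ {m} .{{_ : NonZero m}} → pred m < m
      pred[n]<n {suc m} = ≤-refl

    i%a≤ : ∀ i → i % a ≤ pred a
    i%a≤ i = <⇒≤pred (m%n<n i a)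

    -- The incomplete last block stays in place. As a ≤ n is assumed where exchanges are counted,
    -- the full blocks cover at least half of the array, so this costs only a factor 2.
    reversal : ℕ → ℕ
    reversal i with i <? full
    ... | yes _ = mirror i + i / a * a
    ... | no  _ = i

    reversal-full : ∀ {i} → i < full → reversal i ≡ mirror i + i / a * a
    reversal-full {i} i<F with i <? full
    ... | yes _ = refl
    ... | no ≮F = ⊥-elim (≮F i<F)

    reversal-rest : ∀ {i} → full ≤ i → reversal i ≡ i
    reversal-rest {i} F≤i with i <? full
    ... | yes i<F = ⊥-elim (<⇒≱ i<F F≤i)
    ... | no  _   = refl

    same-block : ∀ i q → i < a → (i + q * a) % a ≡ i × (i + q * a) / a ≡ q
    same-block i q i<a = rem , *-cancelʳ-≡ _ q a (+-cancelˡ-≡ i _ _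
        (trans (cong (_+ (i + q * a) / a * a) (sym rem)) (sym (m≡m%n+[m/n]*n (i + q * a) a))))
      where
      rem : (i + q * a) % a ≡ i
      rem = trans ([m+kn]%n≡m%n i q a) (m<n⇒m%n≡m i<a)

    block<full : ∀ {i} r → i < full → r < a → r + i / a * a < full
    block<full {i} r i<F r<a = <-≤-trans {r + i / a * a} {suc (i / a) * a} (+-monoˡ-< (i / a * a) r<a)
      (*-monoˡ-≤ a {suc (i / a)} {n / a} (m<n*o⇒m/o<n {i} {n / a} i<F))

    reversal-involutive : ∀ i → reversal (reversal i) ≡ i
    reversal-involutive i with i <? full
    ... | no ≮F   = reversal-rest (≮⇒≥ ≮F)
    ... | yes i<F = begin
        reversal j                       ≡⟨ reversal-full (block<full (mirror i) i<F (mirror<a i)) ⟩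
        pred a ∸ j % a + j / a * a       ≡⟨ cong₂ (λ r q → pred a ∸ r + q * a) (proj₁ jd) (proj₂ jd) ⟩
        pred a ∸ mirror i + i / a * a    ≡⟨ cong (_+ i / a * a) (m∸[m∸n]≡n (i%a≤ i)) ⟩
        i % a + i / a * a                ≡⟨ sym (m≡m%n+[m/n]*n i a) ⟩
        i                                ∎
      where
      open ≡-Reasoning
      j = mirror i + i / a * a
      jd = same-block (mirror i) (i / a) (mirror<a i)

    reversal< : ∀ {i} → i < n → reversal i < n
    reversal< {i} i<n with i <? full
    ... | yes i<F = <-≤-trans (block<full (mirror i) i<F (mirror<a i)) full≤n
    ... | no  _   = i<n

    input : List ℕ
    input = map reversal (upTo n)

    input-↭ : input ↭ upTo n
    input-↭ = ∼bag⇒↭ (unique∧set⇒bag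
      (Unique.map⁺ (λ {i} {j} eq → trans (sym (reversal-involutive i)) (trans (cong reversal eq) (reversal-involutive j))) (Unique.upTo⁺ n))
      (Unique.upTo⁺ n)
      (mk⇔ to from))
      where
      to : ∀ {x} → x ∈ input → x ∈ upTo n
      to x∈ with ∈-map⁻ reversal x∈
      ... | i , i∈ , refl = ∈-upTo⁺ (reversal< (∈-upTo⁻ i∈))
      from : ∀ {x} → x ∈ upTo n → x ∈ input
      from {x} x∈ = subst (_∈ input) (reversal-involutive x) (∈-map⁺ reversal (∈-upTo⁺ (reversal< (∈-upTo⁻ x∈))))

    keyAt-input : ∀ {i} → i < n → keyAt input i ≡ reversal i
    keyAt-input i<n = trans (cong (λ z → keyAt z _) (map-upTo reversal n)) (keyAt-applyUpTo reversal n i<n)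

    reversal≤ : ∀ i → reversal i ≤ i + pred a
    reversal≤ i with i <? full
    ... | yes _ = ≤-trans (+-mono-≤ (m∸n≤m (pred a) (i % a)) (m/n*n≤m i a)) (≤-reflexive (+-comm (pred a) i))
    ... | no  _ = m≤m+n i _

    -- For h ≥ a the positions i and i + h lie in different blocks, and all keys of an earlier block
    -- are smaller. If i + h lies in the unreversed rest, the bound `reversal≤` suffices, since no
    -- key exceeds its position by more than a - 1.
    input-sorted : ∀ {h} → a ≤ h → Sorted n h (keyAt input)
    input-sorted {h} a≤h = sorted λ i lt →
        subst₂ _≤_ (sym (keyAt-input (≤-<-trans (m≤m+n i h) lt))) (sym (keyAt-input lt)) (far i)
      where
      far : ∀ i → reversal i ≤ reversal (i + h)
      far i with i + h <? full
      ... | no  _   = ≤-trans (reversal≤ i) (+-monoʳ-≤ i (≤-trans pred[n]≤n a≤h))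
      ... | yes j<F = ≤-trans (≤-reflexive (reversal-full (≤-<-trans (m≤m+n i h) j<F)))
        (≤-trans (+-monoˡ-≤ (i / a * a) (<⇒≤ (mirror<a i))) (≤-trans (*-monoˡ-≤ a next) (m≤n+m _ _)))
        where
        next : suc (i / a) ≤ (i + h) / a
        next = subst (_≤ (i + h) / a) (trans (cong (_/ a) (+-comm i a)) (m/n≡1+[m∸n]/n′)) (/-monoˡ-≤ a (+-monoʳ-≤ i a≤h))
          where
          m/n≡1+[m∸n]/n′ : (a + i) / a ≡ suc (i / a)
          m/n≡1+[m∸n]/n′ = trans (m/n≡1+[m∸n]/n (m≤m+n a i)) (cong (λ z → suc (z / a)) (m+n∸m≡n a i))

    -- The number of earlier keys larger than key k: in a reversed block these are exactly the k mod
    -- a keys before it in the block.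
    depth : ℕ → ℕ
    depth k with k <? full
    ... | yes _ = k % a
    ... | no  _ = 0

    depth-full : ∀ {k} → k < full → depth k ≡ k % a
    depth-full {k} k<F with k <? full
    ... | yes _ = refl
    ... | no ≮F = ⊥-elim (≮F k<F)

    input-deep : ∀ k → k < n → depth k ≤ k × count (keyAt input) (keyAt input k) k + depth k ≤ k
    input-deep k k<n with k <? full
    ... | no  _   = z≤n , ≤-trans (≤-reflexive (+-identityʳ _)) (count≤ (keyAt input) _ k)
    ... | yes k<F = m%n≤m k a , ≤-trans (+-monoˡ-≤ (k % a) (count-above (keyAt input) (keyAt input k) (k / a * a) k later))
        (≤-reflexive (trans (+-comm _ (k % a)) (sym (m≡m%n+[m/n]*n k a))))
      where
      later : ∀ l → k / a * a ≤ l → l < k → keyAt input k < keyAt input l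
      later l le l<k = subst₂ _<_
          (sym (trans (keyAt-input k<n) (reversal-full k<F)))
          (sym (trans (keyAt-input (<-trans l<k k<n)) (trans (reversal-full (<-trans l<k k<F)) (cong₂ (λ r q → pred a ∸ r + q * a) l%a l/a))))
          (+-monoˡ-< (k / a * a) (∸-monoʳ-< {pred a} r< (i%a≤ k)))
        where
        r = l ∸ k / a * a
        l≡ : r + k / a * a ≡ l
        l≡ = m∸n+n≡m le
        r< : r < k % a
        r< = +-cancelʳ-< (k / a * a) r (k % a) (subst₂ _<_ (sym l≡) (m≡m%n+[m/n]*n k a) l<k)
        ld = same-block r (k / a) (<-trans r< (m%n<n k a))
        l%a : l % a ≡ r
        l%a = subst (λ z → z % a ≡ r) l≡ (proj₁ ld)
        l/a : l / a ≡ k / a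
        l/a = subst (λ z → z / a ≡ k / a) l≡ (proj₂ ld)

    block-sum : ∀ q k → k ≤ a → sumTo (_% a) (k + q * a) ≡ sumTo (λ k → k) k + sumTo (_% a) (q * a)
    block-sum q zero    _   = refl
    block-sum q (suc k) k<a = trans (cong₂ _+_ (block-sum q k (<⇒≤ k<a)) (proj₁ (same-block k q k<a)))
      (trans (+-assoc (sumTo (λ k → k) k) _ k) (trans (cong (sumTo (λ k → k) k +_) (+-comm _ k)) (sym (+-assoc (sumTo (λ k → k) k) k _))))

    blocks-sum : ∀ q → sumTo (_% a) (q * a) ≡ q * sumTo (λ k → k) a
    blocks-sum zero    = refl
    blocks-sum (suc q) = trans (block-sum q a ≤-refl) (cong (sumTo (λ k → k) a +_) (blocks-sum q))

    -- Let q = n / a. Each of the q full blocks contributes T = a (a - 1)/2, and n ≤ 2 q a with 4 b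
    -- ≤ a - 1 gives 4 n b ≤ 2 q a (a - 1) = 4 q T.
    total-depth : ∀ b → a ≤ n → 4 * b < a → ∀ {N} → n ≤ N → n * b ≤ sumTo depth N
    total-depth b a≤n 4b<a n≤N = ≤-trans (*-cancelˡ-≤ 4 (begin
        4 * (n * b)                         ≡⟨ trans (sym (*-assoc 4 n b)) (trans (cong (_* b) (*-comm 4 n)) (*-assoc n 4 b)) ⟩
        n * (4 * b)                         ≤⟨ *-mono-≤ n≤2qa (<⇒≤pred 4b<a) ⟩
        2 * (q * a) * pred a                ≡⟨ trans (*-assoc 2 (q * a) (pred a)) (cong (2 *_) (trans (*-assoc q a (pred a)) (cong (q *_) a[a-1]))) ⟩
        2 * (q * (2 * T))                   ≡⟨ cong (2 *_) (trans (sym (*-assoc q 2 T)) (trans (cong (_* T) (*-comm q 2)) (*-assoc 2 q T))) ⟩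
        2 * (2 * (q * T))                   ≡⟨ sym (*-assoc 2 2 (q * T)) ⟩
        4 * (q * T)                         ≡⟨ cong (4 *_) (sym (trans (sumTo-cong full (λ k k<F → depth-full k<F)) (blocks-sum q))) ⟩
        4 * sumTo depth full                ∎))
        (sumTo-mono depth (≤-trans full≤n n≤N))
      where
      open ≤-Reasoning
      q = n / a
      T = sumTo (λ k → k) a
      1≤q : 1 ≤ q
      1≤q = subst (_≤ q) (n/n≡1 a) (/-monoˡ-≤ a a≤n)
      n≤2qa : n ≤ 2 * (q * a)
      n≤2qa = begin
        n                     ≡⟨ m≡m%n+[m/n]*n n a ⟩
        n % a + q * a         ≤⟨ +-monoˡ-≤ (q * a) (≤-trans (<⇒≤ (m%n<n n a)) (m≤n*m a q {{>-nonZero 1≤q}})) ⟩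
        q * a + q * a         ≡⟨ cong (q * a +_) (sym (+-identityʳ _)) ⟩
        2 * (q * a)           ∎
      a[a-1] : a * pred a ≡ 2 * T
      a[a-1] = +-cancelʳ-≡ a _ _ (trans (trans (+-comm (a * pred a) a) (trans (sym (*-suc a (pred a))) (cong (a *_) (suc-pred a)))) (sym (sumTo-id a)))

    coarse-passes : ∀ H s → key s ≡ keyAt input → (∀ {h} → h ∈ H → a ≤ h) → key (foldl (λ s h → pass n h s) s H) ≡ keyAt input
    coarse-passes []      s eq coarse = eq
    coarse-passes (h ∷ H) s eq coarse = coarse-passes H (pass n h s)
      (trans (Chains.pass-sorted n h {{>-nonZero (≤-trans (>-nonZero⁻¹ a) (coarse (here refl)))}} s (subst (Sorted n h) (sym eq) (input-sorted (coarse (here refl))))) eq)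
      (coarse ∘ there)

    W-lower : ∀ H b → (∀ {h} → h ∈ H → a ≤ h) → a ≤ n → 4 * b < a → n * b ≤ W n (H ++ 1 ∷ [])
    W-lower H b coarse a≤n 4b<a = ≤-trans final
        (worst-lower exchanges n (H ++ 1 ∷ []) {input} (Equivalence.from (∈-permutations (upTo n)) input-↭))
      where
      open ≤-Reasoning
      open Chains n 1
      s = foldl (λ s h → pass n h s) (state (keyAt input) 0 0) H
      key-s : key s ≡ keyAt input
      key-s = coarse-passes H (state (keyAt input) 0 0) refl coarse
      len-0 : n ≤ len 0
      len-0 = ≮⇒≥ (λ lt → <-irrefl refl (len-complete 0 (subst (_< n) (sym (*-identityʳ (len 0))) lt)))
      deep : ∀ k → k < len 0 → depth k ≤ k × count (chain 1 0 (key s)) (chain 1 0 (key s) k) k + depth k ≤ k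
      deep k k<len = proj₁ d , subst (λ z → z + depth k ≤ k)
          (trans (cong (λ v → count (keyAt input) v k) (sym (at k))) (count-cong _ k (λ l _ → sym (at l)))) (proj₂ d)
        where
        at : ∀ l → chain 1 0 (key s) l ≡ keyAt input l
        at l = trans (cong (key s) (*-identityʳ l)) (cong (λ f → f l) key-s)
        d = input-deep k (subst (_< n) (*-identityʳ k) (len-sound 0 k<len))
      final : n * b ≤ exchanges (shellsort n (H ++ 1 ∷ []) input)
      final = begin
        n * b                                   ≤⟨ total-depth b a≤n 4b<a len-0 ⟩
        sumTo depth (len 0)                     ≤⟨ m≤n+m _ (exchanges s) ⟩
        exchanges s + sumTo depth (len 0)       ≤⟨ run-exchanges 0 (len 0) s depth deep ⟩
        exchanges (run 0 (len 0) s)             ≡⟨ cong exchanges (sym (insertionSort-run 0 s)) ⟩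
        exchanges (pass n 1 s)                  ≡⟨ cong exchanges (sym (foldl-++ (λ s h → pass n h s) (state (keyAt input) 0 0) H (1 ∷ []))) ⟩
        exchanges (shellsort n (H ++ 1 ∷ []) input) ∎

-- Size and structure of product grids

module Grids where

  open import Defs
  open import Data.Nat
  open import Data.Nat.Properties
  open import Data.Nat.Divisibility
  open import Data.Nat.Coprimality using (Coprime; coprime-divisor)
  open import Data.Nat.GCD using (gcd[m,n]∣m; gcd[m,n]∣n)
  open import Data.List using (List; []; _∷_; _++_; length; map; upTo; cartesianProductWith)
  open import Data.List.Properties using (length-map; length-++; length-upTo)
  open import Data.List.Extrema.Nat using (xs≤max; max≤v⁺; v≤min⁺; min≤xs)
  open import Data.List.Membership.Propositional using (_∈_)
  open import Data.List.Membership.Propositional.Properties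
  import Data.List.Relation.Unary.All as List using ([]; _∷_)
  import Data.List.Relation.Unary.All as ListAll
  import Data.List.Relation.Unary.AllPairs as List using (AllPairs; []; _∷_)
  import Data.List.Relation.Unary.AllPairs.Properties as AllPairs
  open import Data.List.Relation.Unary.Any using (here; there; any?)
  import Data.List.Relation.Unary.Unique.Propositional as List using (Unique)
  import Data.List.Relation.Unary.Unique.Propositional.Properties as Unique
  open import Data.Vec using (Vec; []; _∷_; toList)
  open import Data.Vec.Properties using (∷-injective)
  open import Data.Vec.Relation.Unary.All as All using (All; []; _∷_)
  open import Data.Vec.Relation.Unary.All.Properties using (toList⁺; toList⁻)
  open import Data.Vec.Relation.Unary.AllPairs using ([]; _∷_)
  open import Data.Empty using (⊥-elim)
  open import Data.Product using (∃; _,_; _×_; proj₁; proj₂)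
  open import Function using (_∘_; Equivalence)
  open import Relation.Binary.PropositionalEquality
  open import Relation.Nullary using (yes; no)

  -- A discrete intermediate value statement. Its uses, for powers with growing base or exponent,
  -- replace the floor of a real root or logarithm.
  crossing : ∀ (f : ℕ → ℕ) n N → f 0 < n → n ≤ f N → ∃ λ t → f t < n × n ≤ f (suc t)
  crossing f n zero    f0<n n≤f = ⊥-elim (<⇒≱ f0<n n≤f)
  crossing f n (suc N) f0<n n≤f with f N <? n
  ... | yes lt = N , lt , n≤f
  ... | no ≮n  = crossing f n N f0<n (≮⇒≥ ≮n)

  unique-⊆-length : ∀ {A : Set} {xs ys : List A} → List.Unique xs → (∀ {x} → x ∈ xs → x ∈ ys) → length xs ≤ length ys
  unique-⊆-length {xs = []} _ _ = z≤n
  unique-⊆-length {xs = x ∷ xs} (x∉xs List.∷ u) sub with ∈-∃++ (sub (here refl))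
  ... | as , bs , refl = ≤-trans (s≤s (unique-⊆-length u sub′))
      (≤-reflexive (sym (trans (length-++ as) (trans (+-suc (length as) _) (cong suc (sym (length-++ as)))))))
    where
    drop-mid : ∀ {z} as → z ∈ as ++ x ∷ bs → x ≢ z → z ∈ as ++ bs
    drop-mid []       (here z≡x)  x≢z = ⊥-elim (x≢z (sym z≡x))
    drop-mid []       (there z∈)  _   = z∈
    drop-mid (_ ∷ as) (here z≡a)  _   = here z≡a
    drop-mid (_ ∷ as) (there z∈)  x≢z = there (drop-mid as z∈ x≢z)
    sub′ : ∀ {z} → z ∈ xs → z ∈ as ++ bs
    sub′ z∈ = drop-mid as (sub (there z∈)) (ListAll.lookup x∉xs z∈)

  length-cartesianProductWith : ∀ {A B C : Set} (f : A → B → C) xs ys → length (cartesianProductWith f xs ys) ≡ length xs * length ys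
  length-cartesianProductWith f []       ys = refl
  length-cartesianProductWith f (x ∷ xs) ys = trans (length-++ (map (f x) ys))
    (cong₂ _+_ (length-map (f x) ys) (length-cartesianProductWith f xs ys))

  length-exponents : ∀ k r → length (exponents k r) ≡ k ^ r
  length-exponents k zero    = refl
  length-exponents k (suc r) = trans (length-cartesianProductWith _∷_ (upTo k) (exponents k r))
    (cong₂ _*_ (length-upTo k) (length-exponents k r))

  exponents-unique : ∀ k r → List.Unique (exponents k r)
  exponents-unique k zero    = List.[] List.∷ List.[]
  exponents-unique k (suc r) = Unique.cartesianProductWith⁺ _∷_ ∷-injective (Unique.upTo⁺ k) (exponents-unique k r)

  ∈-exponents⁺ : ∀ {k r} {v : Vec ℕ r} → All (_< k) v → v ∈ exponents k r
  ∈-exponents⁺ []           = here refl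
  ∈-exponents⁺ (x<k ∷ v<k) = ∈-cartesianProductWith⁺ _∷_ (∈-upTo⁺ x<k) (∈-exponents⁺ v<k)

  ∈-exponents⁻ : ∀ {k} r {v : Vec ℕ r} → v ∈ exponents k r → All (_< k) v
  ∈-exponents⁻ zero {[]} _ = []
  ∈-exponents⁻ {k} (suc r) v∈ with ∈-cartesianProductWith⁻ _∷_ (upTo k) (exponents k r) v∈
  ... | _ , _ , x∈ , w∈ , refl = ∈-upTo⁻ x∈ ∷ ∈-exponents⁻ r w∈

  1≤monomial : ∀ {r} {A : Vec ℕ r} → All (2 ≤_) A → ∀ v → 1 ≤ monomial A v
  1≤monomial []                  []      = ≤-refl
  1≤monomial {A = a ∷ _} (2≤a ∷ 2≤A) (k ∷ v) = *-mono-≤ (m^n>0 a {{>-nonZero (<⇒≤ 2≤a)}} k) (1≤monomial 2≤A v)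

  monomial≤ : ∀ {r M m} {A v : Vec ℕ r} → 1 ≤ M → All (_≤ M) A → All (_≤ m) v → monomial A v ≤ M ^ (r * m)
  monomial≤ 1≤M []         []         = ≤-refl
  monomial≤ {suc r} {M} {m} {a ∷ A} {x ∷ v} 1≤M (a≤M ∷ A≤M) (x≤m ∷ v≤m) = begin
    a ^ x * monomial A v    ≤⟨ *-mono-≤ (≤-trans (^-monoˡ-≤ x a≤M) (^-monoʳ-≤ M {{>-nonZero 1≤M}} x≤m)) (monomial≤ {A = A} {v} 1≤M A≤M v≤m) ⟩
    M ^ m * M ^ (r * m)     ≡⟨ sym (^-distribˡ-+-* M m (r * m)) ⟩
    M ^ (m + r * m)         ∎
    where open ≤-Reasoning

  exponents-small : ∀ {r n k} {A v : Vec ℕ r} → All (2 ≤_) A → All (λ a → n ≤ a ^ k) A → monomial A v < n → All (_< k) v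
  exponents-small {v = []} [] [] _ = []
  exponents-small {n = n} {k} {a ∷ A} {x ∷ v} (2≤a ∷ 2≤A) (n≤ ∷ n≤A) lt =
    ≰⇒> (λ k≤x → <⇒≱ lt (≤-trans n≤ (≤-trans (^-monoʳ-≤ a {{a≢0}} k≤x) (m≤m*n (a ^ x) (monomial A v) {{>-nonZero (1≤monomial 2≤A v)}})))) ∷
    exponents-small 2≤A n≤A (≤-<-trans (m≤n*m (monomial A v) (a ^ x) {{m^n≢0 a x {{a≢0}}}}) lt)
    where a≢0 = >-nonZero (<⇒≤ 2≤a)

  module _ {r n : ℕ} {A : Vec ℕ r} where

    private
      dec = λ h → any? (λ v → monomial A v ≟ h) (exponents n r)

    grid-unique : List.Unique (grid A n)
    grid-unique = Unique.filter⁺ dec (Unique.downFrom⁺ n)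

    grid-descending : List.AllPairs _>_ (grid A n)
    grid-descending = AllPairs.filter⁺ dec (AllPairs.applyDownFrom⁺₁ (λ i → i) n (λ j<i _ → j<i))

    module _ (2≤A : All (2 ≤_) A) where

      grid⁺ : ∀ v → monomial A v < n → monomial A v ∈ grid A n
      grid⁺ v lt = Equivalence.from (∈-grid {A = A} 2≤A) (lt , v , refl)

      grid⁻ : ∀ {h} → h ∈ grid A n → h < n × ∃ λ v → monomial A v ≡ h
      grid⁻ = Equivalence.to (∈-grid {A = A} 2≤A)

      grid-positive : ∀ {h} → h ∈ grid A n → 1 ≤ h
      grid-positive h∈ with grid⁻ h∈
      ... | _ , v , refl = 1≤monomial 2≤A v

      -- Independence makes `monomial A` injective, so the box of exponent vectors embeds into the
      -- grid.
      grid-large : ∀ {k} → Independent A → (∀ v → All (_< k) v → monomial A v < n) → k ^ r ≤ length (grid A n)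
      grid-large {k} indep box = ≤-trans
        (≤-reflexive (trans (sym (length-exponents k r)) (sym (length-map (monomial A) (exponents k r)))))
        (unique-⊆-length (Unique.map⁺ (indep _ _) (exponents-unique k r)) sub)
        where
        sub : ∀ {h} → h ∈ map (monomial A) (exponents k r) → h ∈ grid A n
        sub h∈ with ∈-map⁻ (monomial A) h∈
        ... | v , v∈ , refl = grid⁺ v (box v (∈-exponents⁻ r v∈))

      grid-few : ∀ {k} → All (λ a → n ≤ a ^ k) A → length (grid A n) ≤ k ^ r
      grid-few {k} n≤ = ≤-trans (unique-⊆-length grid-unique sub)
        (≤-reflexive (trans (length-map (monomial A) (exponents k r)) (length-exponents k r)))
        where
        sub : ∀ {h} → h ∈ grid A n → h ∈ map (monomial A) (exponents k r)
        sub h∈ with grid⁻ h∈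
        ... | lt , v , refl = ∈-map⁺ (monomial A) (∈-exponents⁺ (exponents-small 2≤A n≤ lt))

  grid-closed₁ : ∀ {r n a b} {A : Vec ℕ r} → All (2 ≤_) (a ∷ b ∷ A) → ∀ {h} → h ∈ grid (a ∷ b ∷ A) n → a * h < n → a * h ∈ grid (a ∷ b ∷ A) n
  grid-closed₁ {n = n} {a} {b} {A} 2≤A h∈ lt with grid⁻ {n = n} {A = a ∷ b ∷ A} 2≤A h∈
  ... | _ , x ∷ v , refl = subst (_∈ grid (a ∷ b ∷ A) n) eq (grid⁺ {n = n} {A = a ∷ b ∷ A} 2≤A (suc x ∷ v) (subst (_< n) (sym eq) lt))
    where
    eq : monomial (a ∷ b ∷ A) (suc x ∷ v) ≡ a * monomial (a ∷ b ∷ A) (x ∷ v)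
    eq = *-assoc a (a ^ x) (monomial (b ∷ A) v)

  grid-closed₂ : ∀ {r n a b} {A : Vec ℕ r} → All (2 ≤_) (a ∷ b ∷ A) → ∀ {h} → h ∈ grid (a ∷ b ∷ A) n → b * h < n → b * h ∈ grid (a ∷ b ∷ A) n
  grid-closed₂ {n = n} {a} {b} {A} 2≤A h∈ lt with grid⁻ {n = n} {A = a ∷ b ∷ A} 2≤A h∈
  ... | _ , x ∷ y ∷ v , refl = subst (_∈ grid (a ∷ b ∷ A) n) eq (grid⁺ {n = n} {A = a ∷ b ∷ A} 2≤A (x ∷ suc y ∷ v) (subst (_< n) (sym eq) lt))
    where
    eq : monomial (a ∷ b ∷ A) (x ∷ suc y ∷ v) ≡ b * monomial (a ∷ b ∷ A) (x ∷ y ∷ v)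
    eq = trans (cong (a ^ x *_) (*-assoc b (b ^ y) (monomial A v)))
      (trans (sym (*-assoc (a ^ x) b _)) (trans (cong (_* monomial (b ∷ A) (y ∷ v)) (*-comm (a ^ x) b)) (*-assoc b (a ^ x) _)))

  monomial-gap : ∀ {r a} {A : Vec ℕ r} → All (2 ≤_) A → All (a ≤_) A → ∀ v → 1 < monomial A v → a ≤ monomial A v
  monomial-gap []          []          []          1<1 = ⊥-elim (<-irrefl refl 1<1)
  monomial-gap {A = b ∷ A} (2≤b ∷ 2≤A) (a≤b ∷ a≤A) (zero ∷ v)  lt = subst (_ ≤_) (sym (*-identityˡ (monomial A v)))
    (monomial-gap 2≤A a≤A v (subst (1 <_) (*-identityˡ (monomial A v)) lt))
  monomial-gap {A = b ∷ A} (2≤b ∷ 2≤A) (a≤b ∷ a≤A) (suc x ∷ v) _  =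
    ≤-trans a≤b (≤-trans (m≤m*n b (b ^ x) {{m^n≢0 b x {{>-nonZero (<⇒≤ 2≤b)}}}}) (m≤m*n (b ^ suc x) (monomial A v) {{>-nonZero (1≤monomial 2≤A v)}}))

  monomial-zero : ∀ {r} (A : Vec ℕ r) → ∃ λ v → monomial A v ≡ 1
  monomial-zero []      = [] , refl
  monomial-zero (a ∷ A) with monomial-zero A
  ... | v , eq = 0 ∷ v , trans (*-identityˡ _) eq

  -- Isolates the final pass with gap 1, the only pass that disturbs the adversarial input.
  split-last : ∀ (L : List ℕ) → List.AllPairs _>_ L → (∀ {h} → h ∈ L → 1 ≤ h) → 1 ∈ L →
               ∃ λ H → L ≡ H ++ 1 ∷ [] × (∀ {h} → h ∈ H → h ∈ L × 1 < h)
  split-last (h ∷ [])     _           pos (here refl) = [] , refl , λ ()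
  split-last (h ∷ g ∷ L)  (h>L List.∷ _) pos (here refl) = ⊥-elim (<⇒≱ (ListAll.head h>L) (pos (there (here refl))))
  split-last (h ∷ L) (h>L List.∷ desc) pos (there 1∈L) with split-last L desc (pos ∘ there) 1∈L
  ... | H , refl , more = h ∷ H , refl , λ { (here refl) → here refl , ListAll.lookup h>L 1∈L
                                           ; (there h∈) → there (proj₁ (more h∈)) , proj₂ (more h∈) }

  grid-split : ∀ {r n a} {A : Vec ℕ r} → 2 ≤ n → All (2 ≤_) A → All (a ≤_) A →
               ∃ λ H → grid A n ≡ H ++ 1 ∷ [] × (∀ {h} → h ∈ H → a ≤ h)
  grid-split {n = n} {a} {A} 2≤n 2≤A a≤A with split-last (grid A n) (grid-descending {n = n} {A = A}) (grid-positive {n = n} {A = A} 2≤A) one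
    where
    one : 1 ∈ grid A n
    one with monomial-zero A
    ... | v , eq = subst (_∈ grid A n) eq (grid⁺ {n = n} {A = A} 2≤A v (subst (_< n) (sym eq) 2≤n))
  ... | H , eq , more = H , eq , coarse
    where
    coarse : ∀ {h} → h ∈ H → a ≤ h
    coarse h∈ with more h∈
    ... | h∈grid , 1<h with grid⁻ {n = n} {A = A} 2≤A h∈grid
    ...   | _ , v , refl = monomial-gap 2≤A a≤A v 1<h

  A≤maximum : ∀ {r} (A : Vec ℕ r) → All (_≤ maximum A) A
  A≤maximum A = toList⁻ (xs≤max 0 (toList A))

  minimum≤A : ∀ {r} (A : Vec ℕ r) → All (minimum A ≤_) A
  minimum≤A A = toList⁻ (min≤xs (maximum A) (toList A))

  maximum≤ : ∀ {r b} {A : Vec ℕ r} → All (_≤ b) A → maximum A ≤ b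
  maximum≤ A≤b = max≤v⁺ z≤n (toList⁺ A≤b)

  -- `minimum` folds from the default `maximum A`, so the bound must hold for that default too; a
  -- first entry between a and the maximum provides this.
  ≤minimum : ∀ {r a} {A : Vec ℕ (suc r)} → All (a ≤_) A → a ≤ minimum A
  ≤minimum {A = b ∷ A} (a≤b ∷ a≤A) = v≤min⁺ (≤-trans a≤b (All.head (A≤maximum (b ∷ A)))) (toList⁺ (a≤b ∷ a≤A))

  coprime-* : ∀ {a b c} → Coprime a b → Coprime a c → Coprime a (b * c)
  coprime-* {a} {b} {c} ab ac {d} (d∣a , d∣bc) = ac (d∣a , coprime-divisor {d} {b} {c} (λ (e∣d , e∣b) → ab (∣-trans e∣d d∣a , e∣b)) d∣bc)

  coprime-^ : ∀ {a b} → Coprime a b → ∀ k → Coprime a (b ^ k)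
  coprime-^ ab zero    (_ , d∣1) = ∣1⇒≡1 d∣1
  coprime-^ {a} {b} ab (suc k) = coprime-* {a} {b} {b ^ k} ab (coprime-^ ab k)

  coprime-monomial : ∀ {r a} {A : Vec ℕ r} → All (Coprime a) A → ∀ v → Coprime a (monomial A v)
  coprime-monomial []         []      (_ , d∣1) = ∣1⇒≡1 d∣1
  coprime-monomial {a = a} {b ∷ A} (ab ∷ aA) (k ∷ v) = coprime-* {a} {b ^ k} {monomial A v} (coprime-^ ab k) (coprime-monomial aA v)

  -- If x < y, cancelling a^x leaves a factor a on the right, so a divides m; being coprime to m, a
  -- would be 1.
  leading-exponent : ∀ {a} → 2 ≤ a → ∀ {m m′} → Coprime a m → ∀ x y → a ^ x * m ≡ a ^ y * m′ → y ≤ x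
  leading-exponent {a} 2≤a {m} {m′} coprime x y eq = ≮⇒≥ λ x<y → <⇒≢ 2≤a (sym (coprime (∣-refl , a∣m x<y)))
    where
    a∣m : x < y → a ∣ m
    a∣m x<y = divides-refl′ (*-cancelˡ-≡ m (a * (a ^ (y ∸ suc x) * m′)) (a ^ x) {{m^n≢0 a x {{>-nonZero (<⇒≤ 2≤a)}}}} (trans eq (begin
        a ^ y * m′                                  ≡⟨ cong (λ z → a ^ z * m′) (sym (m+[n∸m]≡n x<y)) ⟩
        a ^ (suc x + (y ∸ suc x)) * m′              ≡⟨ cong (_* m′) (trans (^-distribˡ-+-* a (suc x) (y ∸ suc x)) (trans (cong (_* a ^ (y ∸ suc x)) (*-comm a (a ^ x))) (*-assoc (a ^ x) a _))) ⟩
        a ^ x * (a * a ^ (y ∸ suc x)) * m′          ≡⟨ trans (*-assoc (a ^ x) _ m′) (cong (a ^ x *_) (*-assoc a _ m′)) ⟩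
        a ^ x * (a * (a ^ (y ∸ suc x) * m′))        ∎)))
      where
      open ≡-Reasoning
      divides-refl′ : ∀ {z} → m ≡ a * z → a ∣ m
      divides-refl′ {z} refl = m∣m*n z

  coprime⇒independent : ∀ {r} {A : Vec ℕ r} → All (2 ≤_) A → PairwiseCoprime A → Independent A
  coprime⇒independent []          []             []      []      _  = refl
  coprime⇒independent {A = a ∷ A} (2≤a ∷ 2≤A) (aA ∷ cop) (x ∷ v) (y ∷ w) eq
    with ≤-antisym (leading-exponent 2≤a (coprime-monomial aA w) y x (sym eq)) (leading-exponent 2≤a (coprime-monomial aA v) x y eq)
  ... | refl = cong (x ∷_) (coprime⇒independent 2≤A cop v w
        (*-cancelˡ-≡ _ _ (a ^ x) {{m^n≢0 a x {{>-nonZero (<⇒≤ 2≤a)}}}} eq))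

  coprime⇒gcd≡1 : ∀ {r} {A : Vec ℕ (suc (suc r))} → PairwiseCoprime A → gcdOf A ≡ 1
  coprime⇒gcd≡1 {A = a ∷ b ∷ A} ((ab ∷ _) ∷ _) = ab (gcd[m,n]∣m a _ , ∣-trans (gcd[m,n]∣n a _) (gcd[m,n]∣m b _))

-- Pairwise coprime generators with a small and cheap grid

module Construction where

  open import Defs
  open Costs
  open Grids
  open import Data.Nat
  open import Data.Nat.Properties
  open import Data.Nat.DivMod using (_/_; m/n*n≤m)
  open import Data.Nat.Divisibility
  open import Data.Nat.Coprimality using (Coprime)
  open import Data.Nat.Solver using (module +-*-Solver)
  open import Data.List using (length)
  open import Data.Vec using (Vec; []; _∷_)
  open import Data.Vec.Relation.Unary.All as All using (All; []; _∷_)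
  open import Data.Vec.Relation.Unary.AllPairs using ([]; _∷_)
  open import Data.Vec.Relation.Unary.Unique.Propositional using (Unique)
  open import Data.Product using (_,_; proj₁)
  open import Relation.Binary.PropositionalEquality
  open +-*-Solver using (solve; _:+_; _:*_; _:=_; con)

  ^-distribʳ-* : ∀ k m n → (m * n) ^ k ≡ m ^ k * n ^ k
  ^-distribʳ-* zero    m n = refl
  ^-distribʳ-* (suc k) m n = trans (cong (m * n *_) (^-distribʳ-* k m n))
    (solve 4 (λ m n p q → m :* n :* (p :* q) := m :* p :* (n :* q)) refl m n (m ^ k) (n ^ k))

  -- gens D 1 r lists 1 + D, 1 + 2 D, …, 1 + r D (Gödel's β-function).
  gens : ℕ → ℕ → (r : ℕ) → Vec ℕ r
  gens D k zero    = []
  gens D k (suc r) = suc (k * D) ∷ gens D (suc k) r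

  gens-≥ : ∀ D k r → All (suc (k * D) ≤_) (gens D k r)
  gens-≥ D k zero    = []
  gens-≥ D k (suc r) = ≤-refl ∷ All.map (≤-trans (s≤s (*-monoˡ-≤ D (n≤1+n k)))) (gens-≥ D (suc k) r)

  gens-≤ : ∀ D k r → All (_≤ suc ((k + r) * D)) (gens D k r)
  gens-≤ D k zero    = []
  gens-≤ D k (suc r) = s≤s (*-monoˡ-≤ D (m≤m+n k (suc r))) ∷
    subst (λ z → All (_≤ suc (z * D)) (gens D (suc k) r)) (sym (+-suc k r)) (gens-≤ D (suc k) r)

  -- A common divisor d divides (i + e)(1 + i D) - i (1 + (i + e) D) = e, hence D, hence 1.
  progression-coprime : ∀ D i e → e ∣ D → Coprime (suc (i * D)) (suc ((i + e) * D))
  progression-coprime D i e e∣D {d} (d∣a , d∣b) = ∣1⇒≡1 (∣m+n∣m⇒∣n (subst (d ∣_) (+-comm 1 (i * D)) d∣a) (∣n⇒∣m*n i (∣-trans d∣e e∣D)))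
    where
    d∣e : d ∣ e
    d∣e = ∣m+n∣m⇒∣n
      (subst (d ∣_) (solve 3 (λ i e D → (i :+ e) :* (con 1 :+ i :* D) := i :* (con 1 :+ (i :+ e) :* D) :+ e) refl i e D) (∣n⇒∣m*n (i + e) d∣a))
      (∣n⇒∣m*n i d∣b)

  gens-coprime : ∀ D r → (∀ e → 1 ≤ e → e ≤ r → e ∣ D) → ∀ k → PairwiseCoprime (gens D k r)
  gens-coprime D zero    _ k = []
  gens-coprime D (suc r) h k = head 1 r ≤-refl (subst (_≤ suc r) (+-comm 1 r) ≤-refl) ∷ gens-coprime D r (λ e 1≤e e≤r → h e 1≤e (m≤n⇒m≤1+n e≤r)) (suc k)
    where
    head : ∀ e m → 1 ≤ e → m + e ≤ suc r → All (Coprime (suc (k * D))) (gens D (e + k) m)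
    head e zero    1≤e le = []
    head e (suc m) 1≤e le =
      subst (λ z → Coprime (suc (k * D)) (suc (z * D))) (+-comm k e) (progression-coprime D k e (h e 1≤e (≤-trans (m≤n+m e (suc m)) le))) ∷
      head (suc e) m (s≤s z≤n) (subst (_≤ suc r) (sym (+-suc m e)) le)

  coprime⇒unique : ∀ {r} {A : Vec ℕ r} → All (2 ≤_) A → PairwiseCoprime A → Unique A
  coprime⇒unique []          []         = []
  coprime⇒unique {A = a ∷ A} (2≤a ∷ 2≤A) (aA ∷ cop) =
    All.map (λ {b} co a≡b → <⇒≢ 2≤a (sym (co (∣-refl , subst (a ∣_) a≡b ∣-refl)))) aA ∷ coprime⇒unique 2≤A cop

  ∣! : ∀ {r} e → 1 ≤ e → e ≤ r → e ∣ r !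
  ∣! (suc e) _ e≤r = ∣-trans (m∣m*n (e !)) (m≤n⇒m!∣n! e≤r)

  -- `N` encodes the admissible ratio as max ≤ min^(1 + 1/N), and `base` is the y in which the cost
  -- is measured. `few` and `many` enclose the size between multiples of k^r.
  record Economical (r N n k : ℕ) {{_ : NonZero r}} : Set where
    field
      base        : ℕ
      A           : Vec ℕ r
      1≤base      : 1 ≤ base
      base^k≤n    : base ^ k ≤ n
      generators  : Generators n A
      coprime     : PairwiseCoprime A
      independent : Independent A
      1≤minimum   : 1 ≤ minimum A
      1≤maximum   : 1 ≤ maximum A
      ratio       : maximum A ^ N ≤ minimum A ^ suc N
      few         : length (grid A n) ≤ k ^ r
      many        : suc (_/_ k (2 * r) {{m*n≢0 2 r}}) ^ r ≤ length (grid A n)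
      cheap       : C n (grid A n) ≤ length (grid A n) * (n * base ^ 5)

  -- The t in (1 + R t)² absorbs both the factor c and the step from t to t + 1, which together cost
  -- at most 2 c ≤ t.
  progression≤square : ∀ c R t .{{_ : NonZero R}} → 1 ≤ t → 2 * c ≤ t → suc (c * (R * suc t)) ≤ suc (R * t) ^ 2
  progression≤square c R t 1≤t 2c≤t = begin
    suc (c * (R * suc t))         ≤⟨ s≤s (*-monoʳ-≤ c (*-monoʳ-≤ R (+-monoˡ-≤ t 1≤t))) ⟩
    suc (c * (R * (t + t)))       ≡⟨ cong suc (solve 3 (λ a R t → a :* (R :* (t :+ t)) := R :* (con 2 :* a :* t)) refl c R t) ⟩
    suc (R * (2 * c * t))         ≤⟨ s≤s (*-monoʳ-≤ R (*-monoˡ-≤ t 2c≤t)) ⟩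
    suc (R * (t * t))             ≤⟨ s≤s (*-monoˡ-≤ (t * t) (m≤m*n R R)) ⟩
    suc (R * R * (t * t))         ≡⟨ cong suc (solve 2 (λ R t → R :* R :* (t :* t) := R :* t :* (R :* t)) refl R t) ⟩
    suc (z * z)                   ≤⟨ s≤s (m≤n+m (z * z) (z + z)) ⟩
    suc (z + z + z * z)           ≡⟨ solve 1 (λ z → con 1 :+ (z :+ z :+ z :* z) := (con 1 :+ z) :* ((con 1 :+ z) :* con 1)) refl z ⟩
    suc z ^ 2                     ∎
    where
    open ≤-Reasoning
    z = R * t

  -- The ratio b / m is at most the constant c, and c^N ≤ m makes this constant harmless once m is
  -- large.
  power-ratio : ∀ c N {D b m} → 1 ≤ c → b ≤ suc (c * D) → suc D ≤ m → c ^ N ≤ m → b ^ N ≤ m ^ suc N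
  power-ratio c N {D} {b} {m} 1≤c b≤ D<m c^N≤m = begin
    b ^ N               ≤⟨ ^-monoˡ-≤ N b≤ ⟩
    suc (c * D) ^ N     ≤⟨ ^-monoˡ-≤ N (+-monoˡ-≤ (c * D) 1≤c) ⟩
    (c + c * D) ^ N     ≡⟨ cong (_^ N) (sym (*-suc c D)) ⟩
    (c * suc D) ^ N     ≤⟨ ^-monoˡ-≤ N (*-monoʳ-≤ c D<m) ⟩
    (c * m) ^ N         ≡⟨ ^-distribʳ-* N c m ⟩
    c ^ N * m ^ N       ≤⟨ *-monoˡ-≤ (m ^ N) c^N≤m ⟩
    m ^ suc N           ∎
    where open ≤-Reasoning

  -- The reason for the divisor 2 r: a product of r powers, with generators at most y² and exponents
  -- at most k / (2 r), stays within y^k.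
  square-power : ∀ y r k .{{_ : NonZero y}} {{_ : NonZero (2 * r)}} → (y ^ 2) ^ (r * (k / (2 * r))) ≤ y ^ k
  square-power y r k = ≤-trans (≤-reflexive (^-*-assoc y 2 (r * q)))
      (^-monoʳ-≤ y (≤-trans (≤-reflexive (trans (sym (*-assoc 2 r q)) (*-comm (2 * r) q))) (m/n*n≤m k (2 * r))))
    where q = k / (2 * r)

  double : ∀ R t → 1 ≤ t → suc (R * suc t) ≤ 2 * suc (R * t)
  double R t 1≤t = begin
    suc (R * suc t)           ≤⟨ s≤s (*-monoʳ-≤ R (+-monoˡ-≤ t 1≤t)) ⟩
    suc (R * (t + t))         ≤⟨ n≤1+n _ ⟩
    2 + R * (t + t)           ≡⟨ solve 2 (λ R t → con 2 :+ R :* (t :+ t) := con 2 :* (con 1 :+ R :* t)) refl R t ⟩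
    2 * suc (R * t)           ∎
    where open ≤-Reasoning

  -- The origin of the exponent 5: the cost 2 (2 m² + 1) is at most 18 y², and y³ ≥ 27 because y ≥
  -- 3.
  per-key : ∀ {m y} → 3 ≤ y → m ≤ 2 * y → 2 * suc (2 * m * m) ≤ y ^ 5
  per-key {m} {y} 3≤y m≤2y = begin
    2 * suc (2 * m * m)               ≤⟨ *-monoʳ-≤ 2 (s≤s (*-mono-≤ (*-monoʳ-≤ 2 m≤2y) m≤2y)) ⟩
    2 * suc (2 * (2 * y) * (2 * y))   ≡⟨ solve 1 (λ y → con 2 :* (con 1 :+ con 2 :* (con 2 :* y) :* (con 2 :* y)) := con 2 :+ con 16 :* (y :* y)) refl y ⟩
    2 + 16 * (y * y)                  ≤⟨ +-monoˡ-≤ (16 * (y * y)) (*-monoʳ-≤ 2 (*-mono-≤ 1≤y 1≤y)) ⟩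
    2 * (y * y) + 16 * (y * y)        ≡⟨ sym (*-distribʳ-+ (y * y) 2 16) ⟩
    18 * (y * y)                      ≤⟨ *-monoˡ-≤ (y * y) (≤-trans (m≤m+n 18 9) (*-mono-≤ 3≤y (*-mono-≤ 3≤y 3≤y))) ⟩
    y * (y * y) * (y * y)             ≡⟨ solve 1 (λ y → y :* (y :* y) :* (y :* y) := y :* (y :* (y :* (y :* (y :* con 1))))) refl y ⟩
    y ^ 5                             ∎
    where
    open ≤-Reasoning
    1≤y = ≤-trans (s≤s z≤n) 3≤y

  odd : ∀ D {m} → m ≡ suc D → suc (suc (2 * D)) ≡ 2 * m
  odd D refl = solve 1 (λ D → con 2 :+ con 2 :* D := con 2 :* (con 1 :+ D)) refl D

  -- The number 3 + r′ is r + 1, for which `gens-≤` bounds all generators by 1 + (r + 1) D. The two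
  -- conditions on t are those of `progression≤square` and `power-ratio` for this factor.
  module _ (r′ N n k R t : ℕ) (2≤k : 2 ≤ k) (1≤R : 1 ≤ R) (e∣R : ∀ e → 1 ≤ e → e ≤ 2 + r′ → e ∣ R)
           (below : suc (R * t) ^ k < n) (above : n ≤ suc (R * suc t) ^ k)
           (4≤t : 2 * (3 + r′) ≤ t) (N≤t : (3 + r′) ^ N ≤ t) where

    private
      r y D m : ℕ
      r = 2 + r′
      y = suc (R * t)
      D = R * suc t
      m = suc (1 * D)
      gs : Vec ℕ r
      gs = gens D 1 r

      instance
        R≢0 : NonZero R
        R≢0 = >-nonZero 1≤R

      1≤t : 1 ≤ t
      1≤t = ≤-trans (s≤s z≤n) 4≤t

      m≡ : m ≡ suc D
      m≡ = cong suc (*-identityˡ D)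

      t≤y : t ≤ y
      t≤y = ≤-trans (m≤n*m t R) (n≤1+n _)

      t≤D : t ≤ D
      t≤D = ≤-trans (n≤1+n t) (m≤n*m (suc t) R)

      1≤D : 1 ≤ D
      1≤D = ≤-trans 1≤t t≤D

      2≤gs : All (2 ≤_) gs
      2≤gs = All.map (≤-trans (subst (2 ≤_) (sym m≡) (s≤s 1≤D))) (gens-≥ D 1 r)

      gs≤ : All (_≤ suc ((3 + r′) * D)) gs
      gs≤ = gens-≤ D 1 r

      top≤y² : suc ((3 + r′) * D) ≤ y ^ 2
      top≤y² = progression≤square (3 + r′) R t 1≤t 4≤t

      gs≤y² : All (_≤ y ^ 2) gs
      gs≤y² = All.map (λ le → ≤-trans le top≤y²) gs≤

      gs<n : All (_< n) gs
      gs<n = All.map (λ le → ≤-<-trans (≤-trans le (^-monoʳ-≤ y 2≤k)) below) gs≤y²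

      n≤gs^k : All (λ a → n ≤ a ^ k) gs
      n≤gs^k = All.map (λ le → ≤-trans above (^-monoˡ-≤ k (≤-trans (≤-reflexive (sym m≡)) le))) (gens-≥ D 1 r)

      cop : PairwiseCoprime gs
      cop = gens-coprime D r (λ e 1≤e e≤r → ∣m⇒∣m*n (suc t) (e∣R e 1≤e e≤r)) 1

      m≤min : m ≤ minimum gs
      m≤min = ≤minimum {A = gs} (gens-≥ D 1 r)

      ratio′ : maximum gs ^ N ≤ minimum gs ^ suc N
      ratio′ = power-ratio (3 + r′) N (s≤s z≤n) (maximum≤ {A = gs} gs≤) (subst (_≤ minimum gs) m≡ m≤min)
        (≤-trans N≤t (≤-trans t≤D (≤-trans (n≤1+n D) (subst (_≤ minimum gs) m≡ m≤min))))

      instance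
        2r≢0 : NonZero (2 * r)
        2r≢0 = m*n≢0 2 r

      box : ∀ v → All (_< suc (k / (2 * r))) v → monomial gs v < n
      box v v≤ = ≤-<-trans (monomial≤ {A = gs} {v} (m^n>0 y 2) gs≤y² (All.map ≤-pred v≤)) (≤-<-trans (square-power y r k) below)

      m≤2y : m ≤ 2 * y
      m≤2y = ≤-trans (≤-reflexive m≡) (double R t 1≤t)

      3≤y : 3 ≤ y
      3≤y = ≤-trans (≤-trans (m≤m+n 3 _) 4≤t) t≤y

      cheap′ : C n (grid gs n) ≤ length (grid gs n) * (n * y ^ 5)
      cheap′ = ≤-trans
        (C-upper n m (suc (2 * D)) (≤-trans (s≤s 1≤D) (≤-reflexive (sym m≡))) (s≤s (≤-trans 1≤D (m≤n*m D 2)))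
          (odd D m≡)
          (grid gs n) (grid-positive {n = n} {A = gs} 2≤gs) (λ h∈ → proj₁ (grid⁻ {n = n} {A = gs} 2≤gs h∈))
          (grid-closed₁ {n = n} 2≤gs) (grid-closed₂ {n = n} 2≤gs) (grid-descending {n = n} {A = gs}))
        (*-monoʳ-≤ (length (grid gs n)) (begin
          2 * n * suc (2 * m * m)       ≡⟨ trans (cong (_* suc (2 * m * m)) (*-comm 2 n)) (*-assoc n 2 _) ⟩
          n * (2 * suc (2 * m * m))     ≤⟨ *-monoʳ-≤ n (per-key {m} {y} 3≤y m≤2y) ⟩
          n * y ^ 5                     ∎))
        where open ≤-Reasoning

    economical : Economical r N n k
    economical = record
      { base        = y
      ; A           = gs
      ; 1≤base      = s≤s z≤n
      ; base^k≤n    = <⇒≤ below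
      ; generators  = record { inRange = All.zip (2≤gs , gs<n) ; distinct = coprime⇒unique 2≤gs cop }
      ; coprime     = cop
      ; independent = coprime⇒independent 2≤gs cop
      ; 1≤minimum   = ≤-trans (s≤s z≤n) m≤min
      ; 1≤maximum   = ≤-trans (s≤s z≤n) (All.head {xs = gens D 2 (1 + r′)} (A≤maximum gs))
      ; ratio       = ratio′
      ; few         = grid-few {n = n} {A = gs} 2≤gs {k} n≤gs^k
      ; many        = grid-large {n = n} {A = gs} 2≤gs {suc (k / (2 * r))} (coprime⇒independent 2≤gs cop) box
      ; cheap       = cheap′
      }

  -- Chosen so that (1 + threshold)^k < n ≤ (1 + r! (t + 1))^k forces t to be at least the sum of
  -- the two lower bounds required of it.
  threshold : (r′ N : ℕ) → ℕ
  threshold r′ N = (2 + r′) ! * suc (2 * (3 + r′) + (3 + r′) ^ N)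

  construct : ∀ r′ N {n k} → 2 ≤ k → suc (threshold r′ N) ^ k < n → Economical (2 + r′) N n k
  construct r′ N {n} {k} 2≤k large with crossing (λ t → suc ((2 + r′) ! * t) ^ k) n n 1<n n≤
    where
    R = (2 + r′) !
    k≢0 = >-nonZero (≤-trans (s≤s z≤n) 2≤k)
    1<n : suc (R * 0) ^ k < n
    1<n = ≤-<-trans (^-monoˡ-≤ k (s≤s (≤-trans (≤-reflexive (*-zeroʳ R)) z≤n))) large
    n≤ : n ≤ suc (R * n) ^ k
    n≤ = ≤-trans (≤-trans (m≤n*m n R {{(2 + r′) !≢0}}) (n≤1+n _))
      (subst (_≤ suc (R * n) ^ k) (^-identityʳ (suc (R * n))) (^-monoʳ-≤ (suc (R * n)) (≤-trans (s≤s z≤n) 2≤k)))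
  ... | t , below , above = economical r′ N n k ((2 + r′) !) t 2≤k (>-nonZero⁻¹ _ {{(2 + r′) !≢0}}) (λ e → ∣! e) below above
      (≤-trans (m≤m+n _ _) T≤t) (≤-trans (m≤n+m _ _) T≤t)
    where
    T≤t : 2 * (3 + r′) + (3 + r′) ^ N ≤ t
    T≤t = ≤-pred (<⇒≤ (*-cancelˡ-< ((2 + r′) !) _ _ (≤-pred (≰⇒> λ le → <⇒≱ large (≤-trans above (^-monoˡ-≤ k le))))))

-- Both bounds for fixed n and P

module Bounds where

  open import Defs
  open RealArithmetic using (_⊑_; ⊑-intro; ⊑-trans; ≈⇒⊑; ≈⇒⊒; ≈-trans; ≈-sym; _⊠_; cst; rat; ⊠-def; cst-def; u; eventually-map; cst-mono; cst-*; cst-⊠-rat; ⊠-monoʳ; ⊠-assoc; ⊠-comm; ⊠-congˡ; ⊠-identityˡ; 0⊑cst; 0⊑rat; 0≤u; 0⊑⊠; rat-positive)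
  open Exponential using (EXP; EXP-def)
  open Logarithm using (LOG; LOG-def)
  open Rates
  open Adversary using (module Reversal)
  open Grids
  open Construction
  open import Data.Nat
  open import Data.Nat.Properties
  open import Data.Nat.DivMod using (_/_; _%_; m≡m%n+[m/n]*n; m%n<n; m/n*n≤m; /-monoˡ-≤)
  open import Data.Integer as ℤ using (ℤ; ∣_∣)
  import Data.Rational as ℚ
  open import Data.List using (length)
  open import Data.Vec using (Vec)
  open import Data.Vec.Relation.Unary.All as All using (All; _∷_)
  open import Data.Product using (∃; _,_; _×_; proj₁; proj₂)
  open import Relation.Binary.PropositionalEquality

  nonNegative-bound : ∀ {m} z → ℤ.+ m ℤ.≤ z → z ≡ ℤ.+ ∣ z ∣ × m ≤ ∣ z ∣
  nonNegative-bound (ℤ.+ k) (ℤ.+≤+ m≤k) = refl , m≤k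

  0<u : ∀ k → ℚ.0ℚ ℚ.< u k
  0<u k = subst (ℚ.0ℚ ℚ.<_) (sym (CauchyLemmas.u≡mk k)) (ℚ.*<* (ℤ.+<+ (s≤s z≤n)))

  ⊑-from : ∀ {x y} x′ y′ → x ≡ x′ → y ≡ y′ → x′ ≤ℝ y′ → x ⊑ y
  ⊑-from x′ y′ refl refl h = ⊑-intro h

  ⊑-to : ∀ {x y} x′ y′ → x ≡ x′ → y ≡ y′ → x ⊑ y → x′ ≤ℝ y′
  ⊑-to x′ y′ refl refl (⊑-intro h) = h

  -- With explicit endpoints, since f = expℝ or c *ℝ_ would be unfolded to infer them.
  ℝ-cong : (f : ℝ → ℝ) (x y : ℝ) → x ≡ y → f x ≡ f y
  ℝ-cong f x y refl = refl

  EXP-⊠-def : ∀ c x → EXP (c ⊠ x) ≡ expℝ (c *ℝ x)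
  EXP-⊠-def c x = trans (EXP-def (c ⊠ x)) (ℝ-cong expℝ (c ⊠ x) (c *ℝ x) (⊠-def c x))

  littleO-⊑ : ∀ {P : ℕ → ℕ} r → LittleO (λ n → fromℕ (P n)) (λ n → log n ^ℕ r) →
              ∀ j → Eventually λ n → cst (P n) ⊑ rat (u j) ⊠ POW (LOG n) r
  littleO-⊑ {P} r o j = eventually-map
      {λ n → fromℕ (P n) ≤ℝ rat (u j) *ℝ (log n ^ℕ r)} {λ n → cst (P n) ⊑ rat (u j) ⊠ POW (LOG n) r}
      step (o (rat (u j)) (rat-positive (u j) (0<u j)))
    where
    eq : ∀ n → rat (u j) ⊠ POW (LOG n) r ≡ rat (u j) *ℝ (log n ^ℕ r)
    eq n = trans (⊠-def (rat (u j)) (POW (LOG n) r)) (ℝ-cong (rat (u j) *ℝ_) (POW (LOG n) r) (log n ^ℕ r)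
      (trans (POW-def (LOG n) r) (ℝ-cong (_^ℕ r) (LOG n) (log n) (LOG-def n))))
    step : ∀ n → fromℕ (P n) ≤ℝ rat (u j) *ℝ (log n ^ℕ r) → cst (P n) ⊑ rat (u j) ⊠ POW (LOG n) r
    step n le = ⊑-from (fromℕ (P n)) (rat (u j) *ℝ (log n ^ℕ r)) (cst-def (P n)) (eq n) le

  EXP-LOG-def : ∀ K m → EXP (K ⊠ LOG m) ≡ m ^ℝ K
  EXP-LOG-def K m = trans (EXP-⊠-def K (LOG m))
    (ℝ-cong (λ z → expℝ (K *ℝ z)) (LOG m) (log m) (LOG-def m))

  ratio-⊑ : ∀ {r} K (A : Vec ℕ r) → BoundedRatio K A → cst (maximum A) ⊑ EXP (K ⊠ LOG (minimum A))
  ratio-⊑ K A h = ⊑-from (fromℕ (maximum A)) (minimum A ^ℝ K) (cst-def (maximum A)) (EXP-LOG-def K (minimum A)) h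

  ⊑-ratio : ∀ {r} K (A : Vec ℕ r) → cst (maximum A) ⊑ EXP (K ⊠ LOG (minimum A)) → BoundedRatio K A
  ⊑-ratio K A h = ⊑-to (fromℕ (maximum A)) (minimum A ^ℝ K) (cst-def (maximum A)) (EXP-LOG-def K (minimum A)) h

  -- A grid with all generators in [a, a^K] contains every product with exponents at most m
  -- as long as a^(K r m) < n, so its size bounds m.
  record Spread (r K n : ℕ) (A : Vec ℕ r) : Set where
    field
      steps : ℕ
      reach : n ≤ minimum A ^ (K * r * suc steps)
      count : suc steps ^ r ≤ length (grid A n)

  spread : ∀ {s} K {n} {A : Vec ℕ (suc s)} → 1 ≤ K → 2 ≤ n → All (2 ≤_) A → Independent A →
           maximum A ≤ minimum A ^ K → Spread (suc s) K n A
  spread {s} K {n} {A} 1≤K 2≤n 2≤A indep max≤ = record { steps = m ; reach = above ; count = grid-large {n = n} {A = A} 2≤A {suc m} indep box }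
    where
    r = suc s
    a = minimum A
    2≤a : 2 ≤ a
    2≤a = ≤minimum {A = A} 2≤A
    1≤a : 1 ≤ a
    1≤a = <⇒≤ 2≤a
    n<2^n : ∀ n → n < 2 ^ n
    n<2^n zero    = s≤s z≤n
    n<2^n (suc n) = ≤-trans (s≤s (n<2^n n)) (≤-trans (+-monoˡ-≤ (2 ^ n) (m^n>0 2 n)) (≤-reflexive (cong (2 ^ n +_) (sym (+-identityʳ (2 ^ n))))))
    n≤ : n ≤ a ^ (K * r * n)
    n≤ = ≤-trans (<⇒≤ (n<2^n n)) (≤-trans (^-monoˡ-≤ n 2≤a) (^-monoʳ-≤ a {{>-nonZero 1≤a}} (m≤n*m n (K * r) {{m*n≢0 K r {{>-nonZero 1≤K}}}})))
    cross = crossing (λ j → a ^ (K * r * j)) n n (subst (λ z → a ^ z < n) (sym (*-zeroʳ (K * r))) 2≤n) n≤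
    m = proj₁ cross
    below : a ^ (K * r * m) < n
    below = proj₁ (proj₂ cross)
    above : n ≤ a ^ (K * r * suc m)
    above = proj₂ (proj₂ cross)
    box : ∀ v → All (_< suc m) v → monomial A v < n
    box v v≤ = ≤-<-trans
      (monomial≤ {A = A} {v} (m^n>0 a {{>-nonZero 1≤a}} K) (All.map (λ le → ≤-trans le max≤) (A≤maximum A)) (All.map ≤-pred v≤))
      (subst (_< n) (trans (cong (a ^_) (*-assoc K r m)) (sym (^-*-assoc a K (r * m)))) below)

  -- With b = (a - 1) / 4 rounded down, a ≤ 4 b + 4, and a ≥ 22 gives b ≥ 5, so a ≤ 5 b ≤ b². This
  -- is where 22 comes from.
  quarter : ∀ a → 22 ≤ a → 1 ≤ pred a / 4 × 4 * (pred a / 4) < a × a ≤ (pred a / 4) ^ 2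
  quarter (suc a) (s≤s 21≤a) = ≤-trans (s≤s z≤n) 5≤b , s≤s (≤-trans (≤-reflexive (*-comm 4 b)) (m/n*n≤m a 4)) , (begin
      suc a                   ≡⟨ cong suc (m≡m%n+[m/n]*n a 4) ⟩
      suc (a % 4) + b * 4     ≤⟨ +-monoˡ-≤ (b * 4) (m%n<n a 4) ⟩
      4 + b * 4               ≤⟨ +-monoˡ-≤ (b * 4) (≤-trans (n≤1+n 4) 5≤b) ⟩
      b + b * 4               ≡⟨ sym (*-suc b 4) ⟩
      b * 5                   ≤⟨ *-monoʳ-≤ b (≤-trans 5≤b (≤-reflexive (sym (*-identityʳ b)))) ⟩
      b ^ 2                   ∎)
    where
    open ≤-Reasoning
    b = a / 4
    5≤b : 5 ≤ b
    5≤b = /-monoˡ-≤ 4 21≤a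

  LowerBound : (r s j n P : ℕ) → Vec ℕ r → Set
  LowerBound r s j n P A = cst n ⊠ EXP (rat (u j) ⊠ RATE s P n) ⊑ cst (W n (grid A n))

  lower-at : ∀ {s} K j {n P} {A : Vec ℕ (suc s)} → 1 ≤ K → suc j ≡ K * suc s * 2 → 2 ≤ n →
    (∀ k → k ^ suc s ≤ P → (22 ^ (K * suc s)) ^ k < n) →
    Generators n A → Independent A → maximum A ≤ minimum A ^ K → length (grid A n) ≤ P →
    LowerBound (suc s) s j n P A
  lower-at {s} K j {n} {P} {A} 1≤K eq 2≤n small gen indep max≤ size =
    ⊑-trans (⊠-monoʳ (0⊑cst n) (EXP-RATE-upper s (K * suc s) j eq (s≤s z≤n) 1≤a (<⇒≤ 2≤n) (proj₁ q) (proj₂ (proj₂ q)) reach m^r≤P))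
    (⊑-trans (≈⇒⊒ (cst-* n b)) (cst-mono nb≤W))
    where
    a = minimum A
    b = pred a / 4
    2≤A : All (2 ≤_) A
    2≤A = All.map proj₁ (Generators.inRange gen)
    open Spread (spread K 1≤K 2≤n 2≤A indep max≤)
    m^r≤P : suc steps ^ suc s ≤ P
    m^r≤P = ≤-trans count size
    1≤a : 1 ≤ a
    1≤a = <⇒≤ (≤minimum {A = A} 2≤A)
    22≤a : 22 ≤ a
    -- If a < 22, then `reach` would give n ≤ 22^(K r m) with m^r ≤ P for m = `suc steps`, which the
    -- sparseness hypothesis `small` forbids.
    22≤a = ≮⇒≥ λ a<22 → <⇒≱ (small (suc steps) m^r≤P)
      (≤-trans reach (≤-trans (^-monoˡ-≤ (K * suc s * suc steps) (<⇒≤ a<22)) (≤-reflexive (sym (^-*-assoc 22 (K * suc s) (suc steps))))))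
    q = quarter a 22≤a
    a≤n : a ≤ n
    a≤n = ≤-trans (head (minimum≤A A)) (<⇒≤ (head (All.map proj₂ (Generators.inRange gen))))
      where
      head : ∀ {p} {B : Vec ℕ (suc s)} {Q : ℕ → Set p} → All Q B → Q (Data.Vec.head B)
      head (px ∷ _) = px
    nb≤W : n * b ≤ W n (grid A n)
    nb≤W with grid-split {n = n} {a = a} {A = A} 2≤n 2≤A (minimum≤A A)
    ... | H , split , coarse = subst (λ G → n * b ≤ W n G) (sym split)
      (Reversal.W-lower n a {{>-nonZero 1≤a}} H b coarse a≤n (proj₁ (proj₂ q)))

  UpperBound : (r s j n P : ℕ) → Vec ℕ r → Set
  UpperBound r s j n P A =
    (rat (u j) ⊠ cst P ⊑ cst (length (grid A n))) × length (grid A n) ≤ P ×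
    cst (C n (grid A n)) ⊑ cst n ⊠ cst P ⊠ EXP (cst 10 ⊠ RATE s P n)

  -- An integer r-th root of P. That k ≥ 2 matters for the construction: its generators are at most
  -- y², which must not exceed y^k < n.
  sandwich : ∀ s P → 2 ^ suc s ≤ P → ∃ λ k → 2 ≤ k × k ^ suc s ≤ P × P ≤ suc k ^ suc s
  sandwich s P 2^r≤P with crossing (λ j → j ^ suc s) (suc P) (suc P) (s≤s z≤n)
                           (m≤m*n (suc P) (suc P ^ s) {{m^n≢0 (suc P) s}})
  ... | k , below , above = k , ≮⇒≥ (λ k<2 → <⇒≱ above (≤-trans (^-monoˡ-≤ (suc s) k<2) 2^r≤P)) , ≤-pred below , <⇒≤ above

  -- The density constant is (2 r)^(-r): since k + 1 ≤ 2 r (k / (2 r) + 1), the box of exponents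
  -- already present in the grid has at least P / (2 r)^r points.
  upper-at : ∀ s N j {n P k} → suc j ≡ (2 * suc s) ^ suc s → 2 ≤ k → k ^ suc s ≤ P → P ≤ suc k ^ suc s →
             (E : Economical (suc s) N n k) → UpperBound (suc s) s j n P (Economical.A E)
  upper-at s N j {n} {P} {k} eq 2≤k k^r≤P P≤ E = dense , ≤-trans few k^r≤P , cost
    where
    open Economical E
    r = suc s
    L = length (grid A n)
    1≤k : 1 ≤ k
    1≤k = <⇒≤ 2≤k
    1≤P : 1 ≤ P
    1≤P = ≤-trans (m^n>0 k {{>-nonZero 1≤k}} r) k^r≤P
    instance
      2r≢0 : NonZero (2 * r)
      2r≢0 = m*n≢0 2 r
    1+k≤ : suc k ≤ 2 * r * suc (k / (2 * r))
    1+k≤ = ≤-trans (≤-reflexive (cong suc (m≡m%n+[m/n]*n k (2 * r))))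
      (≤-trans (+-monoˡ-≤ (k / (2 * r) * (2 * r)) (m%n<n k (2 * r)))
        (≤-reflexive (trans (cong (2 * r +_) (*-comm (k / (2 * r)) (2 * r))) (sym (*-suc (2 * r) (k / (2 * r)))))))
    P≤L : P ≤ suc j * L
    P≤L = ≤-trans P≤ (≤-trans (^-monoˡ-≤ r 1+k≤) (≤-trans (≤-reflexive (^-distribʳ-* r (2 * r) (suc (k / (2 * r)))))
      (subst (λ z → (2 * r) ^ r * suc (k / (2 * r)) ^ r ≤ z * L) (sym eq) (*-monoʳ-≤ ((2 * r) ^ r) many))))
    dense : rat (u j) ⊠ cst P ⊑ cst L
    dense = ⊑-trans (⊠-monoʳ (0⊑rat (0≤u j)) (⊑-trans (cst-mono P≤L) (≈⇒⊑ (cst-* (suc j) L))))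
      (≈⇒⊑ (≈-trans (≈-sym (⊠-assoc (rat (u j)) (cst (suc j)) (cst L)))
        (≈-trans (⊠-congˡ (≈-trans (⊠-comm (rat (u j)) (cst (suc j))) (cst-⊠-rat j))) (⊠-identityˡ (cst L)))))
    P≤2k^r : P ≤ (2 * k) ^ r
    P≤2k^r = ≤-trans P≤ (^-monoˡ-≤ r (≤-trans (+-monoˡ-≤ k 1≤k) (≤-reflexive (cong (k +_) (sym (+-identityʳ k))))))
    C≤ : C n (grid A n) ≤ n * P * base ^ 5
    C≤ = ≤-trans cheap (≤-trans (*-monoˡ-≤ (n * base ^ 5) (≤-trans few k^r≤P))
      (≤-reflexive (trans (sym (*-assoc P n (base ^ 5))) (cong (_* base ^ 5) (*-comm P n)))))
    cost : cst (C n (grid A n)) ⊑ cst n ⊠ cst P ⊠ EXP (cst 10 ⊠ RATE s P n)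
    cost = ⊑-trans (cst-mono C≤) (⊑-trans (≈⇒⊑ (≈-trans (cst-* (n * P) (base ^ 5)) (⊠-congˡ (cst-* n P))))
      (⊠-monoʳ (0⊑⊠ (0⊑cst n) (0⊑cst P)) (power⊑EXP-RATE s 1≤k 1≤P 1≤base base^k≤n P≤2k^r)))

-- Large n, minima, and translation back to the stated reals

module Parts where

  open import Defs
  open RealArithmetic using (_⊑_; ⊑-trans; ≈⇒⊑; ≈⇒⊒; _⊠_; cst; rat; ⊠-def; cst-def; rat-def; u; ι; both; eventually-map; archimedean; above-one; cst-mono; ⊠-monoʳ; ⊠-assoc; ⊠-identityˡ; 0⊑cst; rat-positive)
  open Exponential using (EXP)
  open Logarithm using (LOG; LOG-def)
  open Rates
  open Costs using (W≤C)
  open Grids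
  open Construction
  open Bounds
  open import Axiom.ExcludedMiddle using (ExcludedMiddle)
  open import Level using (0ℓ)
  open import Data.Nat
  open import Data.Nat.Properties
  open import Data.Nat.Induction using (<-rec)
  open import Data.Integer as ℤ using (ℤ; ∣_∣)
  import Data.Rational as ℚ
  open import Data.List using (List; length)
  open import Data.List.Membership.Propositional using (_∈_)
  open import Data.Vec using (Vec)
  open import Data.Vec.Relation.Unary.All as All using (All)
  open import Data.Product using (∃; _,_; _×_; proj₁; proj₂)
  open import Relation.Binary.PropositionalEquality
  open import Relation.Nullary using (yes; no)

  -- K is rounded up to an integer K′, and the constant is c = 1/(2 K′ r). It is fixed before p is
  -- given, as the theorem demands.
  lower-eventually : ∀ s K → ∃ λ j → (p : ℕ → ℤ) → LittleO (λ n → fromℕ ∣ p n ∣) (λ n → log n ^ℕ suc s) →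
    Eventually λ n → (A : Vec ℕ (suc s)) → Feasible K n (p n) A → LowerBound (suc s) s j n ∣ p n ∣ A
  lower-eventually s K = j , λ p o → eventually-map
      {λ n → (2 ≤ n) × (∀ k → k ^ suc s ≤ ∣ p n ∣ → suc (pred (22 ^ N)) ^ k < n)}
      (λ n (2≤n , small) A F → let open Feasible F in
        lower-at K′ j (s≤s z≤n) 1+j 2≤n
          -- `small-powers` speaks of a base `suc M`; here M + 1 = 22^N.
          (subst (λ z → ∀ k → k ^ suc s ≤ ∣ p n ∣ → z ^ k < n) (suc-pred (22 ^ N) {{m^n≢0 22 N}}) small)
          generators independent
          (ratio⇒≤^ K′ (1≤min A generators) K⊑K′ (ratio-⊑ K A ratio))
          (proj₂ (nonNegative-bound (p n) size)))
      (both (2 , λ n 2≤n → 2≤n) (small-powers {λ n → ∣ p n ∣} (suc s) (littleO-⊑ {λ n → ∣ p n ∣} (suc s) o) (pred (22 ^ N))))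
    where
    K′ N j : ℕ
    K′ = suc (proj₁ (archimedean K))
    N = K′ * suc s
    j = pred (N * 2)
    1+j : suc j ≡ N * 2
    1+j = suc-pred (N * 2) {{m*n≢0 N 2 {{m*n≢0 K′ (suc s)}}}}
    K⊑K′ : K ⊑ cst K′
    K⊑K′ = ⊑-trans (proj₂ (archimedean K)) (cst-mono (n≤1+n _))
    1≤min : ∀ {n} (A : Vec ℕ (suc s)) → Generators n A → 1 ≤ minimum A
    1≤min A gen = ≤minimum {A = A} (All.map (λ (2≤a , _) → <⇒≤ 2≤a) (Generators.inRange gen))

  -- Shifted by one because `u` is: `u (density r)` is (2 r)^(-r).
  density : ℕ → ℕ
  density r = pred ((2 * r) ^ r)

  record Witness (s : ℕ) (K : ℝ) (n P : ℕ) : Set where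
    field
      A           : Vec ℕ (suc s)
      generators  : Generators n A
      coprime     : PairwiseCoprime A
      independent : Independent A
      ratio       : BoundedRatio K A
      bounds      : UpperBound (suc s) s (density (suc s)) n P A
      positive    : 1 ≤ P

  witness-from : ∀ {s K n P k} N → cst (suc (suc N)) ⊑ cst (suc N) ⊠ K → 2 ≤ k → k ^ suc s ≤ P → P ≤ suc k ^ suc s →
                 Economical (suc s) (suc N) n k → Witness s K n P
  witness-from {s} {K} {k = k} N hK 2≤k k^r≤P P≤ E = record
      { A           = A
      ; generators  = generators
      ; coprime     = coprime
      ; independent = independent
      ; ratio       = ⊑-ratio K A (≤^⇒ratio N 1≤minimum 1≤maximum hK ratio)
      ; bounds      = upper-at s (suc N) (density (suc s)) (suc-pred ((2 * suc s) ^ suc s) {{m^n≢0 (2 * suc s) (suc s)}}) 2≤k k^r≤P P≤ E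
      ; positive    = ≤-trans (m^n>0 k {{>-nonZero (≤-trans (s≤s z≤n) 2≤k)}} (suc s)) k^r≤P
      }
    where open Economical E

  -- A hypothesis rather than a lemma in this module, so that the factorial in the threshold M
  -- is never unfolded.
  Constructible : ℕ → Set
  Constructible s = ∀ N → ∃ λ M → ∀ {n k} → 2 ≤ k → suc M ^ k < n → Economical (suc s) N n k

  upper-with : ∀ s K N M → cst (suc (suc N)) ⊑ cst (suc N) ⊠ K →
    (∀ {n k} → 2 ≤ k → suc M ^ k < n → Economical (suc s) (suc N) n k) →
    (p : ℕ → ℤ) → TendsToInfinity p → LittleO (λ n → fromℕ ∣ p n ∣) (λ n → log n ^ℕ suc s) →
    Eventually λ n → (p n ≡ ℤ.+ ∣ p n ∣) × Witness s K n ∣ p n ∣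
  upper-with s K N M hK construction p p→∞ o = eventually-map
      {λ n → (ℤ.+ (2 ^ suc s) ℤ.≤ p n) × (∀ k → k ^ suc s ≤ ∣ p n ∣ → suc M ^ k < n)}
      (λ n (large , small) → proj₁ (nonNegative-bound (p n) large) ,
        witness n ∣ p n ∣ (proj₂ (nonNegative-bound (p n) large)) small)
      (both (p→∞ (ℤ.+ (2 ^ suc s))) (small-powers {λ n → ∣ p n ∣} (suc s) (littleO-⊑ {λ n → ∣ p n ∣} (suc s) o) M))
    where
    witness : ∀ n P → 2 ^ suc s ≤ P → (∀ k → k ^ suc s ≤ P → suc M ^ k < n) → Witness s K n P
    witness n P 2^r≤P small with sandwich s P 2^r≤P
    ... | k , 2≤k , k^r≤P , P≤ = witness-from N hK 2≤k k^r≤P P≤ (construction 2≤k (small k k^r≤P))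

  upper-eventually : ∀ s → Constructible s → ∀ K → 1ℝ <ℝ K → (p : ℕ → ℤ) → TendsToInfinity p →
    LittleO (λ n → fromℕ ∣ p n ∣) (λ n → log n ^ℕ suc s) →
    Eventually λ n → (p n ≡ ℤ.+ ∣ p n ∣) × Witness s K n ∣ p n ∣
  upper-eventually s con K 1<K = upper-with s K N (proj₁ (con (suc N))) (proj₂ (above-one {K} 1<K)) (λ 2≤k lt → proj₂ (con (suc N)) 2≤k lt)
    where
    N : ℕ
    N = proj₁ (above-one {K} 1<K)

  decay-def : ∀ s P → decay s P ≡ P ^ℝ fromℚ (ℚ.- (ℤ.+ 1 ℚ./ suc s))
  decay-def s P = subst (λ q → EXP (rat q ⊠ LOG P) ≡ P ^ℝ fromℚ (ℚ.- (ℤ.+ 1 ℚ./ suc s))) (sym neg-u)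
    (trans (EXP-LOG-def (rat (ℚ.- (ℤ.+ 1 ℚ./ suc s))) P)
      (ℝ-cong (P ^ℝ_) (rat (ℚ.- (ℤ.+ 1 ℚ./ suc s))) (fromℚ (ℚ.- (ℤ.+ 1 ℚ./ suc s))) (rat-def (ℚ.- (ℤ.+ 1 ℚ./ suc s)))))
    where
    neg-u : ℚ.- u s ≡ ℚ.- (ℤ.+ 1 ℚ./ suc s)
    neg-u = refl

  ⊠-≡ : ∀ x x′ y y′ → x ≡ x′ → y ≡ y′ → x ⊠ y ≡ x′ *ℝ y′
  ⊠-≡ x .x y .y refl refl = ⊠-def x y

  RATE-def : ∀ s q n → RATE s ∣ q ∣ n ≡ rate (suc s) q n
  RATE-def s q n = trans
      (⊠-≡ (LOG n) (log n) (decay s ∣ q ∣) (∣ q ∣ ^ℝ fromℚ (ℚ.- (ℤ.+ 1 ℚ./ suc s))) (LOG-def n) (decay-def s ∣ q ∣))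
      unfolded
    where
    unfolded : log n *ℝ (∣ q ∣ ^ℝ fromℚ (ℚ.- (ℤ.+ 1 ℚ./ suc s))) ≡ rate (suc s) q n
    unfolded = refl

  EXP-RATE-def : ∀ c s q n → EXP (c ⊠ RATE s ∣ q ∣ n) ≡ expℝ (c *ℝ rate (suc s) q n)
  EXP-RATE-def c s q n = trans (EXP-⊠-def c (RATE s ∣ q ∣ n))
    (ℝ-cong (λ z → expℝ (c *ℝ z)) (RATE s ∣ q ∣ n) (rate (suc s) q n) (RATE-def s q n))

  scaled-def : ∀ m c s q n → cst m ⊠ EXP (c ⊠ RATE s ∣ q ∣ n) ≡ fromℕ m *ℝ expℝ (c *ℝ rate (suc s) q n)
  scaled-def m c s q n = ⊠-≡ (cst m) (fromℕ m) (EXP (c ⊠ RATE s ∣ q ∣ n)) (expℝ (c *ℝ rate (suc s) q n))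
    (cst-def m) (EXP-RATE-def c s q n)

  lower-form : ∀ c s q n m w → w ≤ m → cst n ⊠ EXP (c ⊠ RATE s ∣ q ∣ n) ⊑ cst w →
               fromℕ n *ℝ expℝ (c *ℝ rate (suc s) q n) ≤ℝ fromℕ m
  lower-form c s q n m w w≤m h = ⊑-to (fromℕ n *ℝ expℝ (c *ℝ rate (suc s) q n)) (fromℕ m)
    (scaled-def n c s q n) (cst-def m) (⊑-trans h (cst-mono w≤m))

  upper-form : ∀ c s q n m w → m ≤ w → cst w ⊑ cst n ⊠ EXP (c ⊠ RATE s ∣ q ∣ n) →
               fromℕ m ≤ℝ fromℕ n *ℝ expℝ (c *ℝ rate (suc s) q n)
  upper-form c s q n m w m≤w h = ⊑-to (fromℕ m) (fromℕ n *ℝ expℝ (c *ℝ rate (suc s) q n))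
    (cst-def m) (scaled-def n c s q n) (⊑-trans (cst-mono m≤w) h)

  cst-positive : ∀ k → 0ℝ <ℝ cst (suc k)
  cst-positive k = subst (0ℝ <ℝ_) (trans (rat-def (ι (suc k))) (sym (cst-def (suc k))))
    (rat-positive (ι (suc k)) (subst (ℚ.0ℚ ℚ.<_) (sym (CauchyLemmas.ι≡mk (suc k))) (ℚ.*<* (ℤ.+<+ (s≤s z≤n)))))

  grid≥1 : ∀ {r n K q} {A : Vec ℕ r} → Feasible K n q A → ∀ {h} → h ∈ grid A n → 1 ≤ h
  grid≥1 {n = n} {A = A} F = grid-positive {n = n} {A = A} (All.map proj₁ (Generators.inRange (Feasible.generators F)))

  -- Excluded middle enters here: feasibility contains an inequality between reals and a statement
  -- about all exponent vectors, so a least attained cost is not found by search.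
  least : ExcludedMiddle 0ℓ → (Q : ℕ → Set) → ∀ n → Q n → ∃ λ m → Q m × (∀ k → Q k → m ≤ k)
  least em Q = <-rec (λ n → Q n → ∃ λ m → Q m × (∀ k → Q k → m ≤ k)) step
    where
    step : ∀ n → (∀ {k} → k < n → Q k → ∃ λ m → Q m × (∀ k → Q k → m ≤ k)) → Q n → ∃ λ m → Q m × (∀ k → Q k → m ≤ k)
    step n rec qn with em {∃ λ k → k < n × Q k}
    ... | yes (k , k<n , qk) = rec k<n qk
    ... | no  none           = n , qn , λ k qk → ≮⇒≥ (λ k<n → none (k , k<n , qk))

  minimum-exists : ExcludedMiddle 0ℓ → {B : Set} (P : B → Set) (f : B → ℕ) → ∀ x → P x → ∃ λ m → IsMinimum P f m
  minimum-exists em P f x px with least em (λ m → ∃ λ x → P x × f x ≡ m) (f x) (x , px , refl)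
  ... | m , attained , minimal = m , attained , λ y py → minimal (f y) (y , py , refl)

  part₁ : ∀ s (K : ℝ) → ∃ λ c → 0ℝ <ℝ c ×
    ((p : ℕ → ℤ) → LittleO (λ n → fromℕ ∣ p n ∣) (λ n → log n ^ℕ suc s) →
     Eventually λ n → (A : Vec ℕ (suc s)) → Feasible K n (p n) A →
       (fromℕ n *ℝ expℝ (c *ℝ rate (suc s) (p n) n) ≤ℝ fromℕ (W n (grid A n))) ×
       (fromℕ n *ℝ expℝ (c *ℝ rate (suc s) (p n) n) ≤ℝ fromℕ (C n (grid A n))))
  part₁ s K = rat (u j) , rat-positive (u j) (0<u j) , λ p o → eventually-map
      {λ n → (A : Vec ℕ (suc s)) → Feasible K n (p n) A → LowerBound (suc s) s j n ∣ p n ∣ A}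
      (λ n low A F → conclude (p n) n A F (low A F)) (proj₂ (lower-eventually s K) p o)
    where
    j : ℕ
    j = proj₁ (lower-eventually s K)
    conclude : ∀ q n A → Feasible K n q A → LowerBound (suc s) s j n ∣ q ∣ A →
      (fromℕ n *ℝ expℝ (rat (u j) *ℝ rate (suc s) q n) ≤ℝ fromℕ (W n (grid A n))) ×
      (fromℕ n *ℝ expℝ (rat (u j) *ℝ rate (suc s) q n) ≤ℝ fromℕ (C n (grid A n)))
    conclude q n A F low = lower-form (rat (u j)) s q n (W n (grid A n)) (W n (grid A n)) ≤-refl low ,
      lower-form (rat (u j)) s q n (C n (grid A n)) (W n (grid A n)) (W≤C n (grid A n) (grid≥1 {A = A} F)) low

  part₂ : ∀ s → Constructible s → ∃ λ a → ∃ λ b → ∃ λ d → 0ℝ <ℝ a × 0ℝ <ℝ b × 0ℝ <ℝ d ×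
    ((K : ℝ) → 1ℝ <ℝ K → (p : ℕ → ℤ) → TendsToInfinity p →
     LittleO (λ n → fromℕ ∣ p n ∣) (λ n → log n ^ℕ (suc s)) →
     Eventually λ n → ∃ λ A →
       Generators {suc s} n A × PairwiseCoprime A × Independent A × BoundedRatio K A ×
       (a *ℝ fromℕ ∣ p n ∣ ≤ℝ fromℕ (length (grid A n))) ×
       (fromℕ (length (grid A n)) ≤ℝ b *ℝ fromℕ ∣ p n ∣) ×
       (ℤ.+ length (grid A n) ℤ.≤ p n) ×
       (fromℕ (C n (grid A n)) ≤ℝ fromℕ n *ℝ fromℕ ∣ p n ∣ *ℝ expℝ (d *ℝ rate (suc s) (p n) n)))
  -- The upper density constant is 1 because the grid has at most p elements, and 10 is the exponent
  -- from `power⊑EXP-RATE`.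
  part₂ s con = rat (u j) , cst 1 , cst 10 , rat-positive (u j) (0<u j) , cst-positive 0 , cst-positive 9 ,
    λ K 1<K p p→∞ o → eventually-map {λ n → (p n ≡ ℤ.+ ∣ p n ∣) × Witness s K n ∣ p n ∣}
      (λ n (q≡ , w) → conclude K (p n) n q≡ w) (upper-eventually s con K 1<K p p→∞ o)
    where
    j : ℕ
    j = density (suc s)
    conclude : ∀ K q n → q ≡ ℤ.+ ∣ q ∣ → Witness s K n ∣ q ∣ → ∃ λ A →
       Generators {suc s} n A × PairwiseCoprime A × Independent A × BoundedRatio K A ×
       (rat (u j) *ℝ fromℕ ∣ q ∣ ≤ℝ fromℕ (length (grid A n))) ×
       (fromℕ (length (grid A n)) ≤ℝ cst 1 *ℝ fromℕ ∣ q ∣) ×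
       (ℤ.+ length (grid A n) ℤ.≤ q) ×
       (fromℕ (C n (grid A n)) ≤ℝ fromℕ n *ℝ fromℕ ∣ q ∣ *ℝ expℝ (cst 10 *ℝ rate (suc s) q n))
    conclude K q n q≡ w = A , generators , coprime , independent , ratio ,
        ⊑-to (rat (u j) *ℝ fromℕ ∣ q ∣) (fromℕ L) (⊠-≡ (rat (u j)) (rat (u j)) (cst ∣ q ∣) (fromℕ ∣ q ∣) refl (cst-def ∣ q ∣)) (cst-def L) (proj₁ bounds) ,
        ⊑-to (fromℕ L) (cst 1 *ℝ fromℕ ∣ q ∣) (cst-def L) (⊠-≡ (cst 1) (cst 1) (cst ∣ q ∣) (fromℕ ∣ q ∣) refl (cst-def ∣ q ∣))
          (⊑-trans (cst-mono (proj₁ (proj₂ bounds))) (≈⇒⊒ (⊠-identityˡ (cst ∣ q ∣)))) ,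
        subst (ℤ.+ L ℤ.≤_) (sym q≡) (ℤ.+≤+ (proj₁ (proj₂ bounds))) ,
        ⊑-to (fromℕ (C n (grid A n))) (fromℕ n *ℝ fromℕ ∣ q ∣ *ℝ expℝ (cst 10 *ℝ rate (suc s) q n)) (cst-def (C n (grid A n)))
          (⊠-≡ (cst n ⊠ cst ∣ q ∣) (fromℕ n *ℝ fromℕ ∣ q ∣) (EXP (cst 10 ⊠ RATE s ∣ q ∣ n)) (expℝ (cst 10 *ℝ rate (suc s) q n))
            (⊠-≡ (cst n) (fromℕ n) (cst ∣ q ∣) (fromℕ ∣ q ∣) (cst-def n) (cst-def ∣ q ∣)) (EXP-RATE-def (cst 10) s q n))
          (proj₂ (proj₂ bounds))
      where
      open Witness w
      L = length (grid A n)

  -- The case ε = 1, that is P ≤ exp(rate): enough to absorb the factor P of the upper bound,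
  -- raising its exponent from 10 to 11.
  littleO-rate : ∀ s (p : ℕ → ℤ) → LittleO (λ n → log ∣ p n ∣) (λ n → rate (suc s) (p n) n) →
                 Eventually λ n → LOG ∣ p n ∣ ⊑ RATE s ∣ p n ∣ n
  littleO-rate s p o = eventually-map
      {λ n → log ∣ p n ∣ ≤ℝ cst 1 *ℝ rate (suc s) (p n) n} {λ n → LOG ∣ p n ∣ ⊑ RATE s ∣ p n ∣ n}
      (λ n → step (p n) n) (o (cst 1) (cst-positive 0))
    where
    step : ∀ q n → log ∣ q ∣ ≤ℝ cst 1 *ℝ rate (suc s) q n → LOG ∣ q ∣ ⊑ RATE s ∣ q ∣ n
    step q n le = ⊑-trans
      (⊑-from (log ∣ q ∣) (cst 1 *ℝ rate (suc s) q n) (LOG-def ∣ q ∣)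
        (⊠-≡ (cst 1) (cst 1) (RATE s ∣ q ∣ n) (rate (suc s) q n) refl (RATE-def s q n)) le)
      (≈⇒⊑ (⊠-identityˡ (RATE s ∣ q ∣ n)))

  part₃ : ExcludedMiddle 0ℓ → ∀ s → Constructible s → (∀ {A : Vec ℕ (suc s)} → PairwiseCoprime A → gcdOf A ≡ 1) → (K : ℝ) → 1ℝ <ℝ K → ∃ λ c₁ → ∃ λ c₂ → 0ℝ <ℝ c₁ × 0ℝ <ℝ c₂ ×
    ((p : ℕ → ℤ) → TendsToInfinity p →
     LittleO (λ n → fromℕ ∣ p n ∣) (λ n → log n ^ℕ (suc s)) →
     LittleO (λ n → log ∣ p n ∣) (λ n → rate (suc s) (p n) n) →
     Eventually λ n →
       (∃ λ m → IsMinimum (Feasible {suc s} K n (p n)) (λ A → W n (grid A n)) m ×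
          (fromℕ n *ℝ expℝ (c₁ *ℝ rate (suc s) (p n) n) ≤ℝ fromℕ m) ×
          (fromℕ m ≤ℝ fromℕ n *ℝ expℝ (c₂ *ℝ rate (suc s) (p n) n))) ×
       (∃ λ m → IsMinimum (Feasible {suc s} K n (p n)) (λ A → C n (grid A n)) m ×
          (fromℕ n *ℝ expℝ (c₁ *ℝ rate (suc s) (p n) n) ≤ℝ fromℕ m) ×
          (fromℕ m ≤ℝ fromℕ n *ℝ expℝ (c₂ *ℝ rate (suc s) (p n) n))))
  part₃ em s con gcd-1 K 1<K = rat (u j) , cst 11 , rat-positive (u j) (0<u j) , cst-positive 10 , λ p p→∞ o o′ → eventually-map
      {λ n → (∀ A → Feasible K n (p n) A → LowerBound (suc s) s j n ∣ p n ∣ A) ×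
             ((p n ≡ ℤ.+ ∣ p n ∣) × Witness s K n ∣ p n ∣) × LOG ∣ p n ∣ ⊑ RATE s ∣ p n ∣ n}
      (λ n (low , (q≡ , w) , log≤) → conclude (p n) n low q≡ w log≤ W (λ A F → ≤-refl) (λ A F → W≤C n (grid A n) (grid≥1 {A = A} F)) ,
                                     conclude (p n) n low q≡ w log≤ C (λ A F → W≤C n (grid A n) (grid≥1 {A = A} F)) (λ A F → ≤-refl))
      (both (proj₂ (lower-eventually s K) p o) (both (upper-eventually s con K 1<K p p→∞ o) (littleO-rate s p o′)))
    where
    j : ℕ
    j = proj₁ (lower-eventually s K)
    -- Exchanges and comparisons are treated at once through any cost between W and C: the lower
    -- bound is applied to a minimiser `B`, the upper bound to the constructed set `A`.
    conclude : ∀ q n → (∀ A → Feasible K n q A → LowerBound (suc s) s j n ∣ q ∣ A) → q ≡ ℤ.+ ∣ q ∣ →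
      Witness s K n ∣ q ∣ → LOG ∣ q ∣ ⊑ RATE s ∣ q ∣ n → (cost : ℕ → List ℕ → ℕ) →
      (∀ A → Feasible {suc s} K n q A → W n (grid A n) ≤ cost n (grid A n)) →
      (∀ A → Feasible {suc s} K n q A → cost n (grid A n) ≤ C n (grid A n)) →
      ∃ λ m → IsMinimum (Feasible {suc s} K n q) (λ A → cost n (grid A n)) m ×
        (fromℕ n *ℝ expℝ (rat (u j) *ℝ rate (suc s) q n) ≤ℝ fromℕ m) ×
        (fromℕ m ≤ℝ fromℕ n *ℝ expℝ (cst 11 *ℝ rate (suc s) q n))
    conclude q n low q≡ w log≤ cost W≤ ≤C = m , isMin ,
        lower-form (rat (u j)) s q n m (W n (grid B n)) (subst (W n (grid B n) ≤_) costB (W≤ B FB)) (low B FB) ,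
        upper-form (cst 11) s q n m (C n (grid A n)) (≤-trans (proj₂ isMin A feasible) (≤C A feasible))
          (⊑-trans (proj₂ (proj₂ bounds)) (⊑-trans (≈⇒⊑ (⊠-assoc (cst n) (cst ∣ q ∣) (EXP (cst 10 ⊠ RATE s ∣ q ∣ n))))
            (⊠-monoʳ (0⊑cst n) (absorb-P s positive log≤))))
      where
      open Witness w
      feasible : Feasible K n q A
      feasible = record { generators = generators ; independent = independent ; gcd≡1 = gcd-1 {A} coprime ; ratio = ratio
                        ; size = subst (ℤ.+ length (grid A n) ℤ.≤_) (sym q≡) (ℤ.+≤+ (proj₁ (proj₂ bounds))) }
      least-cost = minimum-exists em (Feasible {suc s} K n q) (λ A → cost n (grid A n)) A feasible
      m = proj₁ least-cost
      isMin = proj₂ least-cost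
      B = proj₁ (proj₁ isMin)
      FB = proj₁ (proj₂ (proj₁ isMin))
      costB = proj₂ (proj₂ (proj₁ isMin))

-- Assembly of the three parts

open import Defs
open import Axiom.ExcludedMiddle using (ExcludedMiddle)
open import Level using (0ℓ)
open import Data.Nat using (ℕ; _≤_; NonZero)
open import Data.Integer as ℤ using (ℤ; +_; ∣_∣)
open import Data.List using (length)
open import Data.Product using (∃-syntax; _×_)
open import Data.Vec using (Vec)
open import Data.Nat using (suc; s≤s; z≤n)
open import Data.Product using (_,_; proj₁; proj₂)
open Grids using (coprime⇒gcd≡1)
open Construction using (threshold; construct)
open Parts using (part₁; part₂; part₃)

theorem3p1 : ExcludedMiddle 0ℓ →
    (r : ℕ) .{{_ : NonZero r}} → 2 ≤ r →
    ((K : ℝ) → 1ℝ <ℝ K →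
    ∃[ c ] 0ℝ <ℝ c ×
    ((p : ℕ → ℤ) → TendsToInfinity p →
    LittleO (λ n → fromℕ ∣ p n ∣) (λ n → log n ^ℕ r) →
    Eventually λ n → (A : Vec ℕ r) → Feasible K n (p n) A →
    (fromℕ n *ℝ expℝ (c *ℝ rate r (p n) n) ≤ℝ fromℕ (W n (grid A n))) ×
    (fromℕ n *ℝ expℝ (c *ℝ rate r (p n) n) ≤ℝ fromℕ (C n (grid A n)))))
    ×
    (∃[ a ] ∃[ b ] ∃[ d ] 0ℝ <ℝ a × 0ℝ <ℝ b × 0ℝ <ℝ d ×
    ((K : ℝ) → 1ℝ <ℝ K →
    (p : ℕ → ℤ) → TendsToInfinity p →
    LittleO (λ n → fromℕ ∣ p n ∣) (λ n → log n ^ℕ r) →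
    Eventually λ n → ∃[ A ]
    Generators {r} n A × PairwiseCoprime A × Independent A × BoundedRatio K A ×
    (a *ℝ fromℕ ∣ p n ∣ ≤ℝ fromℕ (length (grid A n))) ×
    (fromℕ (length (grid A n)) ≤ℝ b *ℝ fromℕ ∣ p n ∣) ×
    (+ length (grid A n) ℤ.≤ p n) ×
    (fromℕ (C n (grid A n)) ≤ℝ fromℕ n *ℝ fromℕ ∣ p n ∣ *ℝ expℝ (d *ℝ rate r (p n) n))))
    ×
    ((K : ℝ) → 1ℝ <ℝ K →
    ∃[ c₁ ] ∃[ c₂ ] 0ℝ <ℝ c₁ × 0ℝ <ℝ c₂ ×
    ((p : ℕ → ℤ) → TendsToInfinity p →
    LittleO (λ n → fromℕ ∣ p n ∣) (λ n → log n ^ℕ r) →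
    LittleO (λ n → log ∣ p n ∣) (λ n → rate r (p n) n) →
    Eventually λ n →
    (∃[ m ] IsMinimum (Feasible {r} K n (p n)) (λ A → W n (grid A n)) m ×
    (fromℕ n *ℝ expℝ (c₁ *ℝ rate r (p n) n) ≤ℝ fromℕ m) ×
    (fromℕ m ≤ℝ fromℕ n *ℝ expℝ (c₂ *ℝ rate r (p n) n))) ×
    (∃[ m ] IsMinimum (Feasible {r} K n (p n)) (λ A → C n (grid A n)) m ×
    (fromℕ n *ℝ expℝ (c₁ *ℝ rate r (p n) n) ≤ℝ fromℕ m) ×
    (fromℕ m ≤ℝ fromℕ n *ℝ expℝ (c₂ *ℝ rate r (p n) n)))))
theorem3p1 em (suc (suc r′)) (s≤s (s≤s z≤n)) =
  (λ K _ → let c , 0<c , bound = part₁ (suc r′) K in c , 0<c , λ p _ → bound p) ,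
  part₂ (suc r′) con ,
  part₃ em (suc r′) con (λ {A} → coprime⇒gcd≡1 {A = A})
  where
  con : Parts.Constructible (suc r′)
  con N = threshold r′ N , construct r′ N
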